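{- Let $T$ be a 1-point lattice tetrahedron with $\mathrm{vol}(T)=n/6$ and interior lattice point $w$, and suppose that, up to a permutation of coordinates, the barycentric coordinates of $w$ with respect to $T$ equal one of $\lambda^{(1)}=(\tfrac14,\tfrac14,\tfrac14,\tfrac14)$, $\lambda^{(2)}=(\tfrac15,\tfrac15,\tfrac15,\tfrac25)$, $\lambda^{(3)}=(\tfrac17,\tfrac17,\tfrac27,\tfrac37)$, $\lambda^{(4)}=(\tfrac2{11},\tfrac1{11},\tfrac3{11},\tfrac5{11})$, $\lambda^{(5)}=(\tfrac1{13},\tfrac3{13},\tfrac4{13},\tfrac5{13})$, $\lambda^{(6)}=(\tfrac2{17},\tfrac3{17},\tfrac5{17},\tfrac7{17})$, $\lambda^{(7)}=(\tfrac3{19},\tfrac5{19},\tfrac4{19},\tfrac7{19})$, say to $\lambda^{(\ell)}$, whose entries have common denominator $N$ (namely $N=4,5,7,11,13,17,19$ respectively). Let $g=n/N$. If $g>1$, then $\ell=1$, $g=5$, and $T$ is equivalent to $T_{3,7,20}$, which is equivalent to $T_{3,11,20}$ and to $T_{7,11,20}$.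
   Context: A lattice tetrahedron is a non-degenerate tetrahedron with vertices in $\mathbb{Z}^3$; it is clean if the only lattice points on its boundary are its vertices, and a 1-point lattice tetrahedron if it is clean with exactly one interior lattice point. Barycentric coordinates of $w$ with respect to $T=\mathrm{conv}(v_1,\dots,v_4)$ are the reals $\lambda_j$ with $w=\sum\lambda_jv_j$, $\sum\lambda_j=1$. For $(a,b,n)\in\mathbb{Z}^3$, $n\ne0$, $T_{a,b,n}$ is the tetrahedron with vertices $(0,0,0),(1,0,0),(0,1,0),(a,b,n)$. Two lattice tetrahedra are equivalent if some map $v\mapsto Mv+u$ with $M\in M_3(\mathbb{Z})$, $\det M=\pm1$, $u\in\mathbb{Z}^3$ maps the vertex set of one onto the vertex set of the other (in any order). -}

module Defs where

open import Data.Nat using (ℕ; suc)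
open import Data.Integer as ℤ using (ℤ; +_; -[1+_]; ∣_∣)
open import Data.Rational as ℚ using (ℚ; 0ℚ; 1ℚ)
open import Data.Fin using (Fin; zero; suc)
open import Data.Fin.Permutation using (Permutation′; _⟨$⟩ʳ_)
open import Data.Product using (Σ; ∃; ∃-syntax; _×_; _,_)
open import Data.Sum using (_⊎_)
open import Relation.Binary.PropositionalEquality using (_≡_; _≢_)

Pt : Set
Pt = ℤ × ℤ × ℤ

coord : Pt → Fin 3 → ℤ
coord (x , y , z) zero = x
coord (x , y , z) (suc zero) = y
coord (x , y , z) (suc (suc zero)) = z

_-ᵖ_ : Pt → Pt → Pt
(a , b , c) -ᵖ (x , y , z) = (a ℤ.- x , b ℤ.- y , c ℤ.- z)

_+ᵖ_ : Pt → Pt → Pt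
(a , b , c) +ᵖ (x , y , z) = (a ℤ.+ x , b ℤ.+ y , c ℤ.+ z)

dot : Pt → Pt → ℤ
dot (a , b , c) (x , y , z) = a ℤ.* x ℤ.+ b ℤ.* y ℤ.+ c ℤ.* z

det3 : Pt → Pt → Pt → ℤ
det3 (a , b , c) (d , e , f) (g , h , i) =
  a ℤ.* (e ℤ.* i ℤ.- f ℤ.* h)
  ℤ.- b ℤ.* (d ℤ.* i ℤ.- f ℤ.* g)
  ℤ.+ c ℤ.* (d ℤ.* h ℤ.- e ℤ.* g)

Tet : Set
Tet = Fin 4 → Pt

v0 v1 v2 v3 : Fin 4
v0 = zero
v1 = suc zero
v2 = suc (suc zero)
v3 = suc (suc (suc zero))

detT : Tet → ℤ
detT T = det3 (T v1 -ᵖ T v0) (T v2 -ᵖ T v0) (T v3 -ᵖ T v0)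

NonDegenerate : Tet → Set
NonDegenerate T = detT T ≢ + 0

-- normalized volume n, i.e. vol(T) = n / 6
normVol : Tet → ℕ
normVol T = ∣ detT T ∣

toℚ : ℤ → ℚ
toℚ k = k ℚ./ 1

sum4 : (Fin 4 → ℚ) → ℚ
sum4 f = f v0 ℚ.+ f v1 ℚ.+ f v2 ℚ.+ f v3

IsBarycentric : Tet → (Fin 4 → ℚ) → Pt → Set
IsBarycentric T μ p =
  (sum4 μ ≡ 1ℚ) ×
  (∀ (k : Fin 3) → sum4 (λ j → μ j ℚ.* toℚ (coord (T j) k)) ≡ toℚ (coord p k))

-- p lies on the boundary of T (T non-degenerate): p ∈ T with some
-- barycentric coordinate equal to 0
OnBoundary : Tet → Pt → Set
OnBoundary T p = ∃[ μ ] (IsBarycentric T μ p × (∀ j → 0ℚ ℚ.≤ μ j) × (∃[ j ] μ j ≡ 0ℚ))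

Interior : Tet → Pt → Set
Interior T p = ∃[ μ ] (IsBarycentric T μ p × (∀ j → 0ℚ ℚ.< μ j))

Clean : Tet → Set
Clean T = ∀ (p : Pt) → OnBoundary T p → ∃[ i ] p ≡ T i

OnePointWith : Tet → Pt → Set
OnePointWith T w =
  NonDegenerate T × Clean T × Interior T w × (∀ (p : Pt) → Interior T p → p ≡ w)

Mat : Set
Mat = Pt × Pt × Pt

apply : Mat → Pt → Pt
apply (r₁ , r₂ , r₃) v = (dot r₁ v , dot r₂ v , dot r₃ v)

detM : Mat → ℤ
detM (r₁ , r₂ , r₃) = det3 r₁ r₂ r₃

Equivalent : Tet → Tet → Set
Equivalent T T' = ∃[ M ] ∃[ u ]
  ((detM M ≡ + 1 ⊎ detM M ≡ -[1+ 0 ]) ×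
   (∀ i → ∃[ j ] apply M (T i) +ᵖ u ≡ T' j) ×
   (∀ j → ∃[ i ] apply M (T i) +ᵖ u ≡ T' j))

Tabn : ℤ → ℤ → ℤ → Tet
Tabn a b n zero = (+ 0 , + 0 , + 0)
Tabn a b n (suc zero) = (+ 1 , + 0 , + 0)
Tabn a b n (suc (suc zero)) = (+ 0 , + 1 , + 0)
Tabn a b n (suc (suc (suc zero))) = (a , b , n)

-- The seven barycentric-coordinate vectors λ^(1),…,λ^(7);
-- index ℓ ∈ Fin 7 with zero ↔ ℓ = 1, …, 6 ↔ ℓ = 7.

denom : Fin 7 → ℕ
denom zero = 4
denom (suc zero) = 5
denom (suc (suc zero)) = 7
denom (suc (suc (suc zero))) = 11
denom (suc (suc (suc (suc zero)))) = 13
denom (suc (suc (suc (suc (suc zero))))) = 17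
denom (suc (suc (suc (suc (suc (suc zero)))))) = 19

vec4 : ℕ → ℕ → ℕ → ℕ → Fin 4 → ℕ
vec4 a b c d zero = a
vec4 a b c d (suc zero) = b
vec4 a b c d (suc (suc zero)) = c
vec4 a b c d (suc (suc (suc zero))) = d

numer : Fin 7 → Fin 4 → ℕ
numer zero = vec4 1 1 1 1
numer (suc zero) = vec4 1 1 1 2
numer (suc (suc zero)) = vec4 1 1 2 3
numer (suc (suc (suc zero))) = vec4 2 1 3 5
numer (suc (suc (suc (suc zero)))) = vec4 1 3 4 5
numer (suc (suc (suc (suc (suc zero))))) = vec4 2 3 5 7
numer (suc (suc (suc (suc (suc (suc zero)))))) = vec4 3 5 4 7

_/ᴺ_ : ℤ → Fin 7 → ℚ
k /ᴺ zero = k ℚ./ 4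
k /ᴺ (suc zero) = k ℚ./ 5
k /ᴺ (suc (suc zero)) = k ℚ./ 7
k /ᴺ (suc (suc (suc zero))) = k ℚ./ 11
k /ᴺ (suc (suc (suc (suc zero)))) = k ℚ./ 13
k /ᴺ (suc (suc (suc (suc (suc zero))))) = k ℚ./ 17
k /ᴺ (suc (suc (suc (suc (suc (suc zero)))))) = k ℚ./ 19

lam : Fin 7 → Fin 4 → ℚ
lam ℓ j = (+ numer ℓ j) /ᴺ ℓ

permLam : Fin 7 → Permutation′ 4 → Fin 4 → ℚ
permLam ℓ σ j = lam ℓ (σ ⟨$⟩ʳ j)

{-# OPTIONS --safe #-}
-- Let L be the lattice spanned by the edges of T.  Since T is clean, each barycentric coordinate
-- is injective on ℤ³ / L; hence ℤ³ / L is cyclic of order n = N g, generated by some u / n, and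
-- the lattice points of T other than the vertices are the k with Σⱼ (k uⱼ mod n) = n.  The only
-- one is w = c / N.  Replacing vᵢ by w gives a tetrahedron with no lattice points besides its
-- vertices, and White's theorem for it yields j ≠ i with cᵢ uⱼ ≡ (cⱼ - N) uᵢ modulo cᵢ n.
-- So q = (N - cⱼ) / cᵢ is an integer and uⱼ ≡ - q uᵢ modulo n.  Following these congruences from
-- vertex to vertex until a vertex recurs bounds g, and the remaining u are checked one by one.
module Submission where

-- No hypothesis bounds n directly, so a search can start only after the congruences have bounded
-- it. In a step from i to j the number (q - 1) cᵢ is the sum of the two remaining weights, so q ≥ 2
-- and the values 1, - q, q q′, ... carried along a walk grow in absolute value. When a vertex
-- recurs, n therefore divides a nonzero difference, and only finitely many differences arise. For
-- λ⁽¹⁾ every q is 3, the values are powers of - 3, and the surviving n = 20 divides (- 3)⁴ - 1 =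
-- 80. There, with u₃ = 1, the coordinates u are the powers 1, 17, 9, 13 of - 3 modulo 20 in some
-- order, so the remaining tetrahedra differ by a relabelling of vertices; this is how the three
-- normal forms come to be equivalent. The assumption g > 1 makes every tetrahedron with w in place
-- of vᵢ, of normalized volume cᵢ g, non-unimodular, as White's theorem requires.

-- Adding up inequalities; bounds on quotients as bounds on products.

module Inequalities where

  open import Data.Nat
  open import Data.Nat.Properties
  open import Data.Nat.DivMod
  open import Data.Empty using (⊥)
  open import Relation.Binary.PropositionalEquality

  -- The two lemmas below conclude from an inequality A ≤ B, a sum of the hypotheses at hand,
  -- together with a semiring identity.
  ≤-by : ∀ {A B x y} r → A ≤ B → x + B + r ≡ y + A → x ≤ y
  ≤-by {A} {B} {x} {y} r A≤B eq = +-cancelʳ-≤ B x y (≤-trans (m≤m+n (x + B) r) (≤-trans (≤-reflexive eq) (+-monoʳ-≤ y A≤B)))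

  ⊥-by : ∀ {A B} r → A ≤ B → A ≡ suc (B + r) → ⊥
  ⊥-by {A} {B} r A≤B eq = <-irrefl refl (≤-trans (s≤s (m≤m+n B r)) (≤-trans (≤-reflexive (sym eq)) A≤B))

  infixl 6 _⊕_
  _⊕_ : ∀ {a b c d} → a ≤ b → c ≤ d → a + c ≤ b + d
  _⊕_ = +-mono-≤

  module _ {m : ℕ} .{{_ : NonZero m}} where

    ≤/⇒*≤ : ∀ {s x} → s ≤ x / m → s * m ≤ x
    ≤/⇒*≤ {s} {x} h = ≤-trans (*-monoˡ-≤ m h) (m/n*n≤m x m)

    </⇒<* : ∀ {s x} → x / m ≤ s → x < suc s * m
    </⇒<* {s} {x} h = begin-strict
      x                      ≡⟨ m≡m%n+[m/n]*n x m ⟩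
      x % m + (x / m) * m    <⟨ +-mono-<-≤ (m%n<n x m) (*-monoˡ-≤ m h) ⟩
      m + s * m              ∎
      where open ≤-Reasoning

    *≤⇒≤/ : ∀ {s x} → s * m ≤ x → s ≤ x / m
    *≤⇒≤/ {s} {x} h = ≤-trans (≤-reflexive (sym (m*n/n≡m s m))) (/-monoˡ-≤ m h)

    <*⇒/≤ : ∀ {s x} → x < suc s * m → x / m ≤ s
    <*⇒/≤ h = s≤s⁻¹ (m<n*o⇒m/o<n h)

    /-unique : ∀ {s x} → s * m ≤ x → x < suc s * m → x / m ≡ s
    /-unique l u = ≤-antisym (<*⇒/≤ u) (*≤⇒≤/ l)

-- White's theorem, as a statement about sums of three floors.

module WhiteTheorem where

  open import Data.Nat
  open import Data.Nat.Properties
  open import Data.Nat.DivMod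
  open import Data.Nat.Tactic.RingSolver
  open import Data.List using ([]; _∷_)
  open import Data.Sum using (_⊎_; inj₁; inj₂)
  open import Data.Product using (∃-syntax; _×_; _,_)
  open import Data.Empty using (⊥; ⊥-elim)
  open import Relation.Nullary using (yes; no)
  open import Relation.Binary.PropositionalEquality
  open Inequalities

  module _ (m : ℕ) .{{_ : NonZero m}} where

    -- The witness is the quotient of s m - 1 by x; the predecessor keeps the lower bound strict
    -- even when x divides s m.
    first-multiple : ∀ x s → 0 < x → 0 < s * m → ∃[ q ] x * q < s * m × s * m ≤ x * suc q
    first-multiple x@(suc _) s 0<x 0<sm with s * m | 0<sm
    ... | suc y | _ = y / x , s≤s (≤-trans (≤-reflexive (*-comm x (y / x))) (m/n*n≤m y x)) , ≤-trans (</⇒<* {x} {y / x} ≤-refl) (≤-reflexive (*-comm (suc (y / x)) x))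

    -- Let T = t + 1 be the least integer with m ≤ c T, s = ⌊b t / m⌋, and q + 1 the least integer
    -- with s m ≤ b (q + 1).  Then ⌊d · / m⌋ jumps at q + 1 and at T, so it is positive at T - q,
    -- hence so is ⌊b · / m⌋.  This makes ⌊b · / m⌋ jump at T + 1, so that ⌊d · / m⌋ jumps at the
    -- consecutive places T and T + 1, against 2 d < m.
    no-double-floor : ∀ {b c d} → suc d ≡ b + c → 2 ≤ c → c ≤ b → 2 * d < m →
      (∀ k → 0 < k → k < m → b * k / m + c * k / m ≡ d * k / m) → ⊥
    no-double-floor {b} {c} {d} bc 2≤c c≤b 2d<m H
      with first-multiple c 1 (≤-trans (s≤s z≤n) 2≤c) (≤-trans (≤-trans (s≤s z≤n) 2d<m) (≤-reflexive (sym (+-identityʳ m))))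
    ... | t , ct<m , m≤ct+ = main
      where
      open ≤-Reasoning
      T = suc t
      c≤d : c ≤ d
      c≤d = ≤-by 1 (≤-reflexive (sym bc) ⊕ ≤-trans 2≤c c≤b) (solve (b ∷ c ∷ d ∷ []))
      3≤d : 3 ≤ d
      3≤d = ≤-by 0 (≤-reflexive (sym bc) ⊕ ≤-trans 2≤c c≤b ⊕ 2≤c) (solve (b ∷ c ∷ d ∷ []))
      7≤m : 7 ≤ m
      7≤m = ≤-by 0 (2d<m ⊕ 3≤d ⊕ 3≤d) (solve (d ∷ m ∷ []))
      0<t : 0 < t
      0<t = n≢0⇒n>0 λ t≡0 → ⊥-by d (2d<m ⊕ c≤d ⊕ ≤-trans m≤ct+ (≤-reflexive (cong (λ x → c * suc x) t≡0))) (solve (c ∷ d ∷ m ∷ []))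
      -- `H` will be used at T + 1 as well, so that place must still lie below m.
      t+2<m : suc T < m
      t+2<m = *-cancelˡ-≤ 2 (≤-by 2 (*-monoˡ-≤ t 2≤c ⊕ ct<m ⊕ 7≤m) (lem t (c * t) m))
        where
        lem : ∀ t x m → 2 * (3 + t) + (x + 1 * m + m) + 2 ≡ 2 * m + (2 * t + suc x + 7)
        lem = solve-∀
      t<m : t < m
      t<m = ≤-trans (m≤n+m (suc t) 2) t+2<m
      T<m : T < m
      T<m = ≤-trans (n≤1+n _) t+2<m
      s = b * t / m
      c/t≡0 : c * t / m ≡ 0
      c/t≡0 = m<n⇒m/n≡0 (≤-trans ct<m (≤-reflexive (+-identityʳ m)))
      d/t≡s : d * t / m ≡ s
      d/t≡s = trans (sym (H t 0<t t<m)) (trans (cong (s +_) c/t≡0) (+-identityʳ s))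
      dt<sm+m : d * t < suc s * m
      dt<sm+m = </⇒<* (≤-reflexive d/t≡s)
      1≤c/T : 1 ≤ c * T / m
      1≤c/T = *≤⇒≤/ m≤ct+
      d/T≤1+s : d * T / m ≤ suc s
      d/T≤1+s = <*⇒/≤ (≤-by (suc d) (dt<sm+m ⊕ 2d<m) (lem d t (s * m) m))
        where
        lem : ∀ d t x m → suc (d * suc t) + (m + x + m) + suc d ≡ (m + (m + x)) + (suc (d * t) + suc (2 * d))
        lem = solve-∀
      s≤b/T : s ≤ b * T / m
      s≤b/T = /-monoˡ-≤ m (*-monoʳ-≤ b (n≤1+n t))
      b/T≤s : b * T / m ≤ s
      b/T≤s = s≤s⁻¹ (begin
        suc (b * T / m)          ≡⟨ +-comm 1 _ ⟩
        b * T / m + 1            ≤⟨ +-monoʳ-≤ _ 1≤c/T ⟩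
        b * T / m + c * T / m    ≡⟨ H T (s≤s z≤n) T<m ⟩
        d * T / m                ≤⟨ d/T≤1+s ⟩
        suc s                    ∎)
      sm+m≤dT : suc s * m ≤ d * T
      sm+m≤dT = ≤/⇒*≤ (begin
        suc s                    ≡⟨ +-comm 1 s ⟩
        s + 1                    ≤⟨ +-mono-≤ s≤b/T 1≤c/T ⟩
        b * T / m + c * T / m    ≡⟨ H T (s≤s z≤n) T<m ⟩
        d * T / m                ∎)
      0<s : 0 < s
      0<s = ≤-trans (*≤⇒≤/ (≤-trans m≤ct+ (*-monoˡ-≤ T c≤b))) b/T≤s
      main : ⊥
      main with first-multiple b s (≤-trans (s≤s z≤n) (≤-trans 2≤c c≤b)) (*-mono-≤ 0<s (≤-trans (s≤s z≤n) 7≤m))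
      ... | q , bq<sm , sm≤bq+ = clash
        where
        q<t : q < t
        q<t = *-cancelˡ-< b q t (≤-trans bq<sm (≤/⇒*≤ ≤-refl))
        -- As q < t, the term ⌊c q / m⌋ vanishes, so ⌊d q / m⌋ = ⌊b q / m⌋ < s. The place q = 0 is
        -- outside the range of `H` and is treated directly.
        dq<sm : d * q < s * m
        dq<sm with q ≟ 0
        ... | yes refl = ≤-trans (s≤s (≤-reflexive (*-zeroʳ d))) (*-mono-≤ 0<s (≤-trans (s≤s z≤n) 7≤m))
        ... | no q≢0 = ≰⇒> λ sm≤dq → <⇒≱ bq<sm (≤/⇒*≤ (begin
          s                       ≤⟨ *≤⇒≤/ sm≤dq ⟩
          d * q / m               ≡⟨ H q (n≢0⇒n>0 q≢0) (<-trans q<t t<m) ⟨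
          b * q / m + c * q / m   ≡⟨ cong (b * q / m +_) (m<n⇒m/n≡0 (≤-<-trans (*-monoʳ-≤ c (<⇒≤ q<t)) (≤-trans ct<m (≤-reflexive (+-identityʳ m))))) ⟩
          b * q / m + 0           ≡⟨ +-identityʳ _ ⟩
          b * q / m               ∎))
        P = T ∸ q
        q+P≡T : q + P ≡ T
        q+P≡T = m+[n∸m]≡n (≤-trans (<⇒≤ q<t) (n≤1+n t))
        m<dP : m < d * P
        m<dP = ≤-by 0 (≤-trans sm+m≤dT (≤-reflexive dT) ⊕ dq<sm) (lem m (d * P) (s * m) (d * q))
          where
          dT : d * T ≡ d * q + d * P
          dT = trans (cong (d *_) (sym q+P≡T)) (*-distribˡ-+ d q P)
          lem : ∀ m p x y → suc m + (y + p + x) + 0 ≡ p + (m + x + suc y)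
          lem = solve-∀
        P<m : P < m
        P<m = ≤-<-trans (m∸n≤m T q) T<m
        0<P : 0 < P
        0<P = n≢0⇒n>0 λ P≡0 → <⇒≱ m<dP (≤-trans (≤-reflexive (trans (cong (d *_) P≡0) (*-zeroʳ d))) z≤n)
        -- Otherwise c P ≤ b P < m, both floors vanish, and with them ⌊d P / m⌋, against m < d P.
        m≤bP : m ≤ b * P
        m≤bP = ≮⇒≥ λ bP<m → <⇒≱ m<dP (<⇒≤ (≤-trans (</⇒<* (≤-reflexive (trans (sym (H P 0<P P<m)) (cong₂ _+_ (m<n⇒m/n≡0 bP<m) (m<n⇒m/n≡0 (≤-<-trans (*-monoˡ-≤ P c≤b) bP<m)))))) (≤-reflexive (+-identityʳ m))))
        -- Split T + 1 = P + (q + 1): the product b P reaches m and b (q + 1) reaches s m.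
        sm+m≤bT+ : suc s * m ≤ b * suc T
        sm+m≤bT+ = begin
          m + s * m               ≤⟨ +-mono-≤ m≤bP sm≤bq+ ⟩
          b * P + b * suc q       ≡⟨ lem b P q ⟩
          b * suc (q + P)         ≡⟨ cong (λ x → b * suc x) q+P≡T ⟩
          b * suc T               ∎
          where
          lem : ∀ b p q → b * p + b * suc q ≡ b * suc (q + p)
          lem = solve-∀
        sm+2m≤dT+ : suc (suc s) * m ≤ d * suc T
        sm+2m≤dT+ = ≤/⇒*≤ (begin
          suc (suc s)                      ≡⟨ +-comm 1 (suc s) ⟩
          suc s + 1                        ≤⟨ +-mono-≤ (*≤⇒≤/ sm+m≤bT+) (≤-trans 1≤c/T (/-monoˡ-≤ m (*-monoʳ-≤ c (n≤1+n T)))) ⟩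
          b * suc T / m + c * suc T / m    ≡⟨ H (suc T) (s≤s z≤n) t+2<m ⟩
          d * suc T / m                    ∎)
        clash : ⊥
        clash = ⊥-by 1 (sm+2m≤dT+ ⊕ dt<sm+m ⊕ 2d<m) (lem d t m (s * m))
          where
          lem : ∀ d t m x → (m + (m + x)) + suc (d * t) + suc (2 * d) ≡ suc (d * suc (suc t) + (m + x) + m + 1)
          lem = solve-∀

    -- The tetrahedron with lattice generated by (a , b , c , - 1) / m in barycentric coordinates
    -- has no lattice points besides its vertices.
    Floors : ℕ → ℕ → ℕ → Set
    Floors a b c = ∀ k → 0 < k → k < m → suc (a * k / m + b * k / m + c * k / m) ≡ k

    floors-swap₁₂ : ∀ {a b c} → Floors a b c → Floors b a c
    floors-swap₁₂ {a} {b} {c} F k p q = trans (cong (λ x → suc (x + c * k / m)) (+-comm (b * k / m) (a * k / m))) (F k p q)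

    floors-swap₂₃ : ∀ {a b c} → Floors a b c → Floors a c b
    floors-swap₂₃ {a} {b} {c} F k p q = trans (cong suc (lem (a * k / m) (b * k / m) (c * k / m))) (F k p q)
      where
      lem : ∀ x y z → x + z + y ≡ x + y + z
      lem = solve-∀

    -- Since x k / m + x l / m = x, the number x exceeds the two floors by two fractional parts,
    -- together less than 2.
    floor-complement : ∀ x {k l} → k + l ≡ m → x ≤ suc (x * k / m + x * l / m)
    floor-complement x {k} {l} k+l≡m = s≤s⁻¹ (*-cancelʳ-< m x (suc (suc (x * k / m + x * l / m))) (begin-strict
      x * m                                          ≡⟨ cong (x *_) k+l≡m ⟨
      x * (k + l)                                    ≡⟨ *-distribˡ-+ x k l ⟩
      x * k + x * l                                  <⟨ +-mono-< (</⇒<* ≤-refl) (</⇒<* ≤-refl) ⟩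
      suc (x * k / m) * m + suc (x * l / m) * m      ≡⟨ lem (x * k / m) (x * l / m) m ⟩
      suc (suc (x * k / m + x * l / m)) * m          ∎))
      where
      open ≤-Reasoning
      lem : ∀ y z m → suc y * m + suc z * m ≡ suc (suc (y + z)) * m
      lem = solve-∀

    -- Here only one fractional part is left, and it is less than 1.
    floor-complement-exact : ∀ x {k l} → k + l ≡ m → x * k % m ≡ 0 → x ≤ x * k / m + x * l / m
    floor-complement-exact x {k} {l} k+l≡m r≡0 = s≤s⁻¹ (*-cancelʳ-< m x (suc (x * k / m + x * l / m)) (begin-strict
      x * m                                          ≡⟨ cong (x *_) k+l≡m ⟨
      x * (k + l)                                    ≡⟨ *-distribˡ-+ x k l ⟩
      x * k + x * l                                  <⟨ +-mono-≤-< (≤-reflexive xk) (</⇒<* ≤-refl) ⟩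
      x * k / m * m + suc (x * l / m) * m            ≡⟨ lem (x * k / m) (x * l / m) m ⟩
      suc (x * k / m + x * l / m) * m                ∎))
      where
      open ≤-Reasoning
      xk : x * k ≡ x * k / m * m
      xk = trans (m≡m%n+[m/n]*n (x * k) m) (cong (_+ x * k / m * m) r≡0)
      lem : ∀ y z m → y * m + suc z * m ≡ suc (y + z) * m
      lem = solve-∀

    -- Adding `Floors` at k and at m - k, the six floors sum to m - 2. If a k had residue 0, they
    -- would sum to at least a + (b - 1) + (c - 1) = m - 1.
    floors-total : ∀ {a b c} → a + b + c ≡ suc m → Floors a b c → ∀ {k} → 0 < k → k < m → 0 < a * k % m
    floors-total {a} {b} {c} abc F {k} 0<k k<m = n≢0⇒n>0 λ r≡0 →
      clash (a * k / m) (b * k / m) (c * k / m) (a * l / m) (b * l / m) (c * l / m)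
        (F k 0<k k<m) (F l (m<n⇒0<n∸m k<m) l<m)
        (floor-complement-exact a k+l≡m r≡0) (floor-complement b k+l≡m) (floor-complement c k+l≡m)
      where
      l = m ∸ k
      k+l≡m : k + l ≡ m
      k+l≡m = m+[n∸m]≡n (<⇒≤ k<m)
      l<m : l < m
      l<m = m∸n<m {m} {k} 0<k (≤-trans (s≤s z≤n) k<m)
        where
        m∸n<m : ∀ {m n} → 0 < n → 0 < m → m ∸ n < m
        m∸n<m {suc m} {suc n} _ _ = s≤s (m∸n≤m m n)
      clash : ∀ x y z x' y' z' → suc (x + y + z) ≡ k → suc (x' + y' + z') ≡ l → a ≤ x + x' → b ≤ suc (y + y') → c ≤ suc (z + z') → ⊥
      clash x y z x' y' z' e e' p q r =
        ⊥-by 0 (p ⊕ q ⊕ r ⊕ ≤-reflexive (sym abc) ⊕ ≤-reflexive k+l≡m ⊕ ≤-reflexive e ⊕ ≤-reflexive e') (lem a b c x y z x' y' z' k l m)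
        where
        lem : ∀ a b c x y z x' y' z' k l m →
          a + b + c + suc m + (k + l) + suc (x + y + z) + suc (x' + y' + z') ≡
          suc (x + x' + suc (y + y') + suc (z + z') + (a + b + c) + m + k + l + 0)
        lem = solve-∀

    -- Put d = b + c - 1, so that a + d = m. As a k is never divisible by m, ⌊a k / m⌋ = k - 1 - ⌊d
    -- k / m⌋, and `Floors` becomes the additivity refuted by `no-double-floor`.
    no-sorted-floors : ∀ {a b c} → a + b + c ≡ suc m → b ≤ a → c ≤ b → 2 ≤ c → Floors a b c → ⊥
    no-sorted-floors {a} {b} {c} abc b≤a c≤b 2≤c F = no-double-floor {d = d} 1+d≡b+c 2≤c c≤b 2d<m two-floors
      where
      d = b + c ∸ 1
      1+d≡b+c : suc d ≡ b + c
      1+d≡b+c = m+[n∸m]≡n (≤-trans (s≤s z≤n) (≤-trans 2≤c (m≤n+m c b)))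
      a+d≡m : a + d ≡ m
      a+d≡m = suc-injective (trans (sym (+-suc a d)) (trans (cong (a +_) 1+d≡b+c) (trans (sym (+-assoc a b c)) abc)))
      2<m : 2 < m
      2<m = ≤-by 2 (≤-reflexive abc ⊕ 2≤c ⊕ ≤-trans 2≤c c≤b ⊕ ≤-trans 2≤c (≤-trans c≤b b≤a)) (lem a b c m)
        where
        lem : ∀ a b c m → 3 + (suc m + c + b + a) + 2 ≡ m + (a + b + c + 2 + 2 + 2)
        lem = solve-∀
      0<r : ∀ {k} → 0 < k → k < m → 0 < a * k % m
      0<r = floors-total {a} {b} {c} abc F
      -- At k = 2 some floor must be positive, and a is the largest of the three numbers; equality 2
      -- a = m is excluded because 2 a has a nonzero residue.
      m<2a : m < a * 2
      m<2a with m ≤? a * 2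
      ... | yes m≤2a = ≤∧≢⇒< m≤2a λ m≡2a → <-irrefl (sym (trans (cong (_% m) (sym m≡2a)) (n%n≡0 m))) (0<r (s≤s z≤n) 2<m)
      ... | no m≰2a with F 2 (s≤s z≤n) 2<m
      ...   | F2 rewrite m<n⇒m/n≡0 (≰⇒> m≰2a) | m<n⇒m/n≡0 (≤-<-trans (*-monoˡ-≤ 2 b≤a) (≰⇒> m≰2a))
                       | m<n⇒m/n≡0 (≤-<-trans (*-monoˡ-≤ 2 (≤-trans c≤b b≤a)) (≰⇒> m≰2a)) with F2
      ...     | ()
      2d<m : 2 * d < m
      2d<m = ≤-by 0 (m<2a ⊕ ≤-reflexive a+d≡m ⊕ ≤-reflexive a+d≡m) (lem a d m)
        where
        lem : ∀ a d m → suc (2 * d) + (a * 2 + m + m) + 0 ≡ m + (suc m + (a + d) + (a + d))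
        lem = solve-∀
      -- From a k + d k = m k, the product d k falls short of a multiple of m by the residue of a k,
      -- which lies strictly between 0 and m.
      two-floors : ∀ k → 0 < k → k < m → b * k / m + c * k / m ≡ d * k / m
      two-floors k 0<k k<m = sym (/-unique
          (≤-by 0 (m%n≤n (a * k) m) (sym key₁))
          (≤-by 0 (0<r 0<k k<m) key₂))
        where
        x = a * k / m
        y = b * k / m
        z = c * k / m
        r = a * k % m
        key : d * k + r ≡ (y + z) * m + m
        key = +-cancelˡ-≡ (x * m) _ _ (trans (trans (lem₁ (x * m) (d * k) r) (cong (_+ d * k) (sym (m≡m%n+[m/n]*n (a * k) m))))
                (trans (sym (*-distribʳ-+ k a d)) (trans (cong₂ _*_ a+d≡m (sym (F k 0<k k<m))) (lem₂ m x y z))))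
          where
          lem₁ : ∀ p q r → p + (q + r) ≡ r + p + q
          lem₁ = solve-∀
          lem₂ : ∀ m x y z → m * suc (x + y + z) ≡ x * m + ((y + z) * m + m)
          lem₂ = solve-∀
        key₁ : d * k + r ≡ (y + z) * m + m + 0
        key₁ = trans key (sym (+-identityʳ _))
        key₂ : suc (d * k) + r + 0 ≡ suc (y + z) * m + 1
        key₂ = trans (lem (d * k) r) (trans (cong suc key) (lem₂ (y + z) m))
          where
          lem : ∀ p r → suc p + r + 0 ≡ suc (p + r)
          lem = solve-∀
          lem₂ : ∀ p m → suc (p * m + m) ≡ suc p * m + 1
          lem₂ = solve-∀

    floors-0< : ∀ {a b c} → 2 ≤ m → a + b + c ≡ suc m → Floors a b c → 0 < a
    floors-0< {a} {b} {c} 2≤m abc F = n≢0⇒n>0 λ a≡0 →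
      <-irrefl (sym (trans (cong (λ x → x * 1 % m) a≡0) (m<n⇒m%n≡m (≤-trans (s≤s z≤n) 2≤m)))) (floors-total {a} {b} {c} abc F (s≤s z≤n) 2≤m)

    -- If none of the three is 1, all are at least 2, and `no-sorted-floors` applies after sorting.
    -- For m = 1 the condition `Floors` is vacuous and 2, 0, 0 would be a counterexample, whence 2 ≤
    -- m.
    white : ∀ {a b c} → 2 ≤ m → a + b + c ≡ suc m → Floors a b c → a ≡ 1 ⊎ b ≡ 1 ⊎ c ≡ 1
    white {a} {b} {c} 2≤m abc F with a ≟ 1 | b ≟ 1 | c ≟ 1
    ... | yes p | _ | _ = inj₁ p
    ... | no _ | yes p | _ = inj₂ (inj₁ p)
    ... | no _ | no _ | yes p = inj₂ (inj₂ p)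
    ... | no a≢1 | no b≢1 | no c≢1 = ⊥-elim (sort (≤-total a b) (≤-total b c) (≤-total a c))
      where
      2≤ : ∀ {x} → x ≢ 1 → 0 < x → 2 ≤ x
      2≤ x≢1 0<x = ≤∧≢⇒< 0<x (≢-sym x≢1)
      bac : b + a + c ≡ suc m
      bac = trans (cong (_+ c) (+-comm b a)) abc
      acb : a + c + b ≡ suc m
      acb = trans (lem a b c) abc
        where
        lem : ∀ a b c → a + c + b ≡ a + b + c
        lem = solve-∀
      bca : b + c + a ≡ suc m
      bca = trans (lem a b c) abc
        where
        lem : ∀ a b c → b + c + a ≡ a + b + c
        lem = solve-∀
      cab : c + a + b ≡ suc m
      cab = trans (cong (_+ b) (+-comm c a)) acb
      cba : c + b + a ≡ suc m
      cba = trans (cong (_+ a) (+-comm c b)) bca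
      Fbac = floors-swap₁₂ {a} {b} {c} F
      Facb = floors-swap₂₃ {a} {b} {c} F
      Fbca = floors-swap₂₃ {b} {a} {c} Fbac
      Fcab = floors-swap₁₂ {a} {c} {b} Facb
      Fcba = floors-swap₁₂ {b} {c} {a} Fbca
      2≤a = 2≤ a≢1 (floors-0< 2≤m abc F)
      2≤b = 2≤ b≢1 (floors-0< 2≤m bac Fbac)
      2≤c = 2≤ c≢1 (floors-0< 2≤m cab Fcab)
      sort : a ≤ b ⊎ b ≤ a → b ≤ c ⊎ c ≤ b → a ≤ c ⊎ c ≤ a → ⊥
      sort (inj₁ a≤b) (inj₁ b≤c) _ = no-sorted-floors cba b≤c a≤b 2≤a Fcba
      sort (inj₂ b≤a) (inj₂ c≤b) _ = no-sorted-floors abc b≤a c≤b 2≤c F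
      sort (inj₁ a≤b) (inj₂ c≤b) (inj₁ a≤c) = no-sorted-floors bca c≤b a≤c 2≤a Fbca
      sort (inj₁ a≤b) (inj₂ c≤b) (inj₂ c≤a) = no-sorted-floors bac a≤b c≤a 2≤c Fbac
      sort (inj₂ b≤a) (inj₁ b≤c) (inj₁ a≤c) = no-sorted-floors cab a≤c b≤a 2≤b Fcab
      sort (inj₂ b≤a) (inj₁ b≤c) (inj₂ c≤a) = no-sorted-floors acb c≤a b≤c 2≤b Facb

-- The cyclic group of ℤ³ modulo the edge lattice, and White's theorem with w as a vertex.

module CyclicQuotient where

  open import Data.Nat
  open import Data.Nat.Properties
  open import Data.Nat.DivMod
  open import Data.Nat.Divisibility
  open import Data.Nat.Tactic.RingSolver
  open import Data.Fin using (Fin; zero; suc)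
  open import Data.Sum using (_⊎_; inj₁; inj₂)
  open import Data.Product using (∃-syntax; _×_; _,_; proj₁; proj₂)
  open import Data.Empty using (⊥; ⊥-elim)
  open import Relation.Binary.PropositionalEquality
  open import Algebra.Properties.CommutativeMonoid.Sum +-0-commutativeMonoid using (sum)
  open Inequalities
  open WhiteTheorem

  -- u / n and c / N are the barycentric coordinates of a generator of ℤ³ modulo the edge lattice
  -- and of w; age says that w is the only lattice point of T besides the vertices.
  record Core (n : ℕ) .{{_ : NonZero n}} (N g : ℕ) (c u : Fin 4 → ℕ) : Set where
    field
      n≡Ng : n ≡ N * g
      Σc≡N : sum c ≡ N
      0<c  : ∀ j → 0 < c j
      n∣Σu : n ∣ sum u
      age  : ∀ k → sum (λ j → k * u j % n) ≡ n → ∀ j → k * u j % n ≡ g * c j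
      wit  : ∃[ k ] (∀ j → k * u j % n ≡ g * c j)

  module _ (m : ℕ) .{{_ : NonZero m}} where

    -- Three residues sum to less than 3 m, which leaves three values in a residue class. The class
    -- is given by multiples of m on both sides, so that no subtraction occurs.
    three-residues : ∀ {k x y z s t} → k < m → x < m → y < m → z < m → x + y + z + s * m ≡ k + t * m →
      x + y + z ≡ k ⊎ x + y + z ≡ k + m ⊎ x + y + z ≡ k + (m + m)
    three-residues {k} {x} {y} {z} {s} {t} k<m x<m y<m z<m e = by-quotient (S / m) refl
      where
      S = x + y + z
      S%m≡k : S % m ≡ k
      S%m≡k = trans (sym ([m+kn]%n≡m%n S s m)) (trans (cong (_% m) e) (trans ([m+kn]%n≡m%n k t m) (m<n⇒m%n≡m k<m)))
      S≡ : ∀ {d} → S / m ≡ d → S ≡ k + d * m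
      S≡ e = trans (m≡m%n+[m/n]*n S m) (cong₂ (λ a b → a + b * m) S%m≡k e)
      by-quotient : ∀ d → S / m ≡ d → S ≡ k ⊎ S ≡ k + m ⊎ S ≡ k + (m + m)
      by-quotient 0 e = inj₁ (trans (S≡ e) (+-identityʳ k))
      by-quotient 1 e = inj₂ (inj₁ (trans (S≡ e) (cong (k +_) (+-identityʳ m))))
      by-quotient 2 e = inj₂ (inj₂ (trans (S≡ e) (cong (λ a → k + (m + a)) (+-identityʳ m))))
      by-quotient (suc (suc (suc d))) e = ⊥-elim (⊥-by (2 + k + d * m) (≤-reflexive (sym (S≡ e)) ⊕ x<m ⊕ y<m ⊕ z<m) (lem k (d * m) x y z m))
        where
        lem : ∀ k d x y z m → k + (m + (m + (m + d))) + suc x + suc y + suc z ≡ suc (x + y + z + m + m + m + (2 + k + d))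
        lem = solve-∀

    residue-complement : ∀ x {k l} → k + l ≡ m → 0 < x * k % m → x * k % m + x * l % m ≡ m
    residue-complement x {k} {l} k+l≡m 0<r = by-quotient (S / m) refl
      where
      S = x * k % m + x * l % m
      S%m≡0 : S % m ≡ 0
      S%m≡0 = trans (sym (%-distribˡ-+ (x * k) (x * l) m)) (trans (cong (_% m) (trans (sym (*-distribˡ-+ x k l)) (cong (x *_) k+l≡m))) (m*n%n≡0 x m))
      S≡ : ∀ {d} → S / m ≡ d → S ≡ d * m
      S≡ e = trans (m≡m%n+[m/n]*n S m) (cong₂ (λ a b → a + b * m) S%m≡0 e)
      by-quotient : ∀ d → S / m ≡ d → S ≡ m
      by-quotient 0 e = ⊥-elim (<⇒≱ 0<r (≤-trans (m≤m+n _ _) (≤-reflexive (S≡ e))))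
      by-quotient 1 e = trans (S≡ e) (+-identityʳ m)
      by-quotient (suc (suc d)) e = ⊥-elim (⊥-by (suc (d * m)) (≤-reflexive (sym (S≡ e)) ⊕ m%n<n (x * k) m ⊕ m%n<n (x * l) m) (lem m (d * m) (x * k % m) (x * l % m)))
        where
        lem : ∀ m d x y → (m + (m + d)) + suc x + suc y ≡ suc (x + y + m + m + suc d)
        lem = solve-∀

    %-*-expand : ∀ x k → x % m * k ≡ x * k % m + x % m * k / m * m
    %-*-expand x k = trans (m≡m%n+[m/n]*n (x % m * k) m) (cong (_+ x % m * k / m * m) (begin
      x % m * k % m                ≡⟨ %-distribˡ-* (x % m) k m ⟩
      x % m % m * (k % m) % m      ≡⟨ cong (λ y → y * (k % m) % m) (m%n%n≡m%n x m) ⟩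
      x % m * (k % m) % m          ≡⟨ %-distribˡ-* x k m ⟨
      x * k % m                    ∎))
      where open ≡-Reasoning

    %≡⇒≡+ : ∀ x {y} → x % m ≡ y → x ≡ y + x / m * m
    %≡⇒≡+ x refl = m≡m%n+[m/n]*n x m

  -- White's theorem for the tetrahedron whose vertices are w and the vertices of T other than
  -- v₀.  When u₀ ≡ - 1, the barycentric coordinates of the point k are - k for w and k aⱼ for
  -- the other vertices, in units of 1 / m, where N aⱼ = cⱼ + c₀ uⱼ and m = c₀ g.
  module _ {n N g : ℕ} .{{_ : NonZero n}} {c u : Fin 4 → ℕ} (C : Core n N g c u) (n∣1+u₀ : n ∣ suc (u zero)) (2≤m : 2 ≤ c zero * g) where

    open Core C

    private
      c₀ = c zero
      u₀ = u zero
      m = c₀ * g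

      instance
        m≢0 : NonZero m
        m≢0 = >-nonZero (≤-trans (s≤s z≤n) 2≤m)
        c₀≢0 : NonZero c₀
        c₀≢0 = >-nonZero (0<c zero)
        g≢0 : NonZero g
        g≢0 = m*n≢0⇒n≢0 c₀
        Ng≢0 : NonZero (N * g)
        Ng≢0 = subst NonZero n≡Ng (>-nonZero (n≢0⇒n>0 (≢-nonZero⁻¹ n)))
        N≢0 : NonZero N
        N≢0 = m*n≢0⇒m≢0 N

      K = proj₁ wit

      Nm≡c₀n : N * m ≡ c₀ * n
      Nm≡c₀n = trans (lem N c₀ g) (cong (c₀ *_) (sym n≡Ng))
        where
        lem : ∀ N c g → N * (c * g) ≡ c * (N * g)
        lem = solve-∀

      Ku : ∀ j → K * u j ≡ g * c j + (K * u j / n) * n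
      Ku j = trans (m≡m%n+[m/n]*n (K * u j) n) (cong (_+ K * u j / n * n) (proj₂ wit j))

      -- The multiple `K` of the generator is w, so K u₀ ≡ g c₀; with u₀ ≡ - 1 this reads K ≡ - g
      -- c₀.
      n∣K+gc₀ : n ∣ K + g * c₀
      n∣K+gc₀ = ∣m+n∣m⇒∣n {m = K * u₀ / n * n} (subst (n ∣_) e (∣n⇒∣m*n K n∣1+u₀)) (n∣m*n (K * u₀ / n))
        where
        lem : ∀ K x y → K + (x + y) ≡ y + (K + x)
        lem = solve-∀
        e : K * suc u₀ ≡ K * u₀ / n * n + (K + g * c₀)
        e = trans (*-suc K u₀) (trans (cong (K +_) (Ku zero)) (lem K (g * c₀) _))

      -- Combining K uⱼ ≡ g cⱼ with K ≡ - g c₀ shows that n = N g divides g (cⱼ + c₀ uⱼ).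
      N∣ : ∀ j → N ∣ c j + c₀ * u j
      N∣ j = *-cancelʳ-∣ g (subst₂ _∣_ n≡Ng (lem₂ g (c j) c₀ (u j))
               (∣m+n∣m⇒∣n {m = K * u j / n * n} (subst (n ∣_) e (∣m⇒∣m*n (u j) n∣K+gc₀)) (n∣m*n (K * u j / n))))
        where
        lem₁ : ∀ K u g c x y → K * u ≡ g * x + y → (K + g * c) * u ≡ y + g * (x + c * u)
        lem₁ K u g c x y e = trans (*-distribʳ-+ u K (g * c)) (trans (cong (_+ g * c * u) e) (lem g c u x y))
          where
          lem : ∀ g c u x y → g * x + y + g * c * u ≡ y + g * (x + c * u)
          lem = solve-∀
        e = lem₁ K (u j) g c₀ (c j) _ (Ku j)
        lem₂ : ∀ g c d u → g * (c + d * u) ≡ (c + d * u) * g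
        lem₂ = solve-∀

      a : Fin 3 → ℕ
      a j = quotient (N∣ (suc j))

      Na : ∀ j → c (suc j) + c₀ * u (suc j) ≡ a j * N
      Na j = m∣n⇒n≡quotient*m (N∣ (suc j))

      -- The sum of the three N aⱼ is N - c₀ (1 + u₀) + c₀ Σu, which is N modulo c₀ n = N m, because
      -- n divides 1 + u₀ and Σu. Division by N gives 1 modulo m.
      Σa : ∃[ s ] ∃[ t ] a zero + a (suc zero) + a (suc (suc zero)) + s * m ≡ 1 + t * m
      Σa = s , t , *-cancelˡ-≡ _ _ N
        (+-cancelʳ-≡ (c₀ * suc u₀) _ _ (trans
           (lem₁ N (a zero) (a (suc zero)) (a (suc (suc zero))) (s * m) _)
           (trans (cong₂ (λ p q → p + q + c₀ * suc u₀) (sym (cong₂ _+_ (cong₂ _+_ (Na zero) (Na (suc zero))) (Na (suc (suc zero))))) (scale s))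
           (trans (lem₂ (c (suc zero)) (c (suc (suc zero))) (c (suc (suc (suc zero)))) c₀ u₀ (u (suc zero)) (u (suc (suc zero))) (u (suc (suc (suc zero)))) (c₀ * (s * n)))
           (trans (cong₂ (λ p q → p + c₀ * q + c₀ * (s * n)) Σc≡N Σu≡)
           (trans (cong (λ q → N + q + c₀ * (s * n)) (sym (scale t)))
           (trans (cong (λ q → N + N * (t * m) + c₀ * q) (sym 1+u₀≡))
             (lem₃ N (t * m) _))))))))
        where
        s = quotient n∣1+u₀
        t = quotient n∣Σu
        1+u₀≡ = m∣n⇒n≡quotient*m n∣1+u₀
        Σu≡ = m∣n⇒n≡quotient*m n∣Σu
        scale : ∀ s → N * (s * m) ≡ c₀ * (s * n)
        scale s = trans (lem N s m) (trans (cong (s *_) Nm≡c₀n) (lem s c₀ n))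
          where
          lem : ∀ a b c → a * (b * c) ≡ b * (a * c)
          lem = solve-∀
        lem₁ : ∀ N x y z s w → N * (x + y + z + s) + w ≡ (x * N + y * N + z * N) + N * s + w
        lem₁ = solve-∀
        lem₂ : ∀ c₁ c₂ c₃ c₀ u₀ u₁ u₂ u₃ w → c₁ + c₀ * u₁ + (c₂ + c₀ * u₂) + (c₃ + c₀ * u₃) + w + c₀ * suc u₀ ≡
               (c₀ + (c₁ + (c₂ + (c₃ + 0)))) + c₀ * (u₀ + (u₁ + (u₂ + (u₃ + 0)))) + w
        lem₂ = solve-∀
        lem₃ : ∀ N t w → N + N * t + w ≡ N * (1 + t) + w
        lem₃ = solve-∀

      r : Fin 3 → ℕ → ℕ
      r j k = a j * k % m

      Σr : ∀ {k} → 0 < k → k < m →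
        r zero k + r (suc zero) k + r (suc (suc zero)) k ≡ k ⊎
        r zero k + r (suc zero) k + r (suc (suc zero)) k ≡ k + m ⊎
        r zero k + r (suc zero) k + r (suc (suc zero)) k ≡ k + (m + m)
      Σr {k} 0<k k<m = three-residues m {s = φ zero + φ (suc zero) + φ (suc (suc zero)) + s * k} {t = t * k} k<m (r<m zero) (r<m (suc zero)) (r<m (suc (suc zero))) e
        where
        s = proj₁ Σa
        t = proj₁ (proj₂ Σa)
        Σa≡ = proj₂ (proj₂ Σa)
        φ : Fin 3 → ℕ
        φ j = a j * k / m
        r<m : ∀ j → r j k < m
        r<m j = m%n<n (a j * k) m
        ak : ∀ j → r j k + φ j * m ≡ a j * k
        ak j = sym (m≡m%n+[m/n]*n (a j * k) m)
        lem : ∀ x y z X Y Z p q v k m → x + X * m ≡ p * k → y + Y * m ≡ q * k → z + Z * m ≡ v * k → p + q + v + s * m ≡ 1 + t * m →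
          x + y + z + (X + Y + Z + s * k) * m ≡ k + t * k * m
        lem x y z X Y Z p q v k m e₁ e₂ e₃ e₄ = trans (lem₁ x y z X Y Z s k m)
          (trans (cong₂ _+_ (cong₂ _+_ (cong₂ _+_ e₁ e₂) e₃) refl) (trans (lem₂ p q v k s m) (trans (cong (_* k) e₄) (lem₃ t k m))))
          where
          lem₁ : ∀ x y z X Y Z s k m → x + y + z + (X + Y + Z + s * k) * m ≡ (x + X * m) + (y + Y * m) + (z + Z * m) + s * k * m
          lem₁ = solve-∀
          lem₂ : ∀ p q v k s m → p * k + q * k + v * k + s * k * m ≡ (p + q + v + s * m) * k
          lem₂ = solve-∀
          lem₃ : ∀ t k m → (1 + t * m) * k ≡ k + t * k * m
          lem₃ = solve-∀
        e = lem (r zero k) (r (suc zero) k) (r (suc (suc zero)) k) (φ zero) (φ (suc zero)) (φ (suc (suc zero))) (a zero) (a (suc zero)) (a (suc (suc zero))) k m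
              (ak zero) (ak (suc zero)) (ak (suc (suc zero))) Σa≡

      -- These are the coordinates of the element k + K: at v₀ it has - k + g c₀ = m - k = l. By
      -- `age` it is w, whose coordinate at v₀ is g c₀ = m, larger than l.
      only-w : ∀ {k l} → 0 < k → 0 < l → k + l ≡ m → (y t : Fin 3 → ℕ) → (∀ j → y j + t j * n ≡ k * u (suc j) + g * c (suc j)) →
        l + (y zero + (y (suc zero) + (y (suc (suc zero)) + 0))) ≡ n → ⊥
      only-w {k} {l} 0<k 0<l k+l≡m y t y+tn l+Σy≡n = <⇒≢ l<m (trans (sym (proj₁ at-K')) (trans (age (k + K) Σ≡n zero) (*-comm g c₀)))
        where
        l<m : l < m
        l<m = ≤-trans (+-monoˡ-≤ l 0<k) (≤-reflexive k+l≡m)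
        residue : ∀ {x z} s → x ≡ z + s * n → z < n → x % n ≡ z
        residue {z = z} s e z<n = trans (cong (_% n) e) (trans ([m+kn]%n≡m%n z s n) (m<n⇒m%n≡m z<n))
        bounds : ∀ a b c → l + (a + (b + (c + 0))) ≡ n → a < n × b < n × c < n
        bounds a b c e =
          ≤-by (b + c) (≤-reflexive e ⊕ 0<l) (lem₁ l a b c n) ,
          ≤-by (a + c) (≤-reflexive e ⊕ 0<l) (lem₂ l a b c n) ,
          ≤-by (a + b) (≤-reflexive e ⊕ 0<l) (lem₃ l a b c n)
          where
          lem₁ : ∀ l a b c n → suc a + (n + l) + (b + c) ≡ n + (l + (a + (b + (c + 0))) + 1)
          lem₁ = solve-∀
          lem₂ : ∀ l a b c n → suc b + (n + l) + (a + c) ≡ n + (l + (a + (b + (c + 0))) + 1)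
          lem₂ = solve-∀
          lem₃ : ∀ l a b c n → suc c + (n + l) + (a + b) ≡ n + (l + (a + (b + (c + 0))) + 1)
          lem₃ = solve-∀
        y<n : ∀ j → y j < n
        y<n zero = proj₁ (bounds (y zero) (y (suc zero)) (y (suc (suc zero))) l+Σy≡n)
        y<n (suc zero) = proj₁ (proj₂ (bounds (y zero) (y (suc zero)) (y (suc (suc zero))) l+Σy≡n))
        y<n (suc (suc zero)) = proj₂ (proj₂ (bounds (y zero) (y (suc zero)) (y (suc (suc zero))) l+Σy≡n))
        l<n : l < n
        l<n = <-≤-trans l<m (≤-trans (*-monoˡ-≤ g (≤-trans (m≤m+n c₀ _) (≤-reflexive Σc≡N))) (≤-reflexive (sym n≡Ng)))
        at-K' : (k + K) * u₀ % n ≡ l × (∀ j → (k + K) * u (suc j) % n ≡ y j)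
        at-K' = residue (k * quotient n∣1+u₀ + K * u₀ / n)
                  (at-zero k K u₀ g c₀ l (K * u₀ / n) (quotient n∣1+u₀) n (Ku zero) (m∣n⇒n≡quotient*m n∣1+u₀) (trans k+l≡m (*-comm c₀ g))) l<n ,
                (λ j → residue (t j + K * u (suc j) / n)
                  (at-suc k K (u (suc j)) g (c (suc j)) (y j) (K * u (suc j) / n) (t j) n (Ku (suc j)) (y+tn j)) (y<n j))
          where
          at-zero : ∀ k K u g c l q s n → K * u ≡ g * c + q * n → suc u ≡ s * n → k + l ≡ g * c → (k + K) * u ≡ l + (k * s + q) * n
          at-zero k K u g c l q s n e₁ e₂ e₃ = trans (*-distribʳ-+ u k K) (trans (cong (k * u +_) (trans e₁ (cong (_+ q * n) (sym e₃))))
            (trans (lem₁ k u l (q * n)) (trans (cong (λ x → k * x + l + q * n) e₂) (lem₂ k s l q n))))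
            where
            lem₁ : ∀ k u l w → k * u + (k + l + w) ≡ k * suc u + l + w
            lem₁ = solve-∀
            lem₂ : ∀ k s l q n → k * (s * n) + l + q * n ≡ l + (k * s + q) * n
            lem₂ = solve-∀
          at-suc : ∀ k K u g c y q t n → K * u ≡ g * c + q * n → y + t * n ≡ k * u + g * c → (k + K) * u ≡ y + (t + q) * n
          at-suc k K u g c y q t n e₁ e₂ = trans (*-distribʳ-+ u k K) (trans (cong (k * u +_) e₁)
            (trans (sym (+-assoc (k * u) (g * c) (q * n))) (trans (cong (_+ q * n) (sym e₂)) (lem y t n q))))
            where
            lem : ∀ y t n q → y + t * n + q * n ≡ y + (t + q) * n
            lem = solve-∀
        Σ≡n : sum (λ j → (k + K) * u j % n) ≡ n
        Σ≡n = trans (cong₂ _+_ (proj₁ at-K') (cong₂ _+_ (proj₂ at-K' zero) (cong₂ _+_ (proj₂ at-K' (suc zero)) (cong (_+ 0) (proj₂ at-K' (suc (suc zero))))))) l+Σy≡n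

      -- A lattice point with Σr = k would be a lattice point of T with coordinates m - k and y,
      -- hence w.
      module _ {k l : ℕ} (0<k : 0 < k) (0<l : 0 < l) (k+l≡m : k + l ≡ m)
               (Σr≡k : r zero k + r (suc zero) k + r (suc (suc zero)) k ≡ k) where

        -- A point with coordinates l / m at w and rⱼ / m at vⱼ is rewritten in terms of T by
        -- expanding w = Σ cᵢ vᵢ / N. The coordinate at vⱼ becomes (N rⱼ + cⱼ l) / (N m), and N m =
        -- c₀ n; at v₀ it becomes l / n.
        y-exists : ∀ j → ∃[ y ] (c₀ * y ≡ N * r j k + c (suc j) * l × ∃[ t ] y + t * n ≡ k * u (suc j) + g * c (suc j))
        y-exists j = y , c₀y , t , y+tn
          where
          t = a j * k / m
          z = N * r j k + c (suc j) * l
          x = k * u (suc j) + g * c (suc j)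
          c₀x : c₀ * x ≡ z + c₀ * (t * n)
          c₀x = +-cancelʳ-≡ (k * c (suc j)) _ _ (trans (lem₁ c₀ k (u (suc j)) g (c (suc j)))
            (trans (cong₂ (λ p q → k * p + c (suc j) * q) (Na j) (sym k+l≡m))
            (trans (lem₂ k (a j) N (c (suc j)) l)
            (trans (cong (λ p → N * p + c (suc j) * k + c (suc j) * l) (m≡m%n+[m/n]*n (a j * k) m))
            (trans (lem₃ N (r j k) t m (c (suc j)) k l)
            (trans (cong (λ p → z + t * p + k * c (suc j)) Nm≡c₀n) (lem₄ z t c₀ n (k * c (suc j)))))))))
            where
            lem₁ : ∀ c₀ k u g c → c₀ * (k * u + g * c) + k * c ≡ k * (c + c₀ * u) + c * (c₀ * g)
            lem₁ = solve-∀
            lem₂ : ∀ k a N c l → k * (a * N) + c * (k + l) ≡ N * (a * k) + c * k + c * l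
            lem₂ = solve-∀
            lem₃ : ∀ N r t m c k l → N * (r + t * m) + c * k + c * l ≡ (N * r + c * l) + t * (N * m) + k * c
            lem₃ = solve-∀
            lem₄ : ∀ z t c n w → z + t * (c * n) + w ≡ z + c * (t * n) + w
            lem₄ = solve-∀
          y = x ∸ t * n
          y+tn : y + t * n ≡ x
          y+tn = m∸n+n≡m (*-cancelˡ-≤ c₀ (≤-trans (m≤n+m _ z) (≤-reflexive (sym c₀x))))
          c₀y : c₀ * y ≡ z
          c₀y = +-cancelʳ-≡ (c₀ * (t * n)) _ _ (trans (sym (*-distribˡ-+ c₀ y (t * n))) (trans (cong (c₀ *_) y+tn) c₀x))

        y : Fin 3 → ℕ
        y j = proj₁ (y-exists j)

        l+Σy≡n : l + (y zero + (y (suc zero) + (y (suc (suc zero)) + 0))) ≡ n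
        l+Σy≡n = *-cancelˡ-≡ _ _ c₀ (trans (lem c₀ l N k (y zero) (y (suc zero)) (y (suc (suc zero))) (r zero k) (r (suc zero) k) (r (suc (suc zero)) k)
            (c (suc zero)) (c (suc (suc zero))) (c (suc (suc (suc zero)))) (e zero) (e (suc zero)) (e (suc (suc zero))) Σr≡k Σc≡N)
          (trans (cong (N *_) k+l≡m) Nm≡c₀n))
          where
          e : ∀ j → c₀ * y j ≡ N * r j k + c (suc j) * l
          e j = proj₁ (proj₂ (y-exists j))
          lem : ∀ c₀ l N k y₁ y₂ y₃ r₁ r₂ r₃ c₁ c₂ c₃ → c₀ * y₁ ≡ N * r₁ + c₁ * l → c₀ * y₂ ≡ N * r₂ + c₂ * l → c₀ * y₃ ≡ N * r₃ + c₃ * l →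
            r₁ + r₂ + r₃ ≡ k → c₀ + (c₁ + (c₂ + (c₃ + 0))) ≡ N → c₀ * (l + (y₁ + (y₂ + (y₃ + 0)))) ≡ N * (k + l)
          lem c₀ l N k y₁ y₂ y₃ r₁ r₂ r₃ c₁ c₂ c₃ e₁ e₂ e₃ eᵣ eₙ =
            trans (lem₁ c₀ l y₁ y₂ y₃) (trans (cong (c₀ * l +_) (cong₂ _+_ (cong₂ _+_ e₁ e₂) e₃))
            (trans (lem₂ c₀ l N r₁ r₂ r₃ c₁ c₂ c₃) (trans (cong₂ (λ p q → N * p + q * l) eᵣ eₙ) (sym (*-distribˡ-+ N k l)))))
            where
            lem₁ : ∀ c₀ l y₁ y₂ y₃ → c₀ * (l + (y₁ + (y₂ + (y₃ + 0)))) ≡ c₀ * l + (c₀ * y₁ + c₀ * y₂ + c₀ * y₃)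
            lem₁ = solve-∀
            lem₂ : ∀ c₀ l N r₁ r₂ r₃ c₁ c₂ c₃ → c₀ * l + (N * r₁ + c₁ * l + (N * r₂ + c₂ * l) + (N * r₃ + c₃ * l)) ≡
                   N * (r₁ + r₂ + r₃) + (c₀ + (c₁ + (c₂ + (c₃ + 0)))) * l
            lem₂ = solve-∀

        no-age-one : ⊥
        no-age-one = only-w 0<k 0<l k+l≡m y (λ j → proj₁ (proj₂ (proj₂ (y-exists j)))) (λ j → proj₂ (proj₂ (proj₂ (y-exists j)))) l+Σy≡n

      -- The sum k is impossible by `no-age-one`. In case of k + 2 m all three residues are
      -- positive, their complements are the residues at l = m - k, and these sum to l, which is
      -- impossible for the same reason.
      Σr≡k+m : ∀ {k} → 0 < k → k < m → r zero k + r (suc zero) k + r (suc (suc zero)) k ≡ k + m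
      Σr≡k+m {k} 0<k k<m = select (Σr 0<k k<m)
        where
        l = m ∸ k
        k+l≡m : k + l ≡ m
        k+l≡m = m+[n∸m]≡n (<⇒≤ k<m)
        0<l : 0 < l
        0<l = m<n⇒0<n∸m k<m
        age-three : ∀ x y z x' y' z' → x < m → y < m → z < m → (0 < x → x + x' ≡ m) → (0 < y → y + y' ≡ m) → (0 < z → z + z' ≡ m) →
          x + y + z ≡ k + (m + m) → x' + y' + z' ≡ l
        age-three x y z x' y' z' x<m y<m z<m f g h e = +-cancelˡ-≡ (k + (m + m)) _ _
          (trans (cong (_+ (x' + y' + z')) (sym e)) (trans (lem x y z x' y' z')
          (trans (cong₂ _+_ (cong₂ _+_ (f 0<x) (g 0<y)) (h 0<z)) (trans (cong (m + m +_) (sym k+l≡m)) (lem₂ k l m)))))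
          where
          lem : ∀ x y z x' y' z' → x + y + z + (x' + y' + z') ≡ x + x' + (y + y') + (z + z')
          lem = solve-∀
          lem₂ : ∀ k l m → m + m + (k + l) ≡ k + (m + m) + l
          lem₂ = solve-∀
          0<x : 0 < x
          0<x = ≤-by (suc k) (≤-reflexive (sym e) ⊕ y<m ⊕ z<m) (eq k m x y z)
            where
            eq : ∀ k m x y z → 1 + (x + y + z + m + m) + suc k ≡ x + (k + (m + m) + suc y + suc z)
            eq = solve-∀
          0<y : 0 < y
          0<y = ≤-by (suc k) (≤-reflexive (sym e) ⊕ x<m ⊕ z<m) (eq k m x y z)
            where
            eq : ∀ k m x y z → 1 + (x + y + z + m + m) + suc k ≡ y + (k + (m + m) + suc x + suc z)
            eq = solve-∀
          0<z : 0 < z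
          0<z = ≤-by (suc k) (≤-reflexive (sym e) ⊕ x<m ⊕ y<m) (eq k m x y z)
            where
            eq : ∀ k m x y z → 1 + (x + y + z + m + m) + suc k ≡ z + (k + (m + m) + suc x + suc y)
            eq = solve-∀
        r<m : ∀ j → r j k < m
        r<m j = m%n<n (a j * k) m
        r-complement : ∀ j → 0 < r j k → r j k + r j l ≡ m
        r-complement j = residue-complement m (a j) {k} {l} k+l≡m
        select : r zero k + r (suc zero) k + r (suc (suc zero)) k ≡ k ⊎
          r zero k + r (suc zero) k + r (suc (suc zero)) k ≡ k + m ⊎
          r zero k + r (suc zero) k + r (suc (suc zero)) k ≡ k + (m + m) → r zero k + r (suc zero) k + r (suc (suc zero)) k ≡ k + m
        select (inj₁ e) = ⊥-elim (no-age-one 0<k 0<l k+l≡m e)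
        select (inj₂ (inj₁ e)) = e
        select (inj₂ (inj₂ e)) = ⊥-elim (no-age-one 0<l 0<k (trans (+-comm l k) k+l≡m)
          (age-three (r zero k) (r (suc zero) k) (r (suc (suc zero)) k) (r zero l) (r (suc zero) l) (r (suc (suc zero)) l)
            (r<m zero) (r<m (suc zero)) (r<m (suc (suc zero))) (r-complement zero) (r-complement (suc zero)) (r-complement (suc (suc zero))) e))

      -- Reducing the aⱼ modulo m sharpens Σa ≡ 1 to the equality Σb = m + 1 required by `white`; it
      -- is the case k = 1 of `Σr≡k+m`.
      b : Fin 3 → ℕ
      b j = a j % m

      Σb : b zero + b (suc zero) + b (suc (suc zero)) ≡ suc m
      Σb = trans (cong₂ _+_ (cong₂ _+_ (b≡ zero) (b≡ (suc zero))) (b≡ (suc (suc zero)))) (Σr≡k+m (s≤s z≤n) 2≤m)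
        where
        b≡ : ∀ j → b j ≡ r j 1
        b≡ j = cong (_% m) (sym (*-identityʳ (a j)))

      -- Summing bⱼ k = rⱼ + m ⌊bⱼ k / m⌋ gives (m + 1) k = (k + m) + m Φ, hence k = Φ + 1.
      floors : Floors m (b zero) (b (suc zero)) (b (suc (suc zero)))
      floors k 0<k k<m = *-cancelʳ-≡ (suc Φ) k m (+-cancelˡ-≡ k (suc Φ * m) (k * m)
        (lem (b zero) (b (suc zero)) (b (suc (suc zero))) (b zero * k / m) (b (suc zero) * k / m) (b (suc (suc zero)) * k / m)
             (r zero k) (r (suc zero) k) (r (suc (suc zero)) k) k m (bk zero) (bk (suc zero)) (bk (suc (suc zero))) Σb (Σr≡k+m 0<k k<m)))
        where
        Φ = b zero * k / m + b (suc zero) * k / m + b (suc (suc zero)) * k / m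
        bk : ∀ j → b j * k ≡ r j k + b j * k / m * m
        bk j = %-*-expand m (a j) k
        lem : ∀ x y z X Y Z p q v k m → x * k ≡ p + X * m → y * k ≡ q + Y * m → z * k ≡ v + Z * m → x + y + z ≡ suc m → p + q + v ≡ k + m →
          k + suc (X + Y + Z) * m ≡ k + k * m
        lem x y z X Y Z p q v k m e₁ e₂ e₃ e₄ e₅ = trans (lem₁ k (X + Y + Z) m) (trans (cong (_+ (X + Y + Z) * m) (sym e₅)) (trans (lem₂ p q v X Y Z m)
          (trans (sym (cong₂ _+_ (cong₂ _+_ e₁ e₂) e₃)) (trans (lem₃ x y z k) (trans (cong (_* k) e₄) (cong (k +_) (*-comm m k)))))))
          where
          lem₁ : ∀ k s m → k + suc s * m ≡ k + m + s * m
          lem₁ = solve-∀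
          lem₂ : ∀ p q v X Y Z m → p + q + v + (X + Y + Z) * m ≡ (p + X * m) + (q + Y * m) + (v + Z * m)
          lem₂ = solve-∀
          lem₃ : ∀ x y z k → x * k + y * k + z * k ≡ (x + y + z) * k
          lem₃ = solve-∀

      -- From aⱼ = 1 + s m and N m = c₀ n one gets c₀ (uⱼ - s n) = N - cⱼ, so uⱼ - s n itself serves
      -- as q.
      paired : ∀ j → b j ≡ 1 → ∃[ q ] (q * c₀ + c (suc j) ≡ N × u (suc j) % n ≡ q % n)
      paired j b≡1 = q , qc₀+c≡N , (trans (cong (_% n) (trans (sym sn+q) (+-comm (s * n) q))) ([m+kn]%n≡m%n q s n))
        where
        s = a j / m
        aj≡ : a j ≡ 1 + s * m
        aj≡ = %≡⇒≡+ m (a j) b≡1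
        c₀u : c (suc j) + c₀ * u (suc j) ≡ N + c₀ * (s * n)
        c₀u = trans (Na j) (trans (cong (_* N) aj≡) (trans (lem s m N) (trans (cong (λ x → N + s * x) Nm≡c₀n) (lem₂ N s c₀ n))))
          where
          lem : ∀ s m N → (1 + s * m) * N ≡ N + s * (N * m)
          lem = solve-∀
          lem₂ : ∀ N s c n → N + s * (c * n) ≡ N + c * (s * n)
          lem₂ = solve-∀
        c≤N : c (suc j) ≤ N
        c≤N = ≤-trans (c≤Σc j) (≤-reflexive Σc≡N)
          where
          c≤Σc : ∀ j → c (suc j) ≤ sum c
          c≤Σc zero = ≤-trans (m≤m+n _ _) (m≤n+m _ c₀)
          c≤Σc (suc zero) = ≤-trans (≤-trans (m≤m+n _ _) (m≤n+m _ (c (suc zero)))) (m≤n+m _ c₀)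
          c≤Σc (suc (suc zero)) = ≤-trans (≤-trans (≤-trans (m≤m+n _ _) (m≤n+m _ (c (suc (suc zero))))) (m≤n+m _ (c (suc zero)))) (m≤n+m _ c₀)
        q = u (suc j) ∸ s * n
        sn+q : s * n + q ≡ u (suc j)
        sn+q = m+[n∸m]≡n (*-cancelˡ-≤ c₀ (≤-by 0 (c≤N ⊕ ≤-reflexive (sym c₀u)) (lem (c₀ * (s * n)) N (c (suc j)) (c₀ * u (suc j)))))
          where
          lem : ∀ x N c y → x + (N + (c + y)) + 0 ≡ y + (c + (N + x))
          lem = solve-∀
        qc₀+c≡N : q * c₀ + c (suc j) ≡ N
        qc₀+c≡N = +-cancelʳ-≡ (c₀ * (s * n)) (q * c₀ + c (suc j)) N (trans (lem q c₀ (c (suc j)) (s * n)) (trans (cong (λ x → c (suc j) + c₀ * x) sn+q) c₀u))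
          where
          lem : ∀ q c d x → q * c + d + c * x ≡ d + c * (x + q)
          lem = solve-∀

    core-paired : ∃[ j ] ∃[ q ] (q * c zero + c (suc j) ≡ N × u (suc j) % n ≡ q % n)
    core-paired = select (white m 2≤m Σb floors)
      where
      select : b zero ≡ 1 ⊎ b (suc zero) ≡ 1 ⊎ b (suc (suc zero)) ≡ 1 → ∃[ j ] ∃[ q ] (q * c zero + c (suc j) ≡ N × u (suc j) % n ≡ q % n)
      select (inj₁ e) = zero , paired zero e
      select (inj₂ (inj₁ e)) = suc zero , paired (suc zero) e
      select (inj₂ (inj₂ e)) = suc (suc zero) , paired (suc (suc zero)) e

-- Relabelling vertices, changing the generator, and the congruence step at any vertex.

module Symmetries where

  open import Data.Nat
  open import Data.Nat.Properties
  open import Data.Nat.DivMod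
  open import Data.Nat.Divisibility
  open import Data.Nat.Coprimality as Coprime using (Coprime; coprime-Bézout)
  open import Data.Nat.GCD using (module Bézout)
  open import Data.Nat.Tactic.RingSolver
  open import Data.Fin using (Fin; zero; suc)
  open import Data.Fin.Permutation using (Permutation′; _⟨$⟩ʳ_; _⟨$⟩ˡ_; inverseˡ; inverseʳ; transpose)
  open import Data.Sum using (_⊎_; inj₁; inj₂)
  open import Data.Product using (∃-syntax; _×_; _,_; proj₁; proj₂)
  open import Data.Empty using (⊥-elim)
  open import Relation.Binary.PropositionalEquality
  open import Algebra.Properties.CommutativeMonoid.Sum +-0-commutativeMonoid using (sum; sum-permute; sum-cong-≗)
  open Inequalities
  open CyclicQuotient

  module _ {n : ℕ} .{{_ : NonZero n}} where

    *-cong-% : ∀ {a b c d} → a % n ≡ b % n → c % n ≡ d % n → a * c % n ≡ b * d % n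
    *-cong-% {a} {b} {c} {d} e f = trans (%-distribˡ-* a c n) (trans (cong₂ (λ x y → x * y % n) e f) (sym (%-distribˡ-* b d n)))

    +-cong-% : ∀ {a b c d} → a % n ≡ b % n → c % n ≡ d % n → (a + c) % n ≡ (b + d) % n
    +-cong-% {a} {b} {c} {d} e f = trans (%-distribˡ-+ a c n) (trans (cong₂ (λ x y → (x + y) % n) e f) (sym (%-distribˡ-+ b d n)))

    ∣-resp-% : ∀ {a b} → a % n ≡ b % n → n ∣ a → n ∣ b
    ∣-resp-% e n∣a = m%n≡0⇒n∣m _ n (trans (sym e) (n∣m⇒m%n≡0 _ n n∣a))

    +-cancel-% : ∀ {a b} z → n ∣ a + z → n ∣ b + z → a % n ≡ b % n
    +-cancel-% {a} {b} z p q = trans (sym (%-remove-+ʳ a q)) (trans (cong (_% n) (lem a b z)) (%-remove-+ʳ b p))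
      where
      lem : ∀ a b z → a + (b + z) ≡ b + (a + z)
      lem = solve-∀

    -- If d divides both x and n, then n / d annihilates x, hence is a multiple of n, and d = 1.
    -- Bézout then gives an inverse of x or of - x; the former is multiplied by n - 1.
    negative-inverse : ∀ x → (∀ k → n ∣ k * x → n ∣ k) → ∃[ v ] n ∣ suc (v * x)
    negative-inverse x unit with coprime-Bézout {x} {n} coprime
      where
      coprime : Coprime x n
      coprime {d} (d∣x , d∣n) = d≡1 d∣x d∣n
        where
        d≡1 : d ∣ x → d ∣ n → d ≡ 1
        d≡1 (divides y x≡yd) (divides k n≡kd) = *-cancelˡ-≡ d 1 k ⦃ k≢0 ⦄ (trans (sym (trans n≡kd refl)) (trans (∣-antisym n∣k (divides d (trans n≡kd (*-comm k d)))) (sym (*-identityʳ k))))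
          where
          k≢0 : NonZero k
          k≢0 = m*n≢0⇒m≢0 k {{subst NonZero n≡kd (>-nonZero (n≢0⇒n>0 (≢-nonZero⁻¹ n)))}}
          n∣k : n ∣ k
          n∣k = unit k (divides y (trans (cong (k *_) x≡yd) (trans (lem k y d) (cong (y *_) (sym n≡kd)))))
            where
            lem : ∀ k y d → k * (y * d) ≡ y * (k * d)
            lem = solve-∀
    ... | Bézout.-+ a b e = a , divides b e
    ... | Bézout.+- a b e = (n ∸ 1) * a , divides (1 + (n ∸ 1) * b) (trans (cong suc (trans (*-assoc (n ∸ 1) a x) (cong ((n ∸ 1) *_) (sym e))))
            (trans (lem (n ∸ 1) b n) (cong (_+ (n ∸ 1) * b * n) (m+[n∸m]≡n (n≢0⇒n>0 (≢-nonZero⁻¹ n))))))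
      where
      lem : ∀ k b n → suc (k * (1 + b * n)) ≡ 1 + k + k * b * n
      lem = solve-∀

  module _ {n N g : ℕ} .{{_ : NonZero n}} {c u : Fin 4 → ℕ} (C : Core n N g c u) where

    open Core C

    core-permute : (π : Permutation′ 4) → Core n N g (λ j → c (π ⟨$⟩ʳ j)) (λ j → u (π ⟨$⟩ʳ j))
    core-permute π = record
      { n≡Ng = n≡Ng
      ; Σc≡N = trans (sym (sum-permute c π)) Σc≡N
      ; 0<c  = λ j → 0<c (π ⟨$⟩ʳ j)
      ; n∣Σu = subst (n ∣_) (sum-permute u π) n∣Σu
      ; age  = λ k e j → age k (trans (sum-permute (λ j → k * u j % n) π) e) (π ⟨$⟩ʳ j)
      ; wit  = proj₁ wit , λ j → proj₂ wit (π ⟨$⟩ʳ j)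
      }

    -- Multiples of v u are multiples of u, so `age` is inherited; `v′` expresses w as a multiple of
    -- the new generator.
    core-scale : ∀ v v′ → v′ * v % n ≡ 1 % n → Core n N g c (λ j → v * u j)
    core-scale v v′ e = record
      { n≡Ng = n≡Ng
      ; Σc≡N = Σc≡N
      ; 0<c  = 0<c
      ; n∣Σu = subst (n ∣_) (lem v (u zero) (u (suc zero)) (u (suc (suc zero))) (u (suc (suc (suc zero))))) (∣n⇒∣m*n v n∣Σu)
      ; age  = λ k p j → trans (assoc k j) (age (k * v) (trans (sum-cong-≗ (λ j → sym (assoc k j))) p) j)
      ; wit  = proj₁ wit * v′ , λ j → trans (cong (_% n) (lem₂ (proj₁ wit) v′ v (u j)))
                 (trans (*-cong-% e refl) (trans (cong (_% n) (*-identityˡ (proj₁ wit * u j))) (proj₂ wit j)))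
      }
      where
      assoc : ∀ k j → k * (v * u j) % n ≡ k * v * u j % n
      assoc k j = cong (_% n) (sym (*-assoc k v (u j)))
      lem : ∀ v a b c d → v * (a + (b + (c + (d + 0)))) ≡ v * a + (v * b + (v * c + (v * d + 0)))
      lem = solve-∀
      lem₂ : ∀ k w v x → k * w * (v * x) ≡ w * v * (k * x)
      lem₂ = solve-∀

    -- An element of the group with a vanishing coordinate is 0: otherwise it or its negative
    -- lies in a face of T.
    vanishing₀ : ∀ {k} → n ∣ k * u zero → ∀ j → n ∣ k * u j
    vanishing₀ {k} n∣ku₀ = select (three-residues n {s = φ₁ + φ₂ + φ₃ + quotient n∣ku₀} {t = k * quotient n∣Σu} 0<n (r<n (suc zero)) (r<n (suc (suc zero))) (r<n (suc (suc (suc zero)))) Σr)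
      where
      0<n : 0 < n
      0<n = n≢0⇒n>0 (≢-nonZero⁻¹ n)
      r : Fin 4 → ℕ
      r j = k * u j % n
      r<n : ∀ j → r j < n
      r<n j = m%n<n (k * u j) n
      r₁ = r (suc zero)
      r₂ = r (suc (suc zero))
      r₃ = r (suc (suc (suc zero)))
      φ₁ = k * u (suc zero) / n
      φ₂ = k * u (suc (suc zero)) / n
      φ₃ = k * u (suc (suc (suc zero))) / n
      Σr : r₁ + r₂ + r₃ + (φ₁ + φ₂ + φ₃ + quotient n∣ku₀) * n ≡ 0 + k * quotient n∣Σu * n
      Σr = lem r₁ r₂ r₃ φ₁ φ₂ φ₃ (quotient n∣ku₀) (quotient n∣Σu) k n (u zero) (u (suc zero)) (u (suc (suc zero))) (u (suc (suc (suc zero))))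
             (m≡m%n+[m/n]*n (k * u (suc zero)) n) (m≡m%n+[m/n]*n (k * u (suc (suc zero))) n) (m≡m%n+[m/n]*n (k * u (suc (suc (suc zero)))) n) (m∣n⇒n≡quotient*m n∣ku₀) (m∣n⇒n≡quotient*m n∣Σu)
        where
        lem : ∀ x y z X Y Z a t k n u₀ u₁ u₂ u₃ → k * u₁ ≡ x + X * n → k * u₂ ≡ y + Y * n → k * u₃ ≡ z + Z * n → k * u₀ ≡ a * n →
          u₀ + (u₁ + (u₂ + (u₃ + 0))) ≡ t * n → x + y + z + (X + Y + Z + a) * n ≡ 0 + k * t * n
        lem x y z X Y Z a t k n u₀ u₁ u₂ u₃ e₁ e₂ e₃ e₀ e = trans (lem₁ x y z X Y Z a n)
          (trans (sym (cong₂ _+_ (cong₂ _+_ (cong₂ _+_ e₁ e₂) e₃) e₀)) (trans (lem₂ k u₀ u₁ u₂ u₃) (trans (cong (k *_) e) (sym (*-assoc k t n)))))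
          where
          lem₁ : ∀ x y z X Y Z a n → x + y + z + (X + Y + Z + a) * n ≡ (x + X * n) + (y + Y * n) + (z + Z * n) + a * n
          lem₁ = solve-∀
          lem₂ : ∀ k u₀ u₁ u₂ u₃ → k * u₁ + k * u₂ + k * u₃ + k * u₀ ≡ k * (u₀ + (u₁ + (u₂ + (u₃ + 0))))
          lem₂ = solve-∀
      not-age-one : ∀ k → n ∣ k * u zero → sum (λ j → k * u j % n) ≢ n
      not-age-one k n∣ e = m<n⇒n≢0 (*-mono-≤ 0<g (0<c zero)) (trans (sym (age k e zero)) (n∣m⇒m%n≡0 (k * u zero) n n∣))
        where
        0<g : 0 < g
        0<g = n≢0⇒n>0 λ g≡0 → m<n⇒n≢0 0<n (trans n≡Ng (trans (cong (N *_) g≡0) (*-zeroʳ N)))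
      r₀≡0 : r zero ≡ 0
      r₀≡0 = n∣m⇒m%n≡0 (k * u zero) n n∣ku₀
      select : r₁ + r₂ + r₃ ≡ 0 ⊎ r₁ + r₂ + r₃ ≡ 0 + n ⊎ r₁ + r₂ + r₃ ≡ 0 + (n + n) → ∀ j → n ∣ k * u j
      select (inj₁ e) = λ where
        zero → n∣ku₀
        (suc zero) → m%n≡0⇒n∣m (k * u (suc zero)) n (m+n≡0⇒m≡0 r₁ (m+n≡0⇒m≡0 (r₁ + r₂) e))
        (suc (suc zero)) → m%n≡0⇒n∣m (k * u (suc (suc zero))) n (m+n≡0⇒n≡0 r₁ (m+n≡0⇒m≡0 (r₁ + r₂) e))
        (suc (suc (suc zero))) → m%n≡0⇒n∣m (k * u (suc (suc (suc zero)))) n (m+n≡0⇒n≡0 (r₁ + r₂) e)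
      select (inj₂ (inj₁ e)) = ⊥-elim (not-age-one k n∣ku₀ (trans (cong (_+ (r₁ + (r₂ + (r₃ + 0)))) r₀≡0) (trans (lem r₁ r₂ r₃) e)))
        where
        lem : ∀ x y z → x + (y + (z + 0)) ≡ x + y + z
        lem = solve-∀
      select (inj₂ (inj₂ e)) = ⊥-elim (not-age-one (k * l) n∣klu₀ (trans (cong (_+ (r′ (suc zero) + (r′ (suc (suc zero)) + (r′ (suc (suc (suc zero))) + 0)))) (n∣m⇒m%n≡0 (k * l * u zero) n n∣klu₀))
          (negated r₁ r₂ r₃ (r′ (suc zero)) (r′ (suc (suc zero))) (r′ (suc (suc (suc zero)))) (r<n (suc zero)) (r<n (suc (suc zero))) (r<n (suc (suc (suc zero)))) (complement (suc zero)) (complement (suc (suc zero))) (complement (suc (suc (suc zero)))) e)))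
        where
        l = n ∸ 1
        r′ : Fin 4 → ℕ
        r′ j = k * l * u j % n
        lem : ∀ k l u → k * u * l ≡ k * l * u
        lem = solve-∀
        n∣klu₀ : n ∣ k * l * u zero
        n∣klu₀ = subst (n ∣_) (lem k l (u zero)) (∣m⇒∣m*n l n∣ku₀)
        complement : ∀ j → 0 < r j → r j + r′ j ≡ n
        complement j 0<r = trans (cong₂ _+_ (cong (_% n) (sym (*-identityʳ (k * u j)))) (cong (_% n) (sym (lem k l (u j)))))
          (residue-complement n (k * u j) {1} {l} (m+[n∸m]≡n 0<n) (≤-trans 0<r (≤-reflexive (cong (_% n) (sym (*-identityʳ (k * u j)))))))
        negated : ∀ x y z x′ y′ z′ → x < n → y < n → z < n → (0 < x → x + x′ ≡ n) → (0 < y → y + y′ ≡ n) → (0 < z → z + z′ ≡ n) →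
          x + y + z ≡ n + n → x′ + (y′ + (z′ + 0)) ≡ n
        negated x y z x′ y′ z′ x<n y<n z<n f g h e = +-cancelˡ-≡ (n + n) (x′ + (y′ + (z′ + 0))) n
          (trans (cong (_+ (x′ + (y′ + (z′ + 0)))) (sym e)) (trans (eq₀ x y z x′ y′ z′)
          (cong₂ _+_ (cong₂ _+_ (f 0<x) (g 0<y)) (h 0<z))))
          where
          eq₀ : ∀ x y z x′ y′ z′ → x + y + z + (x′ + (y′ + (z′ + 0))) ≡ x + x′ + (y + y′) + (z + z′)
          eq₀ = solve-∀
          0<x : 0 < x
          0<x = ≤-by 1 (≤-reflexive (sym e) ⊕ y<n ⊕ z<n) (eq n x y z)
            where
            eq : ∀ m x y z → 1 + (x + y + z + m + m) + 1 ≡ x + (m + m + suc y + suc z)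
            eq = solve-∀
          0<y : 0 < y
          0<y = ≤-by 1 (≤-reflexive (sym e) ⊕ x<n ⊕ z<n) (eq n x y z)
            where
            eq : ∀ m x y z → 1 + (x + y + z + m + m) + 1 ≡ y + (m + m + suc x + suc z)
            eq = solve-∀
          0<z : 0 < z
          0<z = ≤-by 1 (≤-reflexive (sym e) ⊕ x<n ⊕ y<n) (eq n x y z)
            where
            eq : ∀ m x y z → 1 + (x + y + z + m + m) + 1 ≡ z + (m + m + suc x + suc y)
            eq = solve-∀

  module _ {n N g : ℕ} .{{_ : NonZero n}} {c u : Fin 4 → ℕ} (C : Core n N g c u) where

    vanishing : ∀ {k} i → n ∣ k * u i → ∀ j → n ∣ k * u j
    vanishing {k} i n∣ku j = subst (λ j → n ∣ k * u j) (inverseʳ (transpose zero i)) (vanishing₀ (core-permute C (transpose zero i)) {k} n∣ku (transpose zero i ⟨$⟩ˡ j))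

  Units : (n : ℕ) → (Fin 4 → ℕ) → Set
  Units n u = ∀ i k → n ∣ k * u i → n ∣ k

  -- The outcome of White's theorem with w in place of vᵢ: uⱼ ≡ - q uᵢ with q = (N - cⱼ) / cᵢ, free
  -- of division and subtraction.
  Step : (n N : ℕ) (c u : Fin 4 → ℕ) → Fin 4 → Set
  Step n N c u i = ∃[ j ] (i ≢ j × ∃[ q ] (q * c i + c j ≡ N × n ∣ u j + q * u i))

  module _ {n N g : ℕ} .{{_ : NonZero n}} {c u : Fin 4 → ℕ} (C : Core n N g c u) (units : Units n u) where

    -- Scaling by v with v uᵢ ≡ - 1 and moving i to the front yields the hypotheses of
    -- `core-paired`, where cᵢ g ≥ 2 because g ≥ 2. Multiplying its conclusion v uⱼ ≡ q by uᵢ undoes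
    -- the scaling.
    step : 2 ≤ g → ∀ i → Step n N c u i
    step 2≤g i = transport (core-paired (core-permute (core-scale C v ((n ∸ 1) * u i) v-inverse) π) n∣1+vuᵢ (*-mono-≤ (Core.0<c C i) 2≤g))
      where
      π = transpose zero i
      v = proj₁ (negative-inverse (u i) (units i))
      n∣1+vuᵢ : n ∣ suc (v * u i)
      n∣1+vuᵢ = proj₂ (negative-inverse (u i) (units i))
      -- The inverse of v is - uᵢ, written with n - 1 for - 1.
      v-inverse : (n ∸ 1) * u i * v % n ≡ 1 % n
      v-inverse = trans (sym (%-remove-+ʳ ((n ∸ 1) * u i * v) n∣1+vuᵢ)) (trans (cong (_% n) (trans (lem (n ∸ 1) (u i) v) (cong (λ x → 1 + u i * v * x) (m+[n∸m]≡n (n≢0⇒n>0 (≢-nonZero⁻¹ n)))))) ([m+kn]%n≡m%n 1 (u i * v) n))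
        where
        lem : ∀ k x v → k * x * v + suc (v * x) ≡ 1 + x * v * (1 + k)
        lem = solve-∀
      transport : ∃[ j ] ∃[ q ] (q * c i + c (π ⟨$⟩ʳ suc j) ≡ N × v * u (π ⟨$⟩ʳ suc j) % n ≡ q % n) → Step n N c u i
      transport (j′ , q , qc+c≡N , vu≡q) = j , i≢j , q , qc+c≡N , n∣u+qu
        where
        j = π ⟨$⟩ʳ suc j′
        i≢j : i ≢ j
        i≢j e with trans (sym (inverseˡ π {zero})) (trans (cong (π ⟨$⟩ˡ_) e) (inverseˡ π {suc j′}))
        ... | ()
        n∣u+qu : n ∣ u j + q * u i
        n∣u+qu = ∣-resp-% (+-cong-% {a = u j} {b = u j} refl (*-cong-% {a = v * u j} {b = q} {c = u i} {d = u i} vu≡q refl)) (subst (n ∣_) (lem (u j) v (u i)) (∣n⇒∣m*n (u j) n∣1+vuᵢ))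
          where
          lem : ∀ y v x → y * suc (v * x) ≡ y + v * y * x
          lem = solve-∀

-- The two finite computations: closing walks, and extra lattice points.

module Search where

  open import Data.Bool using (Bool; true; false; _∧_; _∨_; not; T)
  open import Data.Nat
  open import Data.Fin using (Fin; zero; suc)
  open import Data.Unit using (tt)
  open import Data.List using (List; []; _∷_)
  open import Data.Integer as ℤ using (ℤ)
  open import Data.Product using (_×_; _,_)
  open import Defs

  allBelow : ℕ → (ℕ → Bool) → Bool
  allBelow zero f = true
  allBelow (suc n) f = f n ∧ allBelow n f

  anyFrom : ℕ → ℕ → (ℕ → Bool) → Bool
  anyFrom k zero f = false
  anyFrom k (suc n) f = f k ∨ anyFrom (suc k) n f

  allFin₄ : (Fin 4 → Bool) → Bool
  allFin₄ f = f v0 ∧ f v1 ∧ f v2 ∧ f v3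

  -- Matching on the premise leaves the conclusion unevaluated where a test fails.
  _⇒ᵇ_ : Bool → Bool → Bool
  true ⇒ᵇ b = b
  false ⇒ᵇ b = true
  infixr 4 _⇒ᵇ_

  _≟ᵇ_ : Fin 4 → Fin 4 → Bool
  i ≟ᵇ j = Data.Fin.toℕ i ≡ᵇ Data.Fin.toℕ j

  -- Junk value x mod 0 = x: no NonZero instance is needed during the search.
  _mod_ : ℕ → ℕ → ℕ
  x mod zero = x
  x mod n@(suc _) = x % n

  -- The largest g with N g ∣ X - Y for values X and Y at which some walk below closes.
  gMax : Fin 7 → ℕ
  gMax zero = 21
  gMax (suc zero) = 26
  gMax (suc (suc zero)) = 26
  gMax (suc (suc (suc zero))) = 22
  gMax (suc (suc (suc (suc zero)))) = 16
  gMax (suc (suc (suc (suc (suc zero))))) = 10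
  gMax (suc (suc (suc (suc (suc (suc zero)))))) = 6

  -- (i , X) stands for u i ≡ X modulo n.  A step from i to j with q c i + c j = N passes from X
  -- to - q X; when a vertex recurs with distinct values X and Y, n divides X - Y.
  closes : ℕ → List (Fin 4 × ℤ) → Fin 4 → ℤ → Bool
  closes D [] j Y = false
  closes D ((i , X) ∷ h) j Y = ((i ≟ᵇ j) ∧ (1 ≤ᵇ ℤ.∣ X ℤ.- Y ∣) ∧ (ℤ.∣ X ℤ.- Y ∣ ≤ᵇ D)) ∨ closes D h j Y

  walks : ℕ → ℕ → ℕ → (Fin 4 → ℕ) → List (Fin 4 × ℤ) → Fin 4 → ℤ → Bool
  walksTo : ℕ → ℕ → ℕ → (Fin 4 → ℕ) → List (Fin 4 × ℤ) → Fin 4 → ℤ → Fin 4 → Bool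
  walksAlong : ℕ → ℕ → ℕ → (Fin 4 → ℕ) → List (Fin 4 × ℤ) → Fin 4 → ℤ → Fin 4 → ℕ → Bool
  walks zero D N c h i X = false
  walks (suc fuel) D N c h i X = allFin₄ (walksTo fuel D N c h i X)
  -- The bound 20 covers every q, since q ≤ q cᵢ ≤ N ≤ 19.
  walksTo fuel D N c h i X j = not (i ≟ᵇ j) ⇒ᵇ allBelow 20 (walksAlong fuel D N c h i X j)
  walksAlong fuel D N c h i X j q = (q * c i + c j ≡ᵇ N) ⇒ᵇ
    closes D ((i , X) ∷ h) j (ℤ.- (ℤ.+ q ℤ.* X)) ∨ walks fuel D N c ((i , X) ∷ h) j (ℤ.- (ℤ.+ q ℤ.* X))

  -- Four steps pass through five vertices, so one of the four recurs within the given fuel. The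
  -- start (v₃, 1) reflects the normalization u₃ ≡ 1.
  all-walks-close : ∀ ℓ → T (walks 4 (gMax ℓ * denom ℓ) (denom ℓ) (numer ℓ) [] v3 (ℤ.+ 1))
  all-walks-close zero = tt
  all-walks-close (suc zero) = tt
  all-walks-close (suc (suc zero)) = tt
  all-walks-close (suc (suc (suc zero))) = tt
  all-walks-close (suc (suc (suc (suc zero)))) = tt
  all-walks-close (suc (suc (suc (suc (suc zero))))) = tt
  all-walks-close (suc (suc (suc (suc (suc (suc zero)))))) = tt

  -- The coordinate u₀ is determined modulo n by u₀ + u₁ + u₂ + 1 ≡ 0.
  extraPoint : (n gc₃ u₁ u₂ k : ℕ) → Bool
  extraPoint n gc₃ u₁ u₂ k =
    ((k * (3 * n ∸ suc (u₁ + u₂))) mod n + ((k * u₁) mod n + ((k * u₂) mod n + (k + 0))) ≡ᵇ n) ∧ not (k ≡ᵇ gc₃)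

  -- The powers of - 3 modulo 20 other than 1. Their negatives 11, 7 and 3 are the parameters of the
  -- normal forms.
  residue : ℕ → Bool
  residue u = (u ≡ᵇ 9) ∨ (u ≡ᵇ 13) ∨ (u ≡ᵇ 17)

  exceptional : Fin 7 → (g u₁ u₂ : ℕ) → Bool
  exceptional zero g u₁ u₂ = (g ≡ᵇ 5) ∧ residue u₁ ∧ residue u₂ ∧ not (u₁ ≡ᵇ u₂)
  exceptional (suc _) _ _ _ = false

  -- The conditions c₃ bⱼ ≡ cⱼ determine bⱼ, the residue of uⱼ modulo N, because c₃ is prime to N in
  -- all seven cases. This leaves the g candidates bⱼ + tⱼ N for each of u₁ and u₂; each pair must
  -- be exceptional or have a lattice point besides w.
  searched : Fin 7 → Bool
  searched ℓ = allBelow N λ b₁ → ((c v3 * b₁) mod N ≡ᵇ c v1) ⇒ᵇ allBelow N λ b₂ → ((c v3 * b₂) mod N ≡ᵇ c v2) ⇒ᵇ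
      allBelow (suc (gMax ℓ)) λ g → (1 <ᵇ g) ⇒ᵇ allBelow g λ t₁ → allBelow g λ t₂ →
        exceptional ℓ g (b₁ + t₁ * N) (b₂ + t₂ * N) ∨ anyFrom 0 (N * g) (extraPoint (N * g) (g * c v3) (b₁ + t₁ * N) (b₂ + t₂ * N))
    where
    N = denom ℓ
    c = numer ℓ

  search : ∀ ℓ → T (searched ℓ)
  search zero = tt
  search (suc zero) = tt
  search (suc (suc zero)) = tt
  search (suc (suc (suc zero))) = tt
  search (suc (suc (suc (suc zero)))) = tt
  search (suc (suc (suc (suc (suc zero))))) = tt
  search (suc (suc (suc (suc (suc (suc zero)))))) = tt

-- What the two computations prove about the group.

module SearchSoundness where

  open import Data.Bool using (true; false; _∧_; _∨_; not; T)
  open import Data.Bool.Properties using (T-∧; T-∨)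
  open import Data.Nat
  open import Data.Nat.Properties
  open import Data.Nat.DivMod hiding (_mod_)
  open import Data.Nat.Divisibility
  import Data.Nat.Tactic.RingSolver as ℕ-Ring
  open import Data.Integer as ℤ using (ℤ; +_)
  import Data.Integer.Properties as ℤ
  import Data.Integer.Tactic.RingSolver as ℤ-Ring
  import Data.Integer.Divisibility.Signed as ℤ∣
  open import Data.Fin using (Fin; zero; suc)
  open import Data.Fin.Properties using (toℕ-injective)
  open import Data.List using ([]; _∷_)
  open import Data.List.Relation.Unary.All using (All; []; _∷_)
  open import Data.Unit using (tt)
  open import Data.Sum using (_⊎_; inj₁; inj₂)
  open import Data.Product using (∃-syntax; _×_; _,_; proj₁; proj₂)
  open import Data.Empty using (⊥-elim)
  open import Function.Bundles using (module Equivalence)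
  open import Relation.Nullary using (¬_)
  open import Relation.Binary.PropositionalEquality
  open import Algebra.Properties.CommutativeMonoid.Sum +-0-commutativeMonoid using (sum)
  open import Defs hiding (Equivalent)
  open Inequalities
  open CyclicQuotient
  open Symmetries
  open Search

  ∧-elim : ∀ {a b} → T (a ∧ b) → T a × T b
  ∧-elim = Equivalence.to T-∧

  ∨-elim : ∀ {a b} → T (a ∨ b) → T a ⊎ T b
  ∨-elim = Equivalence.to T-∨

  ⇒ᵇ-elim : ∀ {a b} → T (a ⇒ᵇ b) → T a → T b
  ⇒ᵇ-elim {true} t _ = t

  not-elim : ∀ {a} → T (not a) → ¬ T a
  not-elim {true} ()
  not-elim {false} _ ()

  not-intro : ∀ {a} → ¬ T a → T (not a)
  not-intro {true} f = f tt
  not-intro {false} f = tt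

  allBelow-sound : ∀ n {f} → T (allBelow n f) → ∀ {k} → k < n → T (f k)
  allBelow-sound (suc n) {f} t {k} k<1+n with m≤n⇒m<n∨m≡n (s≤s⁻¹ k<1+n)
  ... | inj₁ k<n = allBelow-sound n (proj₂ (∧-elim {f n} t)) k<n
  ... | inj₂ refl = proj₁ (∧-elim t)

  anyFrom-sound : ∀ k n {f} → T (anyFrom k n f) → ∃[ j ] (j < k + n × T (f j))
  anyFrom-sound k (suc n) {f} t with ∨-elim {f k} t
  ... | inj₁ p = k , m<m+n k (s≤s z≤n) , p
  ... | inj₂ p with anyFrom-sound (suc k) n p
  ...   | j , j<k+n , q = j , ≤-trans j<k+n (≤-reflexive (sym (+-suc k n))) , q

  allFin₄-sound : ∀ {f} → T (allFin₄ f) → ∀ i → T (f i)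
  allFin₄-sound {f} t zero = proj₁ (∧-elim {f v0} t)
  allFin₄-sound {f} t (suc zero) = proj₁ (∧-elim {f v1} (proj₂ (∧-elim {f v0} t)))
  allFin₄-sound {f} t (suc (suc zero)) = proj₁ (∧-elim {f v2} (proj₂ (∧-elim {f v1} (proj₂ (∧-elim {f v0} t)))))
  allFin₄-sound {f} t (suc (suc (suc zero))) = proj₂ (∧-elim {f v2} (proj₂ (∧-elim {f v1} (proj₂ (∧-elim {f v0} t)))))

  ≟ᵇ⇒≡ : ∀ {i j} → T (i ≟ᵇ j) → i ≡ j
  ≟ᵇ⇒≡ t = toℕ-injective (≡ᵇ⇒≡ _ _ t)

  mod≡% : ∀ x n .{{_ : NonZero n}} → x mod n ≡ x % n
  mod≡% x (suc n) = refl

  denom≤19 : ∀ ℓ → denom ℓ ≤ 19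
  denom≤19 zero = m≤m+n 4 15
  denom≤19 (suc zero) = m≤m+n 5 14
  denom≤19 (suc (suc zero)) = m≤m+n 7 12
  denom≤19 (suc (suc (suc zero))) = m≤m+n 11 8
  denom≤19 (suc (suc (suc (suc zero)))) = m≤m+n 13 6
  denom≤19 (suc (suc (suc (suc (suc zero))))) = m≤m+n 17 2
  denom≤19 (suc (suc (suc (suc (suc (suc zero)))))) = ≤-refl

  module _ {n N D : ℕ} .{{_ : NonZero n}} {c u : Fin 4 → ℕ} (N≤19 : N ≤ 19) (0<c : ∀ j → 0 < c j) (steps : ∀ i → Step n N c u i) where

    At : Fin 4 × ℤ → Set
    At (i , X) = + n ℤ∣.∣ + u i ℤ.- X

    closes-sound : ∀ h {j Y} → All At h → At (j , Y) → T (closes D h j Y) → n ≤ D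
    closes-sound ((i , X) ∷ h) {j} {Y} (p ∷ ps) q t with ∨-elim {(i ≟ᵇ j) ∧ (1 ≤ᵇ ℤ.∣ X ℤ.- Y ∣) ∧ (ℤ.∣ X ℤ.- Y ∣ ≤ᵇ D)} t
    ... | inj₂ t′ = closes-sound h ps q t′
    ... | inj₁ t′ with ∧-elim {i ≟ᵇ j} t′
    ...   | i≡j , t″ with ≟ᵇ⇒≡ {i} {j} i≡j | ∧-elim {1 ≤ᵇ ℤ.∣ X ℤ.- Y ∣} t″
    ...     | refl | 1≤ , ≤D = ≤-trans (∣⇒≤ ⦃ >-nonZero (≤ᵇ⇒≤ 1 _ 1≤) ⦄ n∣) (≤ᵇ⇒≤ _ D ≤D)
      where
      lem : ∀ u X Y → (u ℤ.- Y) ℤ.- (u ℤ.- X) ≡ X ℤ.- Y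
      lem = ℤ-Ring.solve-∀
      n∣ : n ∣ ℤ.∣ X ℤ.- Y ∣
      n∣ = ℤ∣.∣⇒∣ᵤ (subst (+ n ℤ∣.∣_) (lem (+ u i) X Y) (ℤ∣.∣m∣n⇒∣m-n q p))

    -- The search allows every admissible step, and `steps` selects one that is valid for u. The
    -- invariant `At` passes on through uⱼ + q X = (uⱼ + q uᵢ) - q (uᵢ - X).
    walks-sound : ∀ fuel h i X → All At h → At (i , X) → T (walks fuel D N c h i X) → n ≤ D
    walks-sound (suc fuel) h i X ps p t with steps i
    ... | j , i≢j , q , qc+c≡N , n∣u+qu = conclude (∨-elim {closes D ((i , X) ∷ h) j Y} (⇒ᵇ-elim {q * c i + c j ≡ᵇ N}
            (allBelow-sound 20 {walksAlong fuel D N c h i X j} (⇒ᵇ-elim {not (i ≟ᵇ j)} (allFin₄-sound {walksTo fuel D N c h i X} t j) (not-intro {i ≟ᵇ j} λ e → i≢j (≟ᵇ⇒≡ {i} {j} e))) q<20) (≡⇒≡ᵇ _ _ qc+c≡N)))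
      where
      Y = ℤ.- (+ q ℤ.* X)
      q<20 : q < 20
      q<20 = s≤s (≤-trans (≤-trans (≤-trans (≤-reflexive (sym (*-identityʳ q))) (*-monoʳ-≤ q (0<c i))) (≤-trans (m≤m+n _ (c j)) (≤-reflexive qc+c≡N))) N≤19)
      at : At (j , Y)
      at = subst (+ n ℤ∣.∣_) (trans (cong (λ z → z ℤ.- (+ q) ℤ.* ((+ u i) ℤ.- X)) (trans (ℤ.pos-+ (u j) (q * u i)) (cong (λ z → (+ u j) ℤ.+ z) (ℤ.pos-* q (u i))))) (lem (+ u j) (+ q) (+ u i) X))
             (ℤ∣.∣m∣n⇒∣m-n (ℤ∣.∣ᵤ⇒∣ {+ n} {+ (u j + q * u i)} n∣u+qu) (ℤ∣.∣n⇒∣m*n (+ q) p))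
        where
        lem : ∀ a q b X → (a ℤ.+ q ℤ.* b) ℤ.- q ℤ.* (b ℤ.- X) ≡ a ℤ.- (ℤ.- (q ℤ.* X))
        lem = ℤ-Ring.solve-∀
      conclude : T (closes D ((i , X) ∷ h) j Y) ⊎ T (walks fuel D N c ((i , X) ∷ h) j Y) → n ≤ D
      conclude (inj₁ t′) = closes-sound ((i , X) ∷ h) (p ∷ ps) at t′
      conclude (inj₂ t′) = walks-sound fuel ((i , X) ∷ h) j Y (p ∷ ps) at t′

  module _ {n N g : ℕ} .{{_ : NonZero n}} {c u : Fin 4 → ℕ} (C : Core n N g c u) (u₃≡1 : u v3 % n ≡ 1 % n) where

    open Core C

    private
      instance
        Ng≢0 : NonZero (N * g)
        Ng≢0 = subst NonZero n≡Ng (>-nonZero (n≢0⇒n>0 (≢-nonZero⁻¹ n)))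
        N≢0 : NonZero N
        N≢0 = m*n≢0⇒m≢0 N
        g≢0 : NonZero g
        g≢0 = m*n≢0⇒n≢0 N

    -- Because u₃ ≡ 1, the multiple that gives w is congruent to g c₃. Hence g c₃ uⱼ ≡ g cⱼ modulo N
    -- g, and g cancels.
    u-residue : ∀ j → c j < N → c v3 * (u j % n % N) % N ≡ c j
    u-residue j c<N = trans (*-cong-% {N} {c v3} {c v3} {u j % n % N} {u j} refl (trans (m%n%n≡m%n (u j % n) N) (m∣n⇒o%n%m≡o%m N n (u j) (divides g (trans n≡Ng (*-comm N g))))))
      (trans (*-cancelʳ-≡ (c v3 * u j % N) (c j % N) g (trans (m%n*o≡m*o%[n*o] (c v3 * u j) N g) (trans %-eq (sym (m%n*o≡m*o%[n*o] (c j) N g))))) (m<n⇒m%n≡m c<N))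
      where
      K = proj₁ wit
      lem : ∀ g c u → c * u * g ≡ g * c * u
      lem = ℕ-Ring.solve-∀
      mod-n : c v3 * u j * g % n ≡ c j * g % n
      mod-n = trans (cong (_% n) (lem g (c v3) (u j))) (trans (*-cong-% {a = g * c v3} {b = K} {c = u j} {d = u j} K≡ refl)
        (trans (sym (m%n%n≡m%n (K * u j) n)) (cong (_% n) (trans (proj₂ wit j) (*-comm g (c j))))))
        where
        K≡ : g * c v3 % n ≡ K % n
        K≡ = trans (cong (_% n) (sym (proj₂ wit v3))) (trans (m%n%n≡m%n (K * u v3) n) (trans (*-cong-% {a = K} {b = K} refl u₃≡1) (cong (_% n) (*-identityʳ K))))
      %-eq : c v3 * u j * g % (N * g) ≡ c j * g % (N * g)
      %-eq = trans (sym (%-congʳ n≡Ng)) (trans mod-n (%-congʳ n≡Ng))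

    -- With u₃ ≡ 1 the last coordinate of the element k < n is k itself, and `age` forces it to be g
    -- c₃. The coordinate u₀, absent from the search, is recovered from n ∣ Σu.
    no-extraPoint : ∀ {k} → k < n → ¬ T (extraPoint n (g * c v3) (u v1 % n) (u v2 % n) k)
    no-extraPoint {k} k<n t = not-elim (proj₂ (∧-elim {_} {not (k ≡ᵇ g * c v3)} t)) (≡⇒≡ᵇ k (g * c v3) (trans (sym ku₃) (age k Σ≡n v3)))
      where
      a = u v1 % n
      b = u v2 % n
      x = 3 * n ∸ suc (a + b)
      ku₃ : k * u v3 % n ≡ k
      ku₃ = trans (*-cong-% {a = k} {b = k} refl u₃≡1) (trans (cong (_% n) (*-identityʳ k)) (m<n⇒m%n≡m k<n))
      x≡u₀ : u v0 % n ≡ x % n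
      x≡u₀ = +-cancel-% {n} {u v0} {x} (suc (a + b))
        (∣-resp-% (trans (+-cong-% {a = u v0} {b = u v0} refl
            (trans (+-cong-% {a = u v1} {b = a} (sym (m%n%n≡m%n (u v1) n)) (+-cong-% {a = u v2} {b = b} (sym (m%n%n≡m%n (u v2) n)) (+-cong-% {c = 0} {d = 0} u₃≡1 refl))) refl))
            (cong (_% n) (lem (u v0) a b))) n∣Σu)
        (divides 3 (m∸n+n≡m {3 * n} {suc (a + b)} (≤-by (suc n) (m%n<n (u v1) n ⊕ m%n<n (u v2) n) (lem₂ a b n))))
        where
        lem : ∀ u a b → u + (a + (b + (1 + 0))) ≡ u + suc (a + b)
        lem = ℕ-Ring.solve-∀
        lem₂ : ∀ a b n → suc (a + b) + (n + n) + suc n ≡ 3 * n + (suc a + suc b)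
        lem₂ = ℕ-Ring.solve-∀
      reduce : ∀ {y z} → y % n ≡ z % n → (k * y) mod n ≡ k * z % n
      reduce {y} {z} e = trans (mod≡% (k * y) n) (*-cong-% {a = k} {b = k} refl e)
      Σ≡n : sum (λ j → k * u j % n) ≡ n
      Σ≡n = trans (sym (cong₂ _+_ (reduce {x} {u v0} (sym x≡u₀)) (cong₂ _+_ (reduce {a} {u v1} (m%n%n≡m%n (u v1) n)) (cong₂ _+_ (reduce {b} {u v2} (m%n%n≡m%n (u v2) n)) (cong (_+ 0) (sym ku₃))))))
        (≡ᵇ⇒≡ _ n (proj₁ (∧-elim t)))

  module _ {n g : ℕ} .{{_ : NonZero n}} {u : Fin 4 → ℕ} {ℓ : Fin 7} (C : Core n (denom ℓ) g (numer ℓ) u) (u₃≡1 : u v3 % n ≡ 1 % n) where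

    open Core C

    search-sound : 2 ≤ g → g ≤ gMax ℓ → T (exceptional ℓ g (u v1 % n) (u v2 % n))
    search-sound 2≤g g≤gMax = conclude (∨-elim {exceptional ℓ g (b v1 + t v1 * N) (b v2 + t v2 * N)} searched-g)
      where
      N = denom ℓ
      c = numer ℓ
      N≢0 : NonZero N
      N≢0 = m*n≢0⇒m≢0 N ⦃ subst NonZero n≡Ng (>-nonZero (n≢0⇒n>0 (≢-nonZero⁻¹ n))) ⦄
      instance _ = N≢0
      b t : Fin 4 → ℕ
      b j = u j % n % N
      t j = u j % n / N
      b<N : ∀ j → b j < N
      b<N j = m%n<n (u j % n) N
      t<g : ∀ j → t j < g
      t<g j = m<n*o⇒m/o<n (≤-trans (m%n<n (u j) n) (≤-reflexive (trans n≡Ng (*-comm N g))))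
      b+tN : ∀ j → b j + t j * N ≡ u j % n
      b+tN j = sym (m≡m%n+[m/n]*n (u j % n) N)
      filter : ∀ j → c j < N → T ((c v3 * b j) mod N ≡ᵇ c j)
      filter j c<N = ≡⇒≡ᵇ _ (c j) (trans (mod≡% _ N) (u-residue C u₃≡1 j c<N))
      c₁<N : c v1 < N
      c₁<N = ≤-trans (+-mono-≤ (0<c v0) (m≤m+n (c v1) _)) (≤-reflexive Σc≡N)
      c₂<N : c v2 < N
      c₂<N = ≤-trans (+-mono-≤ (0<c v0) (≤-trans (m≤m+n (c v2) _) (m≤n+m _ (c v1)))) (≤-reflexive Σc≡N)
      searched-g : T (exceptional ℓ g (b v1 + t v1 * N) (b v2 + t v2 * N) ∨ anyFrom 0 (N * g) (extraPoint (N * g) (g * c v3) (b v1 + t v1 * N) (b v2 + t v2 * N)))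
      searched-g = allBelow-sound g (allBelow-sound g (⇒ᵇ-elim {1 <ᵇ g} (allBelow-sound (suc (gMax ℓ))
        (⇒ᵇ-elim {(c v3 * b v2) mod N ≡ᵇ c v2} (allBelow-sound N
          (⇒ᵇ-elim {(c v3 * b v1) mod N ≡ᵇ c v1} (allBelow-sound N (search ℓ) (b<N v1)) (filter v1 c₁<N)) (b<N v2)) (filter v2 c₂<N))
        (s≤s g≤gMax)) (<⇒<ᵇ 2≤g)) (t<g v1)) (t<g v2)
      conclude : T (exceptional ℓ g (b v1 + t v1 * N) (b v2 + t v2 * N)) ⊎ T (anyFrom 0 (N * g) (extraPoint (N * g) (g * c v3) (b v1 + t v1 * N) (b v2 + t v2 * N))) →
        T (exceptional ℓ g (u v1 % n) (u v2 % n))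
      conclude (inj₁ e) = subst₂ (λ x y → T (exceptional ℓ g x y)) (b+tN v1) (b+tN v2) e
      conclude (inj₂ p) with anyFrom-sound 0 (N * g) p
      ... | k , k<n , q = ⊥-elim (no-extraPoint C u₃≡1 {k} (≤-trans k<n (≤-reflexive (sym n≡Ng)))
              (subst₂ (λ x y → T (extraPoint n (g * c v3) x y k)) (b+tN v1) (b+tN v2) (subst (λ m → T (extraPoint m (g * c v3) (b v1 + t v1 * N) (b v2 + t v2 * N) k)) (sym n≡Ng) q)))

-- The exceptional residues as the only survivors.

module Classification where

  open import Data.Bool using (T)
  open import Data.Nat
  open import Data.Nat.Properties
  open import Data.Nat.DivMod hiding (_mod_)
  open import Data.Nat.Divisibility
  open import Data.Nat.Tactic.RingSolver
  open import Data.Integer as ℤ using (ℤ; +_)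
  import Data.Integer.Properties as ℤ
  import Data.Integer.Tactic.RingSolver as ℤ-Ring
  import Data.Integer.Divisibility.Signed as ℤ∣
  open import Data.Fin using (Fin; zero; suc)
  open import Data.List using ([])
  open import Data.List.Relation.Unary.All using ([])
  open import Data.Sum using (_⊎_; inj₁; inj₂)
  open import Data.Product using (∃-syntax; _×_; _,_; proj₁; proj₂)
  open import Relation.Binary.PropositionalEquality
  open import Defs hiding (Equivalent)
  open CyclicQuotient
  open Symmetries
  open Search
  open SearchSoundness

  Residue : ℕ → Set
  Residue a = a ≡ 9 ⊎ a ≡ 13 ⊎ a ≡ 17

  exceptional-elim : ∀ ℓ g a b → T (exceptional ℓ g a b) → ℓ ≡ zero × g ≡ 5 × Residue a × Residue b × a ≢ b
  exceptional-elim zero g a b t with ∧-elim {g ≡ᵇ 5} t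
  ... | g≡5 , t₁ with ∧-elim {residue a} t₁
  ...   | ra , t₂ with ∧-elim {residue b} t₂
  ...     | rb , a≢b = refl , ≡ᵇ⇒≡ g 5 g≡5 , residue-elim a ra , residue-elim b rb , λ e → not-elim a≢b (≡⇒≡ᵇ a b e)
    where
    residue-elim : ∀ x → T (residue x) → Residue x
    residue-elim x t with ∨-elim {x ≡ᵇ 9} t
    ... | inj₁ e = inj₁ (≡ᵇ⇒≡ x 9 e)
    ... | inj₂ t′ with ∨-elim {x ≡ᵇ 13} t′
    ...   | inj₁ e = inj₂ (inj₁ (≡ᵇ⇒≡ x 13 e))
    ...   | inj₂ e = inj₂ (inj₂ (≡ᵇ⇒≡ x 17 e))

  module _ {n g : ℕ} .{{_ : NonZero n}} {ℓ : Fin 7} (2≤g : 2 ≤ g) where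

    -- The walks give n ≤ gMax N, hence g ≤ gMax, which is the range covered by the second search.
    normalized-exceptional : ∀ {u} → Core n (denom ℓ) g (numer ℓ) u → Units n u → u v3 % n ≡ 1 % n → T (exceptional ℓ g (u v1 % n) (u v2 % n))
    normalized-exceptional {u} C units u₃≡1 = search-sound {ℓ = ℓ} C u₃≡1 2≤g (*-cancelʳ-≤ g (gMax ℓ) (denom ℓ) ⦃ N≢0 ⦄ (≤-trans (≤-reflexive (trans (*-comm g (denom ℓ)) (sym (Core.n≡Ng C)))) n≤))
      where
      N≢0 : NonZero (denom ℓ)
      N≢0 = m*n≢0⇒m≢0 (denom ℓ) ⦃ subst NonZero (Core.n≡Ng C) (>-nonZero (n≢0⇒n>0 (≢-nonZero⁻¹ n))) ⦄
      at : + n ℤ∣.∣ + u v3 ℤ.- + 1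
      at = subst (+ n ℤ∣.∣_) eq (ℤ∣.∣m∣n⇒∣m-n (ℤ∣.∣ᵤ⇒∣ {+ n} {+ (u v3 + (n ∸ 1))} n∣) (ℤ∣.∣-refl {+ n}))
        where
        0<n : 0 < n
        0<n = n≢0⇒n>0 (≢-nonZero⁻¹ n)
        n∣ : n ∣ u v3 + (n ∸ 1)
        n∣ = ∣-resp-% (+-cong-% {n} {1} {u v3} {n ∸ 1} (sym u₃≡1) refl) (∣-reflexive (sym (m+[n∸m]≡n 0<n)))
        eq : + (u v3 + (n ∸ 1)) ℤ.- + n ≡ + u v3 ℤ.- + 1
        eq = trans (cong (ℤ._- + n) (trans (cong +_ (+-comm (u v3) (n ∸ 1))) (ℤ.pos-+ (n ∸ 1) (u v3)))) (trans (cong (λ x → + (n ∸ 1) ℤ.+ + u v3 ℤ.- x) +n≡) (lem (+ (n ∸ 1)) (+ u v3)))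
          where
          +n≡ : + n ≡ + 1 ℤ.+ + (n ∸ 1)
          +n≡ = trans (cong +_ (sym (m+[n∸m]≡n 0<n))) (ℤ.pos-+ 1 (n ∸ 1))
          lem : ∀ m x → m ℤ.+ x ℤ.- (+ 1 ℤ.+ m) ≡ x ℤ.- + 1
          lem = ℤ-Ring.solve-∀
      n≤ : n ≤ gMax ℓ * denom ℓ
      n≤ = walks-sound {n} {denom ℓ} {gMax ℓ * denom ℓ} {numer ℓ} {u} (denom≤19 ℓ) (Core.0<c C) (step C units 2≤g) 4 [] v3 (+ 1) [] at (all-walks-close ℓ)

    -- Multiplying by the inverse of u₃ normalizes u₃ to 1 but changes u₁ and u₂, so the residues
    -- are only asserted to exist.
    core-exceptional : ∀ {u} → Core n (denom ℓ) g (numer ℓ) u → Units n u → ∃[ a ] ∃[ b ] T (exceptional ℓ g a b)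
    core-exceptional {u} C units = _ , _ , normalized-exceptional (core-scale C v (u v3) (trans (cong (_% n) (*-comm (u v3) v)) vu₃≡1)) units′ vu₃≡1
      where
      v₀ = proj₁ (negative-inverse (u v3) (units v3))
      v = (n ∸ 1) * v₀
      vu₃≡1 : v * u v3 % n ≡ 1 % n
      vu₃≡1 = trans (sym (%-remove-+ʳ (v * u v3) (proj₂ (negative-inverse (u v3) (units v3)))))
        (trans (cong (_% n) (trans (lem (n ∸ 1) v₀ (u v3)) (cong (λ x → 1 + v₀ * u v3 * x) (m+[n∸m]≡n (n≢0⇒n>0 (≢-nonZero⁻¹ n)))))) ([m+kn]%n≡m%n 1 (v₀ * u v3) n))
        where
        lem : ∀ k v x → k * v * x + suc (v * x) ≡ 1 + v * x * (1 + k)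
        lem = solve-∀
      units′ : Units n (λ j → v * u j)
      units′ i k n∣ = ∣-resp-% (trans (*-cong-% {n} {u v3 * v} {1} {k} {k} (trans (cong (_% n) (*-comm (u v3) v)) vu₃≡1) refl) (cong (_% n) (*-identityˡ k)))
        (subst (n ∣_) (lem (u v3) v k) (∣n⇒∣m*n (u v3) (units i (k * v) (subst (n ∣_) (sym (*-assoc k v (u i))) n∣))))
        where
        lem : ∀ x v k → x * (k * v) ≡ x * v * k
        lem = solve-∀

-- Barycentric coordinates with denominators cleared.

module RationalCoordinates where

  open import Data.Nat as ℕ using (ℕ; suc; pred)
  import Data.Nat.Properties as ℕ
  open import Data.Integer as ℤ using (ℤ; +_)
  import Data.Integer.Properties as ℤ
  import Data.Integer.Tactic.RingSolver as ℤ-Ring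
  open import Data.Rational as ℚ using (ℚ; 0ℚ; 1ℚ)
  import Data.Rational.Properties as ℚ
  open import Data.Rational.Unnormalised as ℚᵘ using (ℚᵘ; mkℚᵘ; *≡*; *<*)
  import Data.Rational.Unnormalised.Properties as ℚᵘ
  open import Data.Fin using (Fin; zero; suc)
  open import Data.Product using (_,_)
  open import Relation.Binary.PropositionalEquality
  open import Defs

  -- By computation `frac k d` is `fromℚᵘ (mkℚᵘ k d)`; equations between such fractions thus reduce
  -- to unnormalised ones, which are identities of integers.
  frac : ℤ → ℕ → ℚ
  frac k d = k ℚ./ suc d

  fromℚᵘ-+ : ∀ p q → ℚ.fromℚᵘ p ℚ.+ ℚ.fromℚᵘ q ≡ ℚ.fromℚᵘ (p ℚᵘ.+ q)
  fromℚᵘ-+ p q = ℚ.toℚᵘ-injective (ℚᵘ.≃-trans (ℚ.toℚᵘ-homo-+ (ℚ.fromℚᵘ p) (ℚ.fromℚᵘ q))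
    (ℚᵘ.≃-trans (ℚᵘ.+-cong (ℚ.toℚᵘ-fromℚᵘ p) (ℚ.toℚᵘ-fromℚᵘ q)) (ℚᵘ.≃-sym (ℚ.toℚᵘ-fromℚᵘ (p ℚᵘ.+ q)))))

  fromℚᵘ-* : ∀ p q → ℚ.fromℚᵘ p ℚ.* ℚ.fromℚᵘ q ≡ ℚ.fromℚᵘ (p ℚᵘ.* q)
  fromℚᵘ-* p q = ℚ.toℚᵘ-injective (ℚᵘ.≃-trans (ℚ.toℚᵘ-homo-* (ℚ.fromℚᵘ p) (ℚ.fromℚᵘ q))
    (ℚᵘ.≃-trans (ℚᵘ.*-cong (ℚ.toℚᵘ-fromℚᵘ p) (ℚ.toℚᵘ-fromℚᵘ q)) (ℚᵘ.≃-sym (ℚ.toℚᵘ-fromℚᵘ (p ℚᵘ.* q)))))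

  frac-+ : ∀ a b d → frac a d ℚ.+ frac b d ≡ frac (a ℤ.+ b) d
  frac-+ a b d = trans (fromℚᵘ-+ (mkℚᵘ a d) (mkℚᵘ b d)) (ℚ.fromℚᵘ-cong {mkℚᵘ a d ℚᵘ.+ mkℚᵘ b d} {mkℚᵘ (a ℤ.+ b) d} (*≡* (trans (lem a b (+ suc d)) (cong ((a ℤ.+ b) ℤ.*_) (sym (ℤ.pos-* (suc d) (suc d)))))))
    where
    lem : ∀ a b n → (a ℤ.* n ℤ.+ b ℤ.* n) ℤ.* n ≡ (a ℤ.+ b) ℤ.* (n ℤ.* n)
    lem = ℤ-Ring.solve-∀

  frac-* : ∀ a b d → frac a d ℚ.* toℚ b ≡ frac (a ℤ.* b) d
  frac-* a b d = trans (fromℚᵘ-* (mkℚᵘ a d) (mkℚᵘ b 0)) (ℚ.fromℚᵘ-cong {mkℚᵘ a d ℚᵘ.* mkℚᵘ b 0} {mkℚᵘ (a ℤ.* b) d} (*≡* (cong (λ n → a ℤ.* b ℤ.* + n) (sym (ℕ.*-identityʳ (suc d))))))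

  frac≡toℚ : ∀ {a b d} → a ≡ b ℤ.* + suc d → frac a d ≡ toℚ b
  frac≡toℚ {a} {b} {d} e = ℚ.fromℚᵘ-cong {mkℚᵘ a d} {mkℚᵘ b 0} (*≡* (trans (ℤ.*-identityʳ a) e))

  frac≡toℚ⁻¹ : ∀ {a b d} → frac a d ≡ toℚ b → a ≡ b ℤ.* + suc d
  frac≡toℚ⁻¹ {a} {b} {d} e with ℚ.fromℚᵘ-injective {mkℚᵘ a d} {mkℚᵘ b 0} e
  ... | *≡* e′ = trans (sym (ℤ.*-identityʳ a)) e′

  sum4ᶻ : (Fin 4 → ℤ) → ℤ
  sum4ᶻ f = f v0 ℤ.+ f v1 ℤ.+ f v2 ℤ.+ f v3

  sum4-frac : ∀ (y : Fin 4 → ℤ) d → sum4 (λ j → frac (y j) d) ≡ frac (sum4ᶻ y) d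
  sum4-frac y d = trans (cong (ℚ._+ frac (y v3) d) (trans (cong (ℚ._+ frac (y v2) d) (frac-+ (y v0) (y v1) d)) (frac-+ (y v0 ℤ.+ y v1) (y v2) d)))
    (frac-+ (y v0 ℤ.+ y v1 ℤ.+ y v2) (y v3) d)

  sum4-cong : ∀ {f g} → (∀ j → f j ≡ g j) → sum4 f ≡ sum4 g
  sum4-cong e = cong₂ ℚ._+_ (cong₂ ℚ._+_ (cong₂ ℚ._+_ (e v0) (e v1)) (e v2)) (e v3)

  -- y / n are the barycentric coordinates of p.
  record IntBary (T : Tet) (n : ℤ) (y : Fin 4 → ℤ) (p : Pt) : Set where
    constructor intBary
    field
      total  : sum4ᶻ y ≡ n
      coords : ∀ k → sum4ᶻ (λ j → y j ℤ.* coord (T j) k) ≡ n ℤ.* coord p k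

  barycentric : ∀ {T d y p} → IntBary T (+ suc d) y p → IsBarycentric T (λ j → frac (y j) d) p
  barycentric {T} {d} {y} {p} (intBary Σy Σyv) =
    trans (sum4-frac y d) (frac≡toℚ {b = + 1} (trans Σy (sym (ℤ.*-identityˡ (+ suc d))))) ,
    λ k → trans (sum4-cong (λ j → frac-* (y j) (coord (T j) k) d))
            (trans (sum4-frac (λ j → y j ℤ.* coord (T j) k) d) (frac≡toℚ {b = coord p k} (trans (Σyv k) (ℤ.*-comm (+ suc d) (coord p k)))))

  barycentric⁻¹ : ∀ {T d y p} → IsBarycentric T (λ j → frac (y j) d) p → IntBary T (+ suc d) y p
  barycentric⁻¹ {T} {d} {y} {p} (Σμ , Σμv) =
    intBary (trans (frac≡toℚ⁻¹ {b = + 1} (trans (sym (sum4-frac y d)) Σμ)) (ℤ.*-identityˡ (+ suc d)))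
    λ k → trans (frac≡toℚ⁻¹ {b = coord p k} (trans (sym (sum4-frac (λ j → y j ℤ.* coord (T j) k) d)) (trans (sym (sum4-cong (λ j → frac-* (y j) (coord (T j) k) d))) (Σμv k))))
            (ℤ.*-comm (coord p k) (+ suc d))

  0≤frac : ∀ m d → 0ℚ ℚ.≤ frac (+ m) d
  0≤frac m d = ℚ.nonNegative⁻¹ (frac (+ m) d) ⦃ ℚ.normalize-nonNeg m (suc d) ⦄

  0<frac : ∀ m d → 0ℚ ℚ.< frac (+ suc m) d
  0<frac m d = ℚ.positive⁻¹ (frac (+ suc m) d) ⦃ ℚ.normalize-pos (suc m) (suc d) ⦄

  1<frac : ∀ {m d} → 1ℚ ℚ.< frac (+ m) d → suc d ℕ.< m
  1<frac {m} {d} 1< with ℚᵘ.<-respʳ-≃ (ℚ.toℚᵘ-fromℚᵘ (mkℚᵘ (+ m) d)) (ℚ.toℚᵘ-mono-< 1<)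
  ... | *<* p = ℤ.drop‿+<+ (subst₂ ℤ._<_ (ℤ.*-identityˡ (+ suc d)) (ℤ.*-identityʳ (+ m)) p)

  /ᴺ≡frac : ∀ k ℓ → k /ᴺ ℓ ≡ frac k (pred (denom ℓ))
  /ᴺ≡frac k zero = refl
  /ᴺ≡frac k (suc zero) = refl
  /ᴺ≡frac k (suc (suc zero)) = refl
  /ᴺ≡frac k (suc (suc (suc zero))) = refl
  /ᴺ≡frac k (suc (suc (suc (suc zero)))) = refl
  /ᴺ≡frac k (suc (suc (suc (suc (suc zero))))) = refl
  /ᴺ≡frac k (suc (suc (suc (suc (suc (suc zero)))))) = refl

-- Polynomial identities for determinants, dot products and cross products.

module Vectors where

  open import Data.Integer
  open import Data.Integer.Properties
  open import Data.Integer.Tactic.RingSolver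
  open import Data.Product using (_,_; proj₁; proj₂)
  open import Relation.Binary.PropositionalEquality
  open import Defs

  Pt-≡ : ∀ {x x′ y y′ z z′} → x ≡ x′ → y ≡ y′ → z ≡ z′ → _≡_ {A = Pt} (x , y , z) (x′ , y′ , z′)
  Pt-≡ refl refl refl = refl

  infixr 7 _·ᵖ_
  _·ᵖ_ : ℤ → Pt → Pt
  k ·ᵖ (x , y , z) = (k * x , k * y , k * z)

  _✕_ : Pt → Pt → Pt
  (a , b , c) ✕ (x , y , z) = (b * z - c * y , c * x - a * z , a * y - b * x)

  comb : Pt → Pt → Pt → ℤ → ℤ → ℤ → Pt
  comb e f h x y z = ((x ·ᵖ e) +ᵖ (y ·ᵖ f)) +ᵖ (z ·ᵖ h)

  ·ᵖ-cancel : ∀ k {p q} .{{_ : NonZero k}} → k ·ᵖ p ≡ k ·ᵖ q → p ≡ q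
  ·ᵖ-cancel k e = Pt-≡ (*-cancelˡ-≡ k _ _ (cong proj₁ e)) (*-cancelˡ-≡ k _ _ (cong (λ p → proj₁ (proj₂ p)) e)) (*-cancelˡ-≡ k _ _ (cong (λ p → proj₂ (proj₂ p)) e))

  -- As in the identities that follow, the auxiliary lemmas write the determinants out in full, so
  -- that the ring solver meets plain polynomials.
  cramer : ∀ e f h p → det3 e f h ·ᵖ p ≡ ((det3 p f h ·ᵖ e) +ᵖ (det3 e p h ·ᵖ f)) +ᵖ (det3 e f p ·ᵖ h)
  cramer (e₁ , e₂ , e₃) (f₁ , f₂ , f₃) (h₁ , h₂ , h₃) (p₁ , p₂ , p₃) = Pt-≡ (lem₁ e₁ e₂ e₃ f₁ f₂ f₃ h₁ h₂ h₃ p₁ p₂ p₃) (lem₂ e₁ e₂ e₃ f₁ f₂ f₃ h₁ h₂ h₃ p₁ p₂ p₃) (lem₃ e₁ e₂ e₃ f₁ f₂ f₃ h₁ h₂ h₃ p₁ p₂ p₃)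
    where
    lem₁ : ∀ e₁ e₂ e₃ f₁ f₂ f₃ h₁ h₂ h₃ p₁ p₂ p₃ →
      ((e₁ * (f₂ * h₃ - f₃ * h₂) - e₂ * (f₁ * h₃ - f₃ * h₁) + e₃ * (f₁ * h₂ - f₂ * h₁)) * p₁) ≡
      ((((p₁ * (f₂ * h₃ - f₃ * h₂) - p₂ * (f₁ * h₃ - f₃ * h₁) + p₃ * (f₁ * h₂ - f₂ * h₁)) * e₁) + ((e₁ * (p₂ * h₃ - p₃ * h₂) - e₂ * (p₁ * h₃ - p₃ * h₁) + e₃ * (p₁ * h₂ - p₂ * h₁)) * f₁)) + ((e₁ * (f₂ * p₃ - f₃ * p₂) - e₂ * (f₁ * p₃ - f₃ * p₁) + e₃ * (f₁ * p₂ - f₂ * p₁)) * h₁))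
    lem₁ = solve-∀
    lem₂ : ∀ e₁ e₂ e₃ f₁ f₂ f₃ h₁ h₂ h₃ p₁ p₂ p₃ →
      ((e₁ * (f₂ * h₃ - f₃ * h₂) - e₂ * (f₁ * h₃ - f₃ * h₁) + e₃ * (f₁ * h₂ - f₂ * h₁)) * p₂) ≡
      ((((p₁ * (f₂ * h₃ - f₃ * h₂) - p₂ * (f₁ * h₃ - f₃ * h₁) + p₃ * (f₁ * h₂ - f₂ * h₁)) * e₂) + ((e₁ * (p₂ * h₃ - p₃ * h₂) - e₂ * (p₁ * h₃ - p₃ * h₁) + e₃ * (p₁ * h₂ - p₂ * h₁)) * f₂)) + ((e₁ * (f₂ * p₃ - f₃ * p₂) - e₂ * (f₁ * p₃ - f₃ * p₁) + e₃ * (f₁ * p₂ - f₂ * p₁)) * h₂))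
    lem₂ = solve-∀
    lem₃ : ∀ e₁ e₂ e₃ f₁ f₂ f₃ h₁ h₂ h₃ p₁ p₂ p₃ →
      ((e₁ * (f₂ * h₃ - f₃ * h₂) - e₂ * (f₁ * h₃ - f₃ * h₁) + e₃ * (f₁ * h₂ - f₂ * h₁)) * p₃) ≡
      ((((p₁ * (f₂ * h₃ - f₃ * h₂) - p₂ * (f₁ * h₃ - f₃ * h₁) + p₃ * (f₁ * h₂ - f₂ * h₁)) * e₃) + ((e₁ * (p₂ * h₃ - p₃ * h₂) - e₂ * (p₁ * h₃ - p₃ * h₁) + e₃ * (p₁ * h₂ - p₂ * h₁)) * f₃)) + ((e₁ * (f₂ * p₃ - f₃ * p₂) - e₂ * (f₁ * p₃ - f₃ * p₁) + e₃ * (f₁ * p₂ - f₂ * p₁)) * h₃))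
    lem₃ = solve-∀

  det3-comb₁ : ∀ x y z e f h → det3 (comb e f h x y z) f h ≡ x * det3 e f h
  det3-comb₁ x y z (e₁ , e₂ , e₃) (f₁ , f₂ , f₃) (h₁ , h₂ , h₃) = lem x y z e₁ e₂ e₃ f₁ f₂ f₃ h₁ h₂ h₃
    where
    lem : ∀ x y z e₁ e₂ e₃ f₁ f₂ f₃ h₁ h₂ h₃ →
      ((((x * e₁) + (y * f₁)) + (z * h₁)) * (f₂ * h₃ - f₃ * h₂) - (((x * e₂) + (y * f₂)) + (z * h₂)) * (f₁ * h₃ - f₃ * h₁) + (((x * e₃) + (y * f₃)) + (z * h₃)) * (f₁ * h₂ - f₂ * h₁)) ≡
      x * (e₁ * (f₂ * h₃ - f₃ * h₂) - e₂ * (f₁ * h₃ - f₃ * h₁) + e₃ * (f₁ * h₂ - f₂ * h₁))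
    lem = solve-∀

  det3-comb₂ : ∀ x y z e f h → det3 e (comb e f h x y z) h ≡ y * det3 e f h
  det3-comb₂ x y z (e₁ , e₂ , e₃) (f₁ , f₂ , f₃) (h₁ , h₂ , h₃) = lem x y z e₁ e₂ e₃ f₁ f₂ f₃ h₁ h₂ h₃
    where
    lem : ∀ x y z e₁ e₂ e₃ f₁ f₂ f₃ h₁ h₂ h₃ →
      (e₁ * ((((x * e₂) + (y * f₂)) + (z * h₂)) * h₃ - (((x * e₃) + (y * f₃)) + (z * h₃)) * h₂) - e₂ * ((((x * e₁) + (y * f₁)) + (z * h₁)) * h₃ - (((x * e₃) + (y * f₃)) + (z * h₃)) * h₁) + e₃ * ((((x * e₁) + (y * f₁)) + (z * h₁)) * h₂ - (((x * e₂) + (y * f₂)) + (z * h₂)) * h₁)) ≡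
      y * (e₁ * (f₂ * h₃ - f₃ * h₂) - e₂ * (f₁ * h₃ - f₃ * h₁) + e₃ * (f₁ * h₂ - f₂ * h₁))
    lem = solve-∀

  det3-comb₃ : ∀ x y z e f h → det3 e f (comb e f h x y z) ≡ z * det3 e f h
  det3-comb₃ x y z (e₁ , e₂ , e₃) (f₁ , f₂ , f₃) (h₁ , h₂ , h₃) = lem x y z e₁ e₂ e₃ f₁ f₂ f₃ h₁ h₂ h₃
    where
    lem : ∀ x y z e₁ e₂ e₃ f₁ f₂ f₃ h₁ h₂ h₃ →
      (e₁ * (f₂ * (((x * e₃) + (y * f₃)) + (z * h₃)) - f₃ * (((x * e₂) + (y * f₂)) + (z * h₂))) - e₂ * (f₁ * (((x * e₃) + (y * f₃)) + (z * h₃)) - f₃ * (((x * e₁) + (y * f₁)) + (z * h₁))) + e₃ * (f₁ * (((x * e₂) + (y * f₂)) + (z * h₂)) - f₂ * (((x * e₁) + (y * f₁)) + (z * h₁)))) ≡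
      z * (e₁ * (f₂ * h₃ - f₃ * h₂) - e₂ * (f₁ * h₃ - f₃ * h₁) + e₃ * (f₁ * h₂ - f₂ * h₁))
    lem = solve-∀

  det3-·₁ : ∀ k e f h → det3 (k ·ᵖ e) f h ≡ k * det3 e f h
  det3-·₁ k (e₁ , e₂ , e₃) (f₁ , f₂ , f₃) (h₁ , h₂ , h₃) = lem k e₁ e₂ e₃ f₁ f₂ f₃ h₁ h₂ h₃
    where
    lem : ∀ k e₁ e₂ e₃ f₁ f₂ f₃ h₁ h₂ h₃ →
      ((k * e₁) * (f₂ * h₃ - f₃ * h₂) - (k * e₂) * (f₁ * h₃ - f₃ * h₁) + (k * e₃) * (f₁ * h₂ - f₂ * h₁)) ≡
      k * (e₁ * (f₂ * h₃ - f₃ * h₂) - e₂ * (f₁ * h₃ - f₃ * h₁) + e₃ * (f₁ * h₂ - f₂ * h₁))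
    lem = solve-∀

  det3-·₂ : ∀ k e f h → det3 e (k ·ᵖ f) h ≡ k * det3 e f h
  det3-·₂ k (e₁ , e₂ , e₃) (f₁ , f₂ , f₃) (h₁ , h₂ , h₃) = lem k e₁ e₂ e₃ f₁ f₂ f₃ h₁ h₂ h₃
    where
    lem : ∀ k e₁ e₂ e₃ f₁ f₂ f₃ h₁ h₂ h₃ →
      (e₁ * ((k * f₂) * h₃ - (k * f₃) * h₂) - e₂ * ((k * f₁) * h₃ - (k * f₃) * h₁) + e₃ * ((k * f₁) * h₂ - (k * f₂) * h₁)) ≡
      k * (e₁ * (f₂ * h₃ - f₃ * h₂) - e₂ * (f₁ * h₃ - f₃ * h₁) + e₃ * (f₁ * h₂ - f₂ * h₁))
    lem = solve-∀

  det3-·₃ : ∀ k e f h → det3 e f (k ·ᵖ h) ≡ k * det3 e f h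
  det3-·₃ k (e₁ , e₂ , e₃) (f₁ , f₂ , f₃) (h₁ , h₂ , h₃) = lem k e₁ e₂ e₃ f₁ f₂ f₃ h₁ h₂ h₃
    where
    lem : ∀ k e₁ e₂ e₃ f₁ f₂ f₃ h₁ h₂ h₃ →
      (e₁ * (f₂ * (k * h₃) - f₃ * (k * h₂)) - e₂ * (f₁ * (k * h₃) - f₃ * (k * h₁)) + e₃ * (f₁ * (k * h₂) - f₂ * (k * h₁))) ≡
      k * (e₁ * (f₂ * h₃ - f₃ * h₂) - e₂ * (f₁ * h₃ - f₃ * h₁) + e₃ * (f₁ * h₂ - f₂ * h₁))
    lem = solve-∀

  dot-cross : ∀ e f p → dot (e ✕ f) p ≡ det3 e f p
  dot-cross (e₁ , e₂ , e₃) (f₁ , f₂ , f₃) (p₁ , p₂ , p₃) = lem e₁ e₂ e₃ f₁ f₂ f₃ p₁ p₂ p₃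
    where
    lem : ∀ e₁ e₂ e₃ f₁ f₂ f₃ p₁ p₂ p₃ →
      ((e₂ * f₃ - e₃ * f₂) * p₁ + (e₃ * f₁ - e₁ * f₃) * p₂ + (e₁ * f₂ - e₂ * f₁) * p₃) ≡
      (e₁ * (f₂ * p₃ - f₃ * p₂) - e₂ * (f₁ * p₃ - f₃ * p₁) + e₃ * (f₁ * p₂ - f₂ * p₁))
    lem = solve-∀

  dot-cross-self : ∀ e f → dot e (e ✕ f) ≡ + 0
  dot-cross-self (e₁ , e₂ , e₃) (f₁ , f₂ , f₃) = lem e₁ e₂ e₃ f₁ f₂ f₃
    where
    lem : ∀ e₁ e₂ e₃ f₁ f₂ f₃ →
      (e₁ * (e₂ * f₃ - e₃ * f₂) + e₂ * (e₃ * f₁ - e₁ * f₃) + e₃ * (e₁ * f₂ - e₂ * f₁)) ≡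
      + 0
    lem = solve-∀

  cross-cross : ∀ e f h → (e ✕ f) ✕ (e ✕ h) ≡ det3 e f h ·ᵖ e
  cross-cross (e₁ , e₂ , e₃) (f₁ , f₂ , f₃) (h₁ , h₂ , h₃) = Pt-≡ (lem₁ e₁ e₂ e₃ f₁ f₂ f₃ h₁ h₂ h₃) (lem₂ e₁ e₂ e₃ f₁ f₂ f₃ h₁ h₂ h₃) (lem₃ e₁ e₂ e₃ f₁ f₂ f₃ h₁ h₂ h₃)
    where
    lem₁ : ∀ e₁ e₂ e₃ f₁ f₂ f₃ h₁ h₂ h₃ →
      ((e₃ * f₁ - e₁ * f₃) * (e₁ * h₂ - e₂ * h₁) - (e₁ * f₂ - e₂ * f₁) * (e₃ * h₁ - e₁ * h₃)) ≡
      ((e₁ * (f₂ * h₃ - f₃ * h₂) - e₂ * (f₁ * h₃ - f₃ * h₁) + e₃ * (f₁ * h₂ - f₂ * h₁)) * e₁)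
    lem₁ = solve-∀
    lem₂ : ∀ e₁ e₂ e₃ f₁ f₂ f₃ h₁ h₂ h₃ →
      ((e₁ * f₂ - e₂ * f₁) * (e₂ * h₃ - e₃ * h₂) - (e₂ * f₃ - e₃ * f₂) * (e₁ * h₂ - e₂ * h₁)) ≡
      ((e₁ * (f₂ * h₃ - f₃ * h₂) - e₂ * (f₁ * h₃ - f₃ * h₁) + e₃ * (f₁ * h₂ - f₂ * h₁)) * e₂)
    lem₂ = solve-∀
    lem₃ : ∀ e₁ e₂ e₃ f₁ f₂ f₃ h₁ h₂ h₃ →
      ((e₂ * f₃ - e₃ * f₂) * (e₃ * h₁ - e₁ * h₃) - (e₃ * f₁ - e₁ * f₃) * (e₂ * h₃ - e₃ * h₂)) ≡
      ((e₁ * (f₂ * h₃ - f₃ * h₂) - e₂ * (f₁ * h₃ - f₃ * h₁) + e₃ * (f₁ * h₂ - f₂ * h₁)) * e₃)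
    lem₃ = solve-∀

  cross-plane : ∀ x y z w e f → ((x ·ᵖ e) +ᵖ (y ·ᵖ f)) ✕ ((z ·ᵖ e) +ᵖ (w ·ᵖ f)) ≡ (x * w - y * z) ·ᵖ (e ✕ f)
  cross-plane x y z w (e₁ , e₂ , e₃) (f₁ , f₂ , f₃) = Pt-≡ (lem₁ x y z w e₁ e₂ e₃ f₁ f₂ f₃) (lem₂ x y z w e₁ e₂ e₃ f₁ f₂ f₃) (lem₃ x y z w e₁ e₂ e₃ f₁ f₂ f₃)
    where
    lem₁ : ∀ x y z w e₁ e₂ e₃ f₁ f₂ f₃ →
      (((x * e₂) + (y * f₂)) * ((z * e₃) + (w * f₃)) - ((x * e₃) + (y * f₃)) * ((z * e₂) + (w * f₂))) ≡
      ((x * w - y * z) * (e₂ * f₃ - e₃ * f₂))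
    lem₁ = solve-∀
    lem₂ : ∀ x y z w e₁ e₂ e₃ f₁ f₂ f₃ →
      (((x * e₃) + (y * f₃)) * ((z * e₁) + (w * f₁)) - ((x * e₁) + (y * f₁)) * ((z * e₃) + (w * f₃))) ≡
      ((x * w - y * z) * (e₃ * f₁ - e₁ * f₃))
    lem₂ = solve-∀
    lem₃ : ∀ x y z w e₁ e₂ e₃ f₁ f₂ f₃ →
      (((x * e₁) + (y * f₁)) * ((z * e₂) + (w * f₂)) - ((x * e₂) + (y * f₂)) * ((z * e₁) + (w * f₁))) ≡
      ((x * w - y * z) * (e₁ * f₂ - e₂ * f₁))
    lem₃ = solve-∀

  det3-comb₃- : ∀ k e f h p → det3 e f (p -ᵖ (k ·ᵖ h)) ≡ det3 e f p - k * det3 e f h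
  det3-comb₃- k (e₁ , e₂ , e₃) (f₁ , f₂ , f₃) (h₁ , h₂ , h₃) (p₁ , p₂ , p₃) = lem k e₁ e₂ e₃ f₁ f₂ f₃ h₁ h₂ h₃ p₁ p₂ p₃
    where
    lem : ∀ k e₁ e₂ e₃ f₁ f₂ f₃ h₁ h₂ h₃ p₁ p₂ p₃ →
      (e₁ * (f₂ * (p₃ - k * h₃) - f₃ * (p₂ - k * h₂)) - e₂ * (f₁ * (p₃ - k * h₃) - f₃ * (p₁ - k * h₁)) + e₃ * (f₁ * (p₂ - k * h₂) - f₂ * (p₁ - k * h₁))) ≡
      (e₁ * (f₂ * p₃ - f₃ * p₂) - e₂ * (f₁ * p₃ - f₃ * p₁) + e₃ * (f₁ * p₂ - f₂ * p₁)) - k * (e₁ * (f₂ * h₃ - f₃ * h₂) - e₂ * (f₁ * h₃ - f₃ * h₁) + e₃ * (f₁ * h₂ - f₂ * h₁))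
    lem = solve-∀

  dot-·ˡ : ∀ k e f → dot (k ·ᵖ e) f ≡ k * dot e f
  dot-·ˡ k (e₁ , e₂ , e₃) (f₁ , f₂ , f₃) = lem k e₁ e₂ e₃ f₁ f₂ f₃
    where
    lem : ∀ k e₁ e₂ e₃ f₁ f₂ f₃ →
      ((k * e₁) * f₁ + (k * e₂) * f₂ + (k * e₃) * f₃) ≡
      k * (e₁ * f₁ + e₂ * f₂ + e₃ * f₃)
    lem = solve-∀

  dot-·ʳ : ∀ k e f → dot e (k ·ᵖ f) ≡ k * dot e f
  dot-·ʳ k (e₁ , e₂ , e₃) (f₁ , f₂ , f₃) = lem k e₁ e₂ e₃ f₁ f₂ f₃
    where
    lem : ∀ k e₁ e₂ e₃ f₁ f₂ f₃ →
      (e₁ * (k * f₁) + e₂ * (k * f₂) + e₃ * (k * f₃)) ≡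
      k * (e₁ * f₁ + e₂ * f₂ + e₃ * f₃)
    lem = solve-∀

  dot-comb : ∀ x y z p e f h → dot p (comb e f h x y z) ≡ x * dot p e + y * dot p f + z * dot p h
  dot-comb x y z (p₁ , p₂ , p₃) (e₁ , e₂ , e₃) (f₁ , f₂ , f₃) (h₁ , h₂ , h₃) = lem x y z p₁ p₂ p₃ e₁ e₂ e₃ f₁ f₂ f₃ h₁ h₂ h₃
    where
    lem : ∀ x y z p₁ p₂ p₃ e₁ e₂ e₃ f₁ f₂ f₃ h₁ h₂ h₃ →
      (p₁ * (((x * e₁) + (y * f₁)) + (z * h₁)) + p₂ * (((x * e₂) + (y * f₂)) + (z * h₂)) + p₃ * (((x * e₃) + (y * f₃)) + (z * h₃))) ≡
      x * (p₁ * e₁ + p₂ * e₂ + p₃ * e₃) + y * (p₁ * f₁ + p₂ * f₂ + p₃ * f₃) + z * (p₁ * h₁ + p₂ * h₂ + p₃ * h₃)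
    lem = solve-∀

  -- The cofactor matrix has the square of the determinant; for determinant ± 1 this makes the dual
  -- basis unimodular.
  det3-cross : ∀ e f h → det3 (f ✕ h) (h ✕ e) (e ✕ f) ≡ det3 e f h * det3 e f h
  det3-cross (e₁ , e₂ , e₃) (f₁ , f₂ , f₃) (h₁ , h₂ , h₃) = lem e₁ e₂ e₃ f₁ f₂ f₃ h₁ h₂ h₃
    where
    lem : ∀ e₁ e₂ e₃ f₁ f₂ f₃ h₁ h₂ h₃ →
      ((f₂ * h₃ - f₃ * h₂) * ((h₃ * e₁ - h₁ * e₃) * (e₁ * f₂ - e₂ * f₁) - (h₁ * e₂ - h₂ * e₁) * (e₃ * f₁ - e₁ * f₃)) - (f₃ * h₁ - f₁ * h₃) * ((h₂ * e₃ - h₃ * e₂) * (e₁ * f₂ - e₂ * f₁) - (h₁ * e₂ - h₂ * e₁) * (e₂ * f₃ - e₃ * f₂)) + (f₁ * h₂ - f₂ * h₁) * ((h₂ * e₃ - h₃ * e₂) * (e₃ * f₁ - e₁ * f₃) - (h₃ * e₁ - h₁ * e₃) * (e₂ * f₃ - e₃ * f₂))) ≡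
      (e₁ * (f₂ * h₃ - f₃ * h₂) - e₂ * (f₁ * h₃ - f₃ * h₁) + e₃ * (f₁ * h₂ - f₂ * h₁)) * (e₁ * (f₂ * h₃ - f₃ * h₂) - e₂ * (f₁ * h₃ - f₃ * h₁) + e₃ * (f₁ * h₂ - f₂ * h₁))
    lem = solve-∀

  det3-·· : ∀ k e f h → det3 (k ·ᵖ e) (k ·ᵖ f) (k ·ᵖ h) ≡ k * k * k * det3 e f h
  det3-·· k (e₁ , e₂ , e₃) (f₁ , f₂ , f₃) (h₁ , h₂ , h₃) = lem k e₁ e₂ e₃ f₁ f₂ f₃ h₁ h₂ h₃
    where
    lem : ∀ k e₁ e₂ e₃ f₁ f₂ f₃ h₁ h₂ h₃ →
      ((k * e₁) * ((k * f₂) * (k * h₃) - (k * f₃) * (k * h₂)) - (k * e₂) * ((k * f₁) * (k * h₃) - (k * f₃) * (k * h₁)) + (k * e₃) * ((k * f₁) * (k * h₂) - (k * f₂) * (k * h₁))) ≡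
      k * k * k * (e₁ * (f₂ * h₃ - f₃ * h₂) - e₂ * (f₁ * h₃ - f₃ * h₁) + e₃ * (f₁ * h₂ - f₂ * h₁))
    lem = solve-∀

  det3-cyclic : ∀ e f h → det3 f h e ≡ det3 e f h
  det3-cyclic (e₁ , e₂ , e₃) (f₁ , f₂ , f₃) (h₁ , h₂ , h₃) = lem e₁ e₂ e₃ f₁ f₂ f₃ h₁ h₂ h₃
    where
    lem : ∀ e₁ e₂ e₃ f₁ f₂ f₃ h₁ h₂ h₃ →
      (f₁ * (h₂ * e₃ - h₃ * e₂) - f₂ * (h₁ * e₃ - h₃ * e₁) + f₃ * (h₁ * e₂ - h₂ * e₁)) ≡
      (e₁ * (f₂ * h₃ - f₃ * h₂) - e₂ * (f₁ * h₃ - f₃ * h₁) + e₃ * (f₁ * h₂ - f₂ * h₁))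
    lem = solve-∀

  det3-repeat₁₃ : ∀ e f → det3 e f e ≡ + 0
  det3-repeat₁₃ (e₁ , e₂ , e₃) (f₁ , f₂ , f₃) = lem e₁ e₂ e₃ f₁ f₂ f₃
    where
    lem : ∀ e₁ e₂ e₃ f₁ f₂ f₃ →
      (e₁ * (f₂ * e₃ - f₃ * e₂) - e₂ * (f₁ * e₃ - f₃ * e₁) + e₃ * (f₁ * e₂ - f₂ * e₁)) ≡
      + 0
    lem = solve-∀

  det3-repeat₂₃ : ∀ e f → det3 e f f ≡ + 0
  det3-repeat₂₃ (e₁ , e₂ , e₃) (f₁ , f₂ , f₃) = lem e₁ e₂ e₃ f₁ f₂ f₃
    where
    lem : ∀ e₁ e₂ e₃ f₁ f₂ f₃ →
      (e₁ * (f₂ * f₃ - f₃ * f₂) - e₂ * (f₁ * f₃ - f₃ * f₁) + e₃ * (f₁ * f₂ - f₂ * f₁)) ≡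
      + 0
    lem = solve-∀
  det3-shear : ∀ x y e f p → det3 e f (p -ᵖ ((x ·ᵖ e) +ᵖ (y ·ᵖ f))) ≡ det3 e f p
  det3-shear x y (e₁ , e₂ , e₃) (f₁ , f₂ , f₃) (p₁ , p₂ , p₃) = lem x y e₁ e₂ e₃ f₁ f₂ f₃ p₁ p₂ p₃
    where
    lem : ∀ x y e₁ e₂ e₃ f₁ f₂ f₃ p₁ p₂ p₃ →
      (e₁ * (f₂ * (p₃ - (x * e₃ + y * f₃)) - f₃ * (p₂ - (x * e₂ + y * f₂))) - e₂ * (f₁ * (p₃ - (x * e₃ + y * f₃)) - f₃ * (p₁ - (x * e₁ + y * f₁))) + e₃ * (f₁ * (p₂ - (x * e₂ + y * f₂)) - f₂ * (p₁ - (x * e₁ + y * f₁)))) ≡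
      (e₁ * (f₂ * p₃ - f₃ * p₂) - e₂ * (f₁ * p₃ - f₃ * p₁) + e₃ * (f₁ * p₂ - f₂ * p₁))
    lem = solve-∀

  unit₁ unit₂ unit₃ : Pt
  unit₁ = (+ 1 , + 0 , + 0)
  unit₂ = (+ 0 , + 1 , + 0)
  unit₃ = (+ 0 , + 0 , + 1)

  det3-unit₂₃ : ∀ e → det3 e unit₂ unit₃ ≡ proj₁ e
  det3-unit₂₃ (a , b , c) = lem a b c
    where
    lem : ∀ a b c → a * (+ 1 * + 1 - + 0 * + 0) - b * (+ 0 * + 1 - + 0 * + 0) + c * (+ 0 * + 0 - + 1 * + 0) ≡ a
    lem = solve-∀

  det3-unit₃₁ : ∀ e → det3 e unit₃ unit₁ ≡ proj₁ (proj₂ e)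
  det3-unit₃₁ (a , b , c) = lem a b c
    where
    lem : ∀ a b c → a * (+ 0 * + 0 - + 1 * + 0) - b * (+ 0 * + 0 - + 1 * + 1) + c * (+ 0 * + 0 - + 0 * + 1) ≡ b
    lem = solve-∀

  det3-unit₁₂ : ∀ e → det3 e unit₁ unit₂ ≡ proj₂ (proj₂ e)
  det3-unit₁₂ (a , b , c) = lem a b c
    where
    lem : ∀ a b c → a * (+ 0 * + 0 - + 0 * + 1) - b * (+ 1 * + 0 - + 0 * + 0) + c * (+ 1 * + 1 - + 0 * + 0) ≡ c
    lem = solve-∀

  dot-- : ∀ r p q → dot r p + - dot r q ≡ dot r (p -ᵖ q)
  dot-- (a , b , c) (x , y , z) (x′ , y′ , z′) = lem a b c x y z x′ y′ z′
    where
    lem : ∀ a b c x y z x′ y′ z′ → (a * x + b * y + c * z) + - (a * x′ + b * y′ + c * z′) ≡ a * (x - x′) + b * (y - y′) + c * (z - z′)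
    lem = solve-∀

-- Lattice points of T through their integral barycentric coordinates.

module LatticePoints where

  open import Data.Nat as ℕ using (ℕ; suc; zero)
  open import Data.Integer hiding (suc)
  open import Data.Integer.Properties
  open import Data.Integer.Tactic.RingSolver
  open import Data.Rational using (ℚ; 0ℚ)
  import Data.Rational as ℚ
  open import Data.Fin using (Fin; zero; suc)
  open import Data.Product using (∃-syntax; _×_; _,_; proj₁; proj₂)
  open import Data.Sum using (_⊎_; inj₁; inj₂)
  open import Relation.Binary.PropositionalEquality
  open import Defs
  open RationalCoordinates
  open Vectors

  coord-ext : ∀ {p q} → (∀ k → coord p k ≡ coord q k) → p ≡ q
  coord-ext e = Pt-≡ (e zero) (e (suc zero)) (e (suc (suc zero)))

  coord-+ : ∀ p q k → coord (p +ᵖ q) k ≡ coord p k + coord q k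
  coord-+ p q zero = refl
  coord-+ p q (suc zero) = refl
  coord-+ p q (suc (suc zero)) = refl

  coord-- : ∀ p q k → coord (p -ᵖ q) k ≡ coord p k - coord q k
  coord-- p q zero = refl
  coord-- p q (suc zero) = refl
  coord-- p q (suc (suc zero)) = refl

  coord-· : ∀ n p k → coord (n ·ᵖ p) k ≡ n * coord p k
  coord-· n p zero = refl
  coord-· n p (suc zero) = refl
  coord-· n p (suc (suc zero)) = refl

  coord-comb : ∀ e f h x y z k → coord (comb e f h x y z) k ≡ x * coord e k + y * coord f k + z * coord h k
  coord-comb e f h x y z zero = refl
  coord-comb e f h x y z (suc zero) = refl
  coord-comb e f h x y z (suc (suc zero)) = refl

  δ : Fin 4 → Fin 4 → ℤ
  δ zero zero = + 1
  δ zero (suc _) = + 0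
  δ (suc _) zero = + 0
  δ (suc zero) (suc zero) = + 1
  δ (suc zero) (suc (suc _)) = + 0
  δ (suc (suc _)) (suc zero) = + 0
  δ (suc (suc zero)) (suc (suc zero)) = + 1
  δ (suc (suc zero)) (suc (suc (suc zero))) = + 0
  δ (suc (suc (suc zero))) (suc (suc zero)) = + 0
  δ (suc (suc (suc zero))) (suc (suc (suc zero))) = + 1

  -- When n p = a e₁ + b e₂ + e₃, the n-fold barycentric coordinates of v₀ + k p + x e₁ + y e₂.
  coordinates : (n a b k x y : ℤ) → Fin 4 → ℤ
  coordinates n a b k x y zero = n - (k * a + x * n + (k * b + y * n) + k)
  coordinates n a b k x y (suc zero) = k * a + x * n
  coordinates n a b k x y (suc (suc zero)) = k * b + y * n
  coordinates n a b k x y (suc (suc (suc zero))) = k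

  module Edges (T : Tet) where

    e₁ e₂ e₃ : Pt
    e₁ = T v1 -ᵖ T v0
    e₂ = T v2 -ᵖ T v0
    e₃ = T v3 -ᵖ T v0

    D : ℤ
    D = detT T

    edges⇒bary : ∀ {n y q} → sum4ᶻ y ≡ n → n ·ᵖ q ≡ comb e₁ e₂ e₃ (y v1) (y v2) (y v3) → IntBary T n y (T v0 +ᵖ q)
    edges⇒bary {n} {y} {q} Σy e = intBary Σy λ k → trans (lem (y v0) (y v1) (y v2) (y v3) (coord (T v0) k) (coord (T v1) k) (coord (T v2) k) (coord (T v3) k))
      (trans (cong₂ (λ a b → a * coord (T v0) k + b) Σy (sym (e′ k))) (trans (sym (*-distribˡ-+ n (coord (T v0) k) (coord q k))) (cong (n *_) (sym (coord-+ (T v0) q k)))))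
      where
      e′ : ∀ k → n * coord q k ≡ y v1 * (coord (T v1) k - coord (T v0) k) + y v2 * (coord (T v2) k - coord (T v0) k) + y v3 * (coord (T v3) k - coord (T v0) k)
      e′ k = trans (sym (coord-· n q k)) (trans (cong (λ p → coord p k) e) (trans (coord-comb e₁ e₂ e₃ (y v1) (y v2) (y v3) k)
        (cong₂ _+_ (cong₂ _+_ (cong (y v1 *_) (coord-- (T v1) (T v0) k)) (cong (y v2 *_) (coord-- (T v2) (T v0) k))) (cong (y v3 *_) (coord-- (T v3) (T v0) k)))))
      lem : ∀ y₀ y₁ y₂ y₃ a b c d → y₀ * a + y₁ * b + y₂ * c + y₃ * d ≡ (y₀ + y₁ + y₂ + y₃) * a + (y₁ * (b - a) + y₂ * (c - a) + y₃ * (d - a))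
      lem = solve-∀

    bary⇒edges : ∀ {n y p} → IntBary T n y p → n ·ᵖ (p -ᵖ T v0) ≡ comb e₁ e₂ e₃ (y v1) (y v2) (y v3)
    bary⇒edges {n} {y} {p} (intBary Σy e) = coord-ext λ k → trans (coord-· n (p -ᵖ T v0) k) (trans (cong (n *_) (coord-- p (T v0) k)) (trans (lem₁ n (coord p k) (coord (T v0) k))
      (trans (cong₂ (λ a b → a - b * coord (T v0) k) (sym (e k)) (sym Σy)) (trans (lem₂ (y v0) (y v1) (y v2) (y v3) (coord (T v0) k) (coord (T v1) k) (coord (T v2) k) (coord (T v3) k))
      (trans (sym (cong₂ _+_ (cong₂ _+_ (cong (y v1 *_) (coord-- (T v1) (T v0) k)) (cong (y v2 *_) (coord-- (T v2) (T v0) k))) (cong (y v3 *_) (coord-- (T v3) (T v0) k))))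
        (sym (coord-comb e₁ e₂ e₃ (y v1) (y v2) (y v3) k)))))))
      where
      lem₁ : ∀ n p a → n * (p - a) ≡ n * p - n * a
      lem₁ = solve-∀
      lem₂ : ∀ y₀ y₁ y₂ y₃ a b c d → y₀ * a + y₁ * b + y₂ * c + y₃ * d - (y₀ + y₁ + y₂ + y₃) * a ≡ y₁ * (b - a) + y₂ * (c - a) + y₃ * (d - a)
      lem₂ = solve-∀

    -- By Cramer's rule, D times the barycentric coordinates of v₀ + q.
    minor : Pt → Fin 4 → ℤ
    minor q zero = D - (det3 q e₂ e₃ + det3 e₁ q e₃ + det3 e₁ e₂ q)
    minor q (suc zero) = det3 q e₂ e₃
    minor q (suc (suc zero)) = det3 e₁ q e₃
    minor q (suc (suc (suc zero))) = det3 e₁ e₂ q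

    bary-minor : ∀ {n y p} → IntBary T n y p → ∀ j → y j * D ≡ n * minor (p -ᵖ T v0) j
    bary-minor {n} {y} {p} I = λ where
        zero → trans (lem₁ (y v0) (y v1) (y v2) (y v3) D) (trans (cong₂ _-_ (cong (_* D) (IntBary.total I)) (cong₂ _+_ (cong₂ _+_ (m₁) (m₂)) (m₃))) (lem₂ n D (det3 q e₂ e₃) (det3 e₁ q e₃) (det3 e₁ e₂ q)))
        (suc zero) → m₁
        (suc (suc zero)) → m₂
        (suc (suc (suc zero))) → m₃
      where
      q = p -ᵖ T v0
      E : n ·ᵖ q ≡ comb e₁ e₂ e₃ (y v1) (y v2) (y v3)
      E = bary⇒edges I
      m₁ : y v1 * D ≡ n * det3 q e₂ e₃
      m₁ = trans (sym (det3-comb₁ (y v1) (y v2) (y v3) e₁ e₂ e₃)) (trans (cong (λ v → det3 v e₂ e₃) (sym E)) (det3-·₁ n q e₂ e₃))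
      m₂ : y v2 * D ≡ n * det3 e₁ q e₃
      m₂ = trans (sym (det3-comb₂ (y v1) (y v2) (y v3) e₁ e₂ e₃)) (trans (cong (λ v → det3 e₁ v e₃) (sym E)) (det3-·₂ n e₁ q e₃))
      m₃ : y v3 * D ≡ n * det3 e₁ e₂ q
      m₃ = trans (sym (det3-comb₃ (y v1) (y v2) (y v3) e₁ e₂ e₃)) (trans (cong (λ v → det3 e₁ e₂ v) (sym E)) (det3-·₃ n e₁ e₂ q))
      lem₁ : ∀ y₀ y₁ y₂ y₃ D → y₀ * D ≡ (y₀ + y₁ + y₂ + y₃) * D - (y₁ * D + y₂ * D + y₃ * D)
      lem₁ = solve-∀
      lem₂ : ∀ n D x y z → n * D - (n * x + n * y + n * z) ≡ n * (D - (x + y + z))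
      lem₂ = solve-∀

    -- After multiplication by D both sides are m n times the same minor. The scales n and m may
    -- differ because w is given over N and other points over the volume.
    bary-unique : D ≢ + 0 → ∀ {n m y z p} → IntBary T n y p → IntBary T m z p → ∀ j → m * y j ≡ n * z j
    bary-unique D≢0 {n} {m} {y} {z} {p} I J j = *-cancelʳ-≡ (m * y j) (n * z j) D ⦃ ≢-nonZero D≢0 ⦄
      (trans (*-assoc m (y j) D) (trans (cong (m *_) (bary-minor I j)) (trans (lem m n (minor (p -ᵖ T v0) j)) (trans (cong (n *_) (sym (bary-minor J j))) (sym (*-assoc n (z j) D))))))
      where
      lem : ∀ m n x → m * (n * x) ≡ n * (m * x)
      lem = solve-∀

    vertex-bary : ∀ i → IntBary T (+ 1) (δ i) (T i)
    vertex-bary i = intBary (Σδ i) (Σδv i)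
      where
      Σδ : ∀ i → sum4ᶻ (δ i) ≡ + 1
      Σδ zero = refl
      Σδ (suc zero) = refl
      Σδ (suc (suc zero)) = refl
      Σδ (suc (suc (suc zero))) = refl
      lem₀ : ∀ a b c d → + 1 * a + + 0 * b + + 0 * c + + 0 * d ≡ + 1 * a
      lem₀ = solve-∀
      lem₁ : ∀ a b c d → + 0 * a + + 1 * b + + 0 * c + + 0 * d ≡ + 1 * b
      lem₁ = solve-∀
      lem₂ : ∀ a b c d → + 0 * a + + 0 * b + + 1 * c + + 0 * d ≡ + 1 * c
      lem₂ = solve-∀
      lem₃ : ∀ a b c d → + 0 * a + + 0 * b + + 0 * c + + 1 * d ≡ + 1 * d
      lem₃ = solve-∀
      Σδv : ∀ i k → sum4ᶻ (λ j → δ i j * coord (T j) k) ≡ + 1 * coord (T i) k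
      Σδv zero k = lem₀ (coord (T v0) k) (coord (T v1) k) (coord (T v2) k) (coord (T v3) k)
      Σδv (suc zero) k = lem₁ (coord (T v0) k) (coord (T v1) k) (coord (T v2) k) (coord (T v3) k)
      Σδv (suc (suc zero)) k = lem₂ (coord (T v0) k) (coord (T v1) k) (coord (T v2) k) (coord (T v3) k)
      Σδv (suc (suc (suc zero))) k = lem₃ (coord (T v0) k) (coord (T v1) k) (coord (T v2) k) (coord (T v3) k)

  module OnePoint (T : Tet) (w : Pt) (one : OnePointWith T w) {N-1 : ℕ} {c : Fin 4 → ℕ} (Iw : IntBary T (+ suc N-1) (λ j → + c j) w) where

    open Edges T public

    D≢0 : D ≢ + 0
    D≢0 = proj₁ one

    zero-or-positive : ∀ (y : Fin 4 → ℕ) → (∃[ j ] y j ≡ 0) ⊎ (∀ j → ∃[ m ] y j ≡ suc m)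
    zero-or-positive y with y v0 in p₀ | y v1 in p₁ | y v2 in p₂ | y v3 in p₃
    ... | zero | _ | _ | _ = inj₁ (v0 , p₀)
    ... | suc _ | zero | _ | _ = inj₁ (v1 , p₁)
    ... | suc _ | suc _ | zero | _ = inj₁ (v2 , p₂)
    ... | suc _ | suc _ | suc _ | zero = inj₁ (v3 , p₃)
    ... | suc _ | suc _ | suc _ | suc _ = inj₂ λ where
      zero → _ , p₀
      (suc zero) → _ , p₁
      (suc (suc zero)) → _ , p₂
      (suc (suc (suc zero))) → _ , p₃

    -- A zero coordinate puts p on the boundary, where cleanness makes it a vertex; otherwise p is
    -- interior, hence w. Positivity is kept in the second alternative to exclude points of the face
    -- opposite v₃ later.
    lattice-points : ∀ {d y p} → IntBary T (+ suc d) (λ j → + y j) p →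
      (∃[ i ] ∀ j → + y j ≡ + suc d * δ i j) ⊎ ((∀ j → ∃[ m ] y j ≡ suc m) × (∀ j → suc N-1 ℕ.* y j ≡ suc d ℕ.* c j))
    lattice-points {d} {y} {p} I with zero-or-positive y
    ... | inj₁ (j , yⱼ≡0) = inj₁ (vertex (proj₁ (proj₂ one) p (_ , barycentric {T} {d} {λ j → + y j} {p} I , (λ j → 0≤frac (y j) d) , j , trans (cong (λ m → frac (+ m) d) yⱼ≡0) (frac≡toℚ {b = + 0} {d} refl))))
      where
      vertex : (∃[ i ] p ≡ T i) → ∃[ i ] ∀ j → + y j ≡ + suc d * δ i j
      vertex (i , refl) = i , λ j → trans (sym (*-identityˡ (+ y j))) (bary-unique D≢0 {+ suc d} {+ 1} {λ j → + y j} {δ i} {T i} I (vertex-bary i) j)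
    ... | inj₂ pos = inj₂ (pos , λ j → +-injective (trans (pos-* (suc N-1) (y j)) (trans (bary-unique D≢0 {+ suc d} {+ suc N-1} {λ j → + y j} {λ j → + c j} {w} (subst (IntBary T (+ suc d) (λ j → + y j)) p≡w I) Iw j) (sym (pos-* (suc d) (c j))))))
      where
      0<yⱼ : ∀ j → 0ℚ ℚ.< frac (+ y j) d
      0<yⱼ j = subst (λ m → 0ℚ ℚ.< frac (+ m) d) (sym (proj₂ (pos j))) (0<frac (proj₁ (pos j)) d)
      p≡w : p ≡ w
      p≡w = proj₂ (proj₂ (proj₂ one)) p (_ , barycentric {T} {d} {λ j → + y j} {p} I , 0<yⱼ)

-- A basis of ℤ³ containing two edges of T, and the resulting normal form.

module NormalForms where

  open import Data.Nat as ℕ using (ℕ; suc; zero)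
  import Data.Nat.Properties as ℕ
  open import Data.Nat.GCD using (module Bézout; module GCD)
  import Data.Nat.Divisibility as ℕ∣
  open import Data.Integer hiding (suc)
  open import Data.Integer.Properties
  open import Data.Integer.DivMod using (_%ℕ_; _/ℕ_; n%ℕd<d; a≡a%ℕn+[a/ℕn]*n)
  open import Data.Integer.Tactic.RingSolver
  open import Data.Fin using (Fin; zero; suc)
  open import Data.Product using (∃-syntax; _×_; _,_; proj₁; proj₂)
  open import Data.Sum using (_⊎_; inj₁; inj₂)
  open import Data.Empty using (⊥; ⊥-elim)
  open import Relation.Nullary using (yes; no)
  open import Relation.Binary.PropositionalEquality
  open import Defs
  open RationalCoordinates
  open Vectors
  open LatticePoints

  sign-split : ∀ D → D ≢ + 0 → ∃[ s ] ∃[ d ] (D ≡ s * + suc d × ∣ D ∣ ≡ suc d × (s ≡ + 1 ⊎ s ≡ -[1+ 0 ]))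
  sign-split (+ 0) D≢0 = ⊥-elim (D≢0 refl)
  sign-split (+ suc d) _ = + 1 , d , sym (*-identityˡ (+ suc d)) , refl , inj₁ refl
  sign-split -[1+ d ] _ = -[1+ 0 ] , d , sym (-1*i≡-i (+ suc d)) , refl , inj₂ refl

  abs-unit : ∀ a → ∃[ ε ] (a * ε ≡ + ∣ a ∣ × + ∣ a ∣ * ε ≡ a)
  abs-unit (+ m) = + 1 , *-identityʳ (+ m) , *-identityʳ (+ m)
  abs-unit -[1+ m ] = -[1+ 0 ] , trans (*-comm -[1+ m ] -[1+ 0 ]) (-1*i≡-i -[1+ m ]) , trans (*-comm (+ suc m) -[1+ 0 ]) (-1*i≡-i (+ suc m))

  bézout₂ : ∀ a b → ∃[ d ] ∃[ x ] ∃[ y ] (a * x + b * y ≡ d × (∃[ a′ ] a ≡ d * a′) × (∃[ b′ ] b ≡ d * b′))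
  bézout₂ a b with abs-unit a | abs-unit b | Bézout.lemma ∣ a ∣ ∣ b ∣
  ... | ε , aε , ε∣a∣ | η , bη , η∣b∣ | Bézout.result d gcd identity = combine identity
    where
    factor : ∀ a {m ε} → d ℕ∣.∣ m → + m * ε ≡ a → ∃[ a′ ] a ≡ + d * a′
    factor a {m} {ε} (ℕ∣.divides q m≡qd) e = + q * ε , trans (sym e) (trans (cong (_* ε) (trans (cong +_ m≡qd) (trans (pos-* q d) (*-comm (+ q) (+ d))))) (*-assoc (+ d) (+ q) ε))
    a∣ = factor a (GCD.gcd∣m gcd) ε∣a∣
    b∣ = factor b (GCD.gcd∣n gcd) η∣b∣
    lem₁ : ∀ a ε x b η y → a * (ε * x) + b * (η * - y) ≡ (a * ε) * x - y * (b * η)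
    lem₁ = solve-∀
    lem₂ : ∀ d y → d + y - y ≡ d
    lem₂ = solve-∀
    lem₃ : ∀ a ε x b η y → a * (ε * - x) + b * (η * y) ≡ (b * η) * y - x * (a * ε)
    lem₃ = solve-∀
    ints : ∀ {x y m n} → d ℕ.+ y ℕ.* n ≡ x ℕ.* m → + m * + x - + y * + n ≡ + d
    ints {x} {y} {m} {n} eq = trans (cong (_- + y * + n) (trans (*-comm (+ m) (+ x)) (trans (sym (pos-* x m)) (trans (cong +_ (sym eq)) (trans (pos-+ d (y ℕ.* n)) (cong (_+_ (+ d)) (pos-* y n))))))) (lem₂ (+ d) (+ y * + n))
    combine : Bézout.Identity d ∣ a ∣ ∣ b ∣ → ∃[ d ] ∃[ x ] ∃[ y ] (a * x + b * y ≡ d × (∃[ a′ ] a ≡ d * a′) × (∃[ b′ ] b ≡ d * b′))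
    combine (Bézout.+- x y eq) = + d , ε * + x , η * - (+ y) , trans (lem₁ a ε (+ x) b η (+ y)) (trans (cong₂ (λ p q → p * + x - + y * q) aε bη) (ints {x} {y} {∣ a ∣} {∣ b ∣} eq)) , a∣ , b∣
    combine (Bézout.-+ x y eq) = + d , ε * - (+ x) , η * + y , trans (lem₃ a ε (+ x) b η (+ y)) (trans (cong₂ (λ p q → q * + y - + x * p) aε bη) (ints {y} {x} {∣ b ∣} {∣ a ∣} eq)) , a∣ , b∣

  -- Two applications of the binary case: h divides all entries of c and is a value of c, so it is
  -- their greatest common divisor up to sign.
  bézout₃ : ∀ c → ∃[ h ] ∃[ p ] ∃[ γ ] (dot c p ≡ h × c ≡ h ·ᵖ γ)
  bézout₃ (c₁ , c₂ , c₃) with bézout₂ c₁ c₂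
  ... | d , x , y , e , (a , c₁≡) , (b , c₂≡) with bézout₂ d c₃
  ...   | h , z , w , e′ , (k , d≡) , (l , c₃≡) = h , (x * z , y * z , w) , (k * a , k * b , l) ,
    trans (trans (lem c₁ c₂ c₃ x y z w) (cong (λ t → t * z + c₃ * w) e)) e′ ,
    Pt-≡ (trans c₁≡ (trans (cong (_* a) d≡) (*-assoc h k a))) (trans c₂≡ (trans (cong (_* b) d≡) (*-assoc h k b))) c₃≡
    where
    lem : ∀ c₁ c₂ c₃ x y z w → c₁ * (x * z) + c₂ * (y * z) + c₃ * w ≡ (c₁ * x + c₂ * y) * z + c₃ * w
    lem = solve-∀

  square : ∀ {s} → s ≡ + 1 ⊎ s ≡ -[1+ 0 ] → s * s ≡ + 1
  square (inj₁ e) = cong₂ _*_ e e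
  square (inj₂ e) = cong₂ _*_ e e

  record Dual (r₁ r₂ r₃ e₁ e₂ p : Pt) : Set where
    field
      r₁e₁ : dot r₁ e₁ ≡ + 1
      r₁e₂ : dot r₁ e₂ ≡ + 0
      r₁p  : dot r₁ p ≡ + 0
      r₂e₁ : dot r₂ e₁ ≡ + 0
      r₂e₂ : dot r₂ e₂ ≡ + 1
      r₂p  : dot r₂ p ≡ + 0
      r₃e₁ : dot r₃ e₁ ≡ + 0
      r₃e₂ : dot r₃ e₂ ≡ + 0
      r₃p  : dot r₃ p ≡ + 1

  -- The rows of the inverse of the matrix with columns e₁, e₂, p: the adjugate divided by the
  -- determinant, where dividing by s = ± 1 is multiplying by s.
  dual-basis : ∀ {s} e₁ e₂ p → s ≡ + 1 ⊎ s ≡ -[1+ 0 ] → det3 e₁ e₂ p ≡ s →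
    Dual (s ·ᵖ (e₂ ✕ p)) (s ·ᵖ (p ✕ e₁)) (s ·ᵖ (e₁ ✕ e₂)) e₁ e₂ p
  dual-basis {s} e₁ e₂ p s≡±1 det≡s = record
    { r₁e₁ = s-dot e₂ p e₁ s (trans (det3-cyclic e₁ e₂ p) det≡s) ss
    ; r₁e₂ = s-dot e₂ p e₂ (+ 0) (det3-repeat₁₃ e₂ p) s0
    ; r₁p  = s-dot e₂ p p (+ 0) (det3-repeat₂₃ e₂ p) s0
    ; r₂e₁ = s-dot p e₁ e₁ (+ 0) (det3-repeat₂₃ p e₁) s0
    ; r₂e₂ = s-dot p e₁ e₂ s (trans (sym (det3-cyclic p e₁ e₂)) det≡s) ss
    ; r₂p  = s-dot p e₁ p (+ 0) (det3-repeat₁₃ p e₁) s0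
    ; r₃e₁ = s-dot e₁ e₂ e₁ (+ 0) (det3-repeat₁₃ e₁ e₂) s0
    ; r₃e₂ = s-dot e₁ e₂ e₂ (+ 0) (det3-repeat₂₃ e₁ e₂) s0
    ; r₃p  = s-dot e₁ e₂ p s det≡s ss
    }
    where
    ss : s * s ≡ + 1
    ss = square s≡±1
    s0 : s * + 0 ≡ + 0
    s0 = *-zeroʳ s
    s-dot : ∀ e f q a {b} → det3 e f q ≡ a → s * a ≡ b → dot (s ·ᵖ (e ✕ f)) q ≡ b
    s-dot e f q a e≡ sa≡ = trans (dot-·ˡ s (e ✕ f) q) (trans (cong (s *_) (trans (dot-cross e f q) e≡)) sa≡)

  dual-det : ∀ {s} e₁ e₂ p → s ≡ + 1 ⊎ s ≡ -[1+ 0 ] → det3 e₁ e₂ p ≡ s →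
    det3 (s ·ᵖ (e₂ ✕ p)) (s ·ᵖ (p ✕ e₁)) (s ·ᵖ (e₁ ✕ e₂)) ≡ s
  dual-det {s} e₁ e₂ p s≡±1 det≡s = trans (det3-·· s (e₂ ✕ p) (p ✕ e₁) (e₁ ✕ e₂)) (trans (cong (s * s * s *_) (trans (det3-cross e₁ e₂ p) (cong₂ _*_ det≡s det≡s))) (cases s≡±1))
    where
    cases : s ≡ + 1 ⊎ s ≡ -[1+ 0 ] → s * s * s * (s * s) ≡ s
    cases (inj₁ refl) = refl
    cases (inj₂ refl) = refl

  module _ {e₁ e₂ e₃ r₁ r₂ r₃ p : Pt} {n x y : ℤ} (dual : Dual r₁ r₂ r₃ e₁ e₂ p) (np : n ·ᵖ p ≡ comb e₁ e₂ e₃ x y (+ 1)) where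

    open Dual dual

    -- Solve n p = x e₁ + y e₂ + e₃ for e₃ and read the result in the basis e₁, e₂, p; this is where
    -- the signs come from.
    apex-image : apply (r₁ , r₂ , r₃) e₃ ≡ (- x , - y , n)
    apex-image = Pt-≡ (re₃ r₁ r₁e₁ r₁e₂ r₁p (lem₁ n x y)) (re₃ r₂ r₂e₁ r₂e₂ r₂p (lem₂ n x y)) (re₃ r₃ r₃e₁ r₃e₂ r₃p (lem₃ n x y))
      where
      re₃ : ∀ r {a b c t} → dot r e₁ ≡ a → dot r e₂ ≡ b → dot r p ≡ c → n * c - x * a - y * b ≡ t → dot r e₃ ≡ t
      re₃ r {a} {b} {c} ea eb ec et = trans (lem x y (dot r e₁) (dot r e₂) (dot r e₃))
        (trans (cong (λ t → t - x * dot r e₁ - y * dot r e₂) (trans (sym (dot-comb x y (+ 1) r e₁ e₂ e₃)) (trans (cong (dot r) (sym np)) (dot-·ʳ n r p))))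
        (trans (cong (λ t → n * dot r p - x * t - y * dot r e₂) ea) (trans (cong (λ t → n * dot r p - x * a - y * t) eb) (trans (cong (λ t → n * t - x * a - y * b) ec) et))))
        where
        lem : ∀ x y a b c → c ≡ (x * a + y * b + + 1 * c) - x * a - y * b
        lem = solve-∀
      lem₁ : ∀ n x y → n * + 0 - x * + 1 - y * + 0 ≡ - x
      lem₁ = solve-∀
      lem₂ : ∀ n x y → n * + 0 - x * + 0 - y * + 1 ≡ - y
      lem₂ = solve-∀
      lem₃ : ∀ n x y → n * + 1 - x * + 0 - y * + 0 ≡ n
      lem₃ = solve-∀

  apply-translate : ∀ M a b → apply M a +ᵖ (- dot (proj₁ M) b , - dot (proj₁ (proj₂ M)) b , - dot (proj₂ (proj₂ M)) b) ≡ apply M (a -ᵖ b)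
  apply-translate (r₁ , r₂ , r₃) a b = Pt-≡ (dot-- r₁ a b) (dot-- r₂ a b) (dot-- r₃ a b)

  -- The dual basis maps e₁, e₂, p to the standard basis of ℤ³.
  basis⇒normal-form : (T : Tet) {s n x y : ℤ} {p : Pt} → s ≡ + 1 ⊎ s ≡ -[1+ 0 ] → det3 (T v1 -ᵖ T v0) (T v2 -ᵖ T v0) p ≡ s →
    n ·ᵖ p ≡ comb (T v1 -ᵖ T v0) (T v2 -ᵖ T v0) (T v3 -ᵖ T v0) x y (+ 1) → Equivalent T (Tabn (- x) (- y) n)
  basis⇒normal-form T {s} {n} {x} {y} {p} s≡±1 det≡s np =
    equivalence (s ·ᵖ (e₂ ✕ p)) (s ·ᵖ (p ✕ e₁)) (s ·ᵖ (e₁ ✕ e₂)) (dual-basis e₁ e₂ p s≡±1 det≡s) (subst (λ t → t ≡ + 1 ⊎ t ≡ -[1+ 0 ]) (sym (dual-det e₁ e₂ p s≡±1 det≡s)) s≡±1)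
    where
    e₁ = T v1 -ᵖ T v0
    e₂ = T v2 -ᵖ T v0
    e₃ = T v3 -ᵖ T v0
    equivalence : ∀ r₁ r₂ r₃ → Dual r₁ r₂ r₃ e₁ e₂ p → det3 r₁ r₂ r₃ ≡ + 1 ⊎ det3 r₁ r₂ r₃ ≡ -[1+ 0 ] → Equivalent T (Tabn (- x) (- y) n)
    equivalence r₁ r₂ r₃ dual det≡±1 = M , _ , det≡±1 , (λ i → i , maps i) , (λ j → j , maps j)
      where
      open Dual dual
      M : Mat
      M = r₁ , r₂ , r₃
      maps : ∀ i → apply M (T i) +ᵖ (- dot r₁ (T v0) , - dot r₂ (T v0) , - dot r₃ (T v0)) ≡ Tabn (- x) (- y) n i
      maps zero = Pt-≡ (+-inverseʳ (dot r₁ (T v0))) (+-inverseʳ (dot r₂ (T v0))) (+-inverseʳ (dot r₃ (T v0)))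
      maps (suc zero) = trans (apply-translate M (T v1) (T v0)) (Pt-≡ r₁e₁ r₂e₁ r₃e₁)
      maps (suc (suc zero)) = trans (apply-translate M (T v2) (T v0)) (Pt-≡ r₁e₂ r₂e₂ r₃e₂)
      maps (suc (suc (suc zero))) = trans (apply-translate M (T v3) (T v0)) (apex-image dual np)

  module _ (T : Tet) (w : Pt) (one : OnePointWith T w) {N-1 : ℕ} {c : Fin 4 → ℕ} (Iw : IntBary T (+ suc N-1) (λ j → + c j) w) where

    open OnePoint T w one Iw

    -- No lattice point of the plane of v₀, v₁, v₂ is a proper point of the parallelogram spanned
    -- by e₁ and e₂: such a point or its reflection would lie in the face.
    no-reduced-point : ∀ {d r t p} → r ℕ.< suc d → t ℕ.< suc d → + suc d ·ᵖ p ≡ comb e₁ e₂ e₃ (+ r) (+ t) (+ 0) → r ≡ 0 × t ≡ 0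
    no-reduced-point {d} {r} {t} {p} r<n t<n e with r ℕ.+ t ℕ.≤? suc d
    ... | yes r+t≤n = conclude (lattice-points {d} {y} (edges⇒bary {y = λ j → + y j} Σy e))
      where
      y : Fin 4 → ℕ
      y = vec4 (suc d ℕ.∸ (r ℕ.+ t)) r t 0
      Σy : + (suc d ℕ.∸ (r ℕ.+ t)) + + r + + t + + 0 ≡ + suc d
      Σy = cong +_ (trans (ℕ.+-identityʳ _) (trans (ℕ.+-assoc (suc d ℕ.∸ (r ℕ.+ t)) r t) (ℕ.m∸n+n≡m r+t≤n)))
      vanish : ∀ {m} i j → m ℕ.< suc d → + m ≡ + suc d * δ i j → m ≡ 0
      vanish {m} i j m<n e = δ-cases (δ-01 i j)
        where
        δ-01 : ∀ i j → δ i j ≡ + 0 ⊎ δ i j ≡ + 1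
        δ-01 zero zero = inj₂ refl
        δ-01 zero (suc _) = inj₁ refl
        δ-01 (suc _) zero = inj₁ refl
        δ-01 (suc zero) (suc zero) = inj₂ refl
        δ-01 (suc zero) (suc (suc _)) = inj₁ refl
        δ-01 (suc (suc _)) (suc zero) = inj₁ refl
        δ-01 (suc (suc zero)) (suc (suc zero)) = inj₂ refl
        δ-01 (suc (suc zero)) (suc (suc (suc zero))) = inj₁ refl
        δ-01 (suc (suc (suc zero))) (suc (suc zero)) = inj₁ refl
        δ-01 (suc (suc (suc zero))) (suc (suc (suc zero))) = inj₂ refl
        δ-cases : δ i j ≡ + 0 ⊎ δ i j ≡ + 1 → m ≡ 0
        δ-cases (inj₁ δ≡0) = +-injective (trans e (trans (cong (+ suc d *_) δ≡0) (*-zeroʳ (+ suc d))))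
        δ-cases (inj₂ δ≡1) = ⊥-elim (ℕ.<-irrefl (+-injective (trans e (trans (cong (+ suc d *_) δ≡1) (*-identityʳ (+ suc d))))) m<n)
      conclude : (∃[ i ] ∀ j → + y j ≡ + suc d * δ i j) ⊎ ((∀ j → ∃[ m ] y j ≡ suc m) × (∀ j → suc N-1 ℕ.* y j ≡ suc d ℕ.* c j)) → r ≡ 0 × t ≡ 0
      conclude (inj₁ (i , f)) = vanish i v1 r<n (f v1) , vanish i v2 t<n (f v2)
      conclude (inj₂ (pos , _)) with pos v3
      ... | _ , ()
    -- The reflected point e₁ + e₂ - p has coordinates n - r, n - t and, at v₀, r + t - n. These are
    -- positive while the one at v₃ is 0, so the point is neither a vertex nor interior.
    ... | no r+t≰n = ⊥-elim (conclude (lattice-points {d} {y} (edges⇒bary {y = λ j → + y j} {q = (e₁ +ᵖ e₂) -ᵖ p} Σy (coord-ext E))))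
      where
      y : Fin 4 → ℕ
      y = vec4 (r ℕ.+ t ℕ.∸ suc d) (suc d ℕ.∸ r) (suc d ℕ.∸ t) 0
      n<r+t = ℕ.≰⇒> r+t≰n
      pos-∸ : ∀ {m n} → m ℕ.≤ n → + (n ℕ.∸ m) ≡ + n - + m
      pos-∸ {m} {n} m≤n = trans (sym (lem (+ m) (+ (n ℕ.∸ m)))) (cong (_- + m) (trans (sym (pos-+ m (n ℕ.∸ m))) (cong +_ (ℕ.m+[n∸m]≡n m≤n))))
        where
        lem : ∀ m x → m + x - m ≡ x
        lem = solve-∀
      y₀ : + y v0 ≡ + r + + t - + suc d
      y₀ = trans (pos-∸ (ℕ.<⇒≤ n<r+t)) (cong (_- + suc d) (pos-+ r t))
      Σy : + y v0 + + y v1 + + y v2 + + 0 ≡ + suc d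
      Σy = trans (cong (_+ + 0) (cong₂ _+_ (cong₂ _+_ y₀ (pos-∸ (ℕ.<⇒≤ r<n))) (pos-∸ (ℕ.<⇒≤ t<n)))) (lem (+ r) (+ t) (+ suc d))
        where
        lem : ∀ r t n → (r + t - n) + (n - r) + (n - t) + + 0 ≡ n
        lem = solve-∀
      E : ∀ k → coord (+ suc d ·ᵖ ((e₁ +ᵖ e₂) -ᵖ p)) k ≡ coord (comb e₁ e₂ e₃ (+ y v1) (+ y v2) (+ 0)) k
      E k = trans (coord-· (+ suc d) ((e₁ +ᵖ e₂) -ᵖ p) k) (trans (cong (+ suc d *_) (trans (coord-- (e₁ +ᵖ e₂) p k) (cong (_- coord p k) (coord-+ e₁ e₂ k))))
        (trans (lem (+ suc d) (coord e₁ k) (coord e₂ k) (coord p k)) (trans (cong (λ x → + suc d * coord e₁ k + + suc d * coord e₂ k - x) (trans (sym (coord-· (+ suc d) p k)) (trans (cong (λ q → coord q k) e) (coord-comb e₁ e₂ e₃ (+ r) (+ t) (+ 0) k))))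
        (trans (lem₂ (+ suc d) (+ r) (+ t) (coord e₁ k) (coord e₂ k) (coord e₃ k)) (trans (cong₂ (λ a b → a * coord e₁ k + b * coord e₂ k + + 0 * coord e₃ k) (sym (pos-∸ (ℕ.<⇒≤ r<n))) (sym (pos-∸ (ℕ.<⇒≤ t<n)))) (sym (coord-comb e₁ e₂ e₃ (+ y v1) (+ y v2) (+ 0) k)))))))
        where
        lem : ∀ n a b p → n * (a + b - p) ≡ n * a + n * b - n * p
        lem = solve-∀
        lem₂ : ∀ n r t a b c → n * a + n * b - (r * a + t * b + + 0 * c) ≡ (n - r) * a + (n - t) * b + + 0 * c
        lem₂ = solve-∀
      conclude : (∃[ i ] ∀ j → + y j ≡ + suc d * δ i j) ⊎ ((∀ j → ∃[ m ] y j ≡ suc m) × (∀ j → suc N-1 ℕ.* y j ≡ suc d ℕ.* c j)) → ⊥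
      conclude (inj₂ (pos , _)) with pos v3
      ... | _ , ()
      conclude (inj₁ (i , f)) = impossible i f
        where
        ≢0 : ∀ {a m} → 0 ℕ.< m → + m ≡ a * + 0 → ⊥
        ≢0 {a} 0<m e = ℕ.m<n⇒n≢0 0<m (+-injective (trans e (*-zeroʳ a)))
        impossible : ∀ i → (∀ j → + y j ≡ + suc d * δ i j) → ⊥
        impossible zero f = ≢0 {+ suc d} (ℕ.m<n⇒0<n∸m r<n) (f v1)
        impossible (suc zero) f = ≢0 {+ suc d} (ℕ.m<n⇒0<n∸m n<r+t) (f v0)
        impossible (suc (suc i)) f = ≢0 {+ suc d} (ℕ.m<n⇒0<n∸m r<n) (f v1)

    s : ℤ
    s = proj₁ (sign-split D D≢0)

    d : ℕ
    d = proj₁ (proj₂ (sign-split D D≢0))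

    n : ℕ
    n = suc d

    D≡sn : D ≡ s * + n
    D≡sn = proj₁ (proj₂ (proj₂ (sign-split D D≢0)))

    ∣D∣≡n : ∣ D ∣ ≡ n
    ∣D∣≡n = proj₁ (proj₂ (proj₂ (proj₂ (sign-split D D≢0))))

    s≡±1 : s ≡ + 1 ⊎ s ≡ -[1+ 0 ]
    s≡±1 = proj₂ (proj₂ (proj₂ (proj₂ (sign-split D D≢0))))

    s*s≡1 : s * s ≡ + 1
    s*s≡1 = square s≡±1

    -- Cramer's rule gives n p = X e₁ + Y e₂. Subtracting the integral parts of X / n and Y / n
    -- leaves a point to which `no-reduced-point` applies, so n divides X and Y.
    plane : ∀ p → det3 e₁ e₂ p ≡ + 0 → ∃[ x ] ∃[ y ] p ≡ (x ·ᵖ e₁) +ᵖ (y ·ᵖ e₂)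
    plane p e = X /ℕ n , Y /ℕ n , ·ᵖ-cancel (+ n) (coord-ext λ k → trans (np k) (goal k))
      where
      X = s * det3 p e₂ e₃
      Y = s * det3 e₁ p e₃
      a = X /ℕ n
      b = Y /ℕ n
      X≡ : X ≡ + (X %ℕ n) + a * + n
      X≡ = a≡a%ℕn+[a/ℕn]*n X n
      Y≡ : Y ≡ + (Y %ℕ n) + b * + n
      Y≡ = a≡a%ℕn+[a/ℕn]*n Y n
      np : ∀ k → coord (+ n ·ᵖ p) k ≡ X * coord e₁ k + Y * coord e₂ k
      np k = trans (coord-· (+ n) p k) (trans (lem₁ s (+ n) (coord p k) s*s≡1) (trans (cong (λ x → s * (x * coord p k)) (sym D≡sn))
        (trans (cong (s *_) (trans (sym (coord-· D p k)) (trans (cong (λ q → coord q k) (cramer e₁ e₂ e₃ p)) (coord-comb e₁ e₂ e₃ (det3 p e₂ e₃) (det3 e₁ p e₃) (det3 e₁ e₂ p) k))))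
        (trans (cong (λ x → s * (det3 p e₂ e₃ * coord e₁ k + det3 e₁ p e₃ * coord e₂ k + x * coord e₃ k)) e) (lem₂ s (det3 p e₂ e₃) (det3 e₁ p e₃) (coord e₁ k) (coord e₂ k) (coord e₃ k))))))
        where
        lem₁ : ∀ s n p → s * s ≡ + 1 → n * p ≡ s * (s * n * p)
        lem₁ s n p e = trans (sym (*-identityˡ (n * p))) (trans (cong (_* (n * p)) (sym e)) (lem s n p))
          where
          lem : ∀ s n p → s * s * (n * p) ≡ s * (s * n * p)
          lem = solve-∀
        lem₂ : ∀ s x y a b c → s * (x * a + y * b + + 0 * c) ≡ s * x * a + s * y * b
        lem₂ = solve-∀
      reduced : X %ℕ n ≡ 0 × Y %ℕ n ≡ 0
      reduced = no-reduced-point {p = p -ᵖ ((a ·ᵖ e₁) +ᵖ (b ·ᵖ e₂))} (n%ℕd<d X n) (n%ℕd<d Y n) (coord-ext λ k →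
        trans (coord-· (+ n) (p -ᵖ ((a ·ᵖ e₁) +ᵖ (b ·ᵖ e₂))) k) (trans (cong (+ n *_) (trans (coord-- p ((a ·ᵖ e₁) +ᵖ (b ·ᵖ e₂)) k) (cong (_-_ (coord p k)) (trans (coord-+ (a ·ᵖ e₁) (b ·ᵖ e₂) k) (cong₂ _+_ (coord-· a e₁ k) (coord-· b e₂ k))))))
        (trans (lem (+ n) (coord p k) a b (coord e₁ k) (coord e₂ k)) (trans (cong (λ x → x - (a * + n * coord e₁ k + b * + n * coord e₂ k)) (trans (sym (coord-· (+ n) p k)) (trans (np k) (cong₂ (λ x y → x * coord e₁ k + y * coord e₂ k) X≡ Y≡))))
        (trans (lem₂ (+ (X %ℕ n)) (+ (Y %ℕ n)) (a * + n) (b * + n) (coord e₁ k) (coord e₂ k) (coord e₃ k)) (sym (coord-comb e₁ e₂ e₃ (+ (X %ℕ n)) (+ (Y %ℕ n)) (+ 0) k)))))))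
        where
        lem : ∀ n p a b x y → n * (p - (a * x + b * y)) ≡ n * p - (a * n * x + b * n * y)
        lem = solve-∀
        lem₂ : ∀ r t x y a b c → (r + x) * a + (t + y) * b - (x * a + y * b) ≡ r * a + t * b + + 0 * c
        lem₂ = solve-∀
      goal : ∀ k → X * coord e₁ k + Y * coord e₂ k ≡ coord (+ n ·ᵖ ((a ·ᵖ e₁) +ᵖ (b ·ᵖ e₂))) k
      goal k = trans (cong₂ (λ x y → x * coord e₁ k + y * coord e₂ k) (trans X≡ (cong (λ r → + r + a * + n) (proj₁ reduced))) (trans Y≡ (cong (λ r → + r + b * + n) (proj₂ reduced))))
        (trans (lem (+ n) a b (coord e₁ k) (coord e₂ k)) (sym (trans (coord-· (+ n) ((a ·ᵖ e₁) +ᵖ (b ·ᵖ e₂)) k) (cong (+ n *_) (trans (coord-+ (a ·ᵖ e₁) (b ·ᵖ e₂) k) (cong₂ _+_ (coord-· a e₁ k) (coord-· b e₂ k)))))))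
        where
        lem : ∀ n a b x y → (+ 0 + a * n) * x + (+ 0 + b * n) * y ≡ n * (a * x + b * y)
        lem = solve-∀

    private
      D≡dot : dot (e₁ ✕ e₂) e₃ ≡ D
      D≡dot = dot-cross e₁ e₂ e₃

    -- Let e₁ ✕ e₂ = h γ.  All γ ✕ a lie in the plane of e₁ and e₂, hence are integral combinations
    -- of them, so that (γ ✕ a) ✕ (γ ✕ b) = det (γ, a, b) γ is a multiple of e₁ ✕ e₂ = h γ.
    module _ {h : ℤ} {γ : Pt} (e₁✕e₂ : e₁ ✕ e₂ ≡ h ·ᵖ γ) where

      hg≢0 : h * dot γ e₃ ≢ + 0
      hg≢0 hg≡0 = D≢0 (trans (sym D≡dot) (trans (cong (λ c → dot c e₃) e₁✕e₂) (trans (dot-·ˡ h γ e₃) hg≡0)))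

      ✕-in-plane : ∀ a → ∃[ x ] ∃[ y ] γ ✕ a ≡ (x ·ᵖ e₁) +ᵖ (y ·ᵖ e₂)
      ✕-in-plane a = plane (γ ✕ a) (trans (sym (dot-cross e₁ e₂ (γ ✕ a))) (trans (cong (λ c → dot c (γ ✕ a)) e₁✕e₂)
        (trans (dot-·ˡ h γ (γ ✕ a)) (trans (cong (h *_) (dot-cross-self γ a)) (*-zeroʳ h)))))

      h∣det3 : ∀ a b → ∃[ t ] det3 γ a b ≡ t * h
      h∣det3 a b = t , *-cancelʳ-≡ (det3 γ a b) (t * h) (dot γ e₃) ⦃ ≢-nonZero g≢0 ⦄
          (trans (sym (dot-·ˡ (det3 γ a b) γ e₃)) (trans (cong (λ c → dot c e₃) E) (trans (dot-·ˡ t (h ·ᵖ γ) e₃) (trans (cong (t *_) (dot-·ˡ h γ e₃)) (sym (*-assoc t h (dot γ e₃)))))))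
        where
        x = proj₁ (✕-in-plane a)
        y = proj₁ (proj₂ (✕-in-plane a))
        x′ = proj₁ (✕-in-plane b)
        y′ = proj₁ (proj₂ (✕-in-plane b))
        t = x * y′ - y * x′
        g≢0 : dot γ e₃ ≢ + 0
        g≢0 g≡0 = hg≢0 (trans (cong (h *_) g≡0) (*-zeroʳ h))
        E : det3 γ a b ·ᵖ γ ≡ t ·ᵖ (h ·ᵖ γ)
        E = trans (sym (cross-cross γ a b)) (trans (cong₂ _✕_ (proj₂ (proj₂ (✕-in-plane a))) (proj₂ (proj₂ (✕-in-plane b)))) (trans (cross-plane x y x′ y′ e₁ e₂) (cong (t ·ᵖ_) e₁✕e₂)))

      -- The entries of γ are determinants of γ with two unit vectors, so h divides each of them and
      -- hence divides γ · p = 1.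
      h-unit : ∀ p → dot (e₁ ✕ e₂) p ≡ h → ∃[ τ ] τ * h ≡ + 1
      h-unit p dot≡h = conclude (h∣det3 unit₂ unit₃) (h∣det3 unit₃ unit₁) (h∣det3 unit₁ unit₂)
        where
        instance
          h≢0 : NonZero h
          h≢0 = ≢-nonZero {h} λ h≡0 → hg≢0 (trans (cong (_* dot γ e₃) h≡0) (*-zeroˡ (dot γ e₃)))
        γp≡1 : dot γ p ≡ + 1
        γp≡1 = *-cancelˡ-≡ h (dot γ p) (+ 1) (trans (sym (dot-·ˡ h γ p)) (trans (cong (λ c → dot c p) (sym e₁✕e₂)) (trans dot≡h (sym (*-identityʳ h)))))
        lem : ∀ a b c h x y z → (a * x + b * y + c * z) * h ≡ a * h * x + b * h * y + c * h * z
        lem = solve-∀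
        conclude : (∃[ t ] det3 γ unit₂ unit₃ ≡ t * h) → (∃[ t ] det3 γ unit₃ unit₁ ≡ t * h) → (∃[ t ] det3 γ unit₁ unit₂ ≡ t * h) → ∃[ τ ] τ * h ≡ + 1
        conclude (t₁ , E₁) (t₂ , E₂) (t₃ , E₃) = t₁ * x + t₂ * y + t₃ * z ,
          trans (lem t₁ t₂ t₃ h x y z) (trans (cong₂ _+_ (cong₂ _+_ (cong (_* x) (trans (sym E₁) (det3-unit₂₃ γ))) (cong (_* y) (trans (sym E₂) (det3-unit₃₁ γ)))) (cong (_* z) (trans (sym E₃) (det3-unit₁₂ γ)))) γp≡1)
          where
          x = proj₁ p
          y = proj₁ (proj₂ p)
          z = proj₂ (proj₂ p)

    -- Together with e₁ and e₂, `point` is a basis of ℤ³, so it generates the quotient by the edge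
    -- lattice. Its coordinates at v₁, v₂, v₃ are x, y, 1 over n; thus u₃ = 1 from the outset.
    record Generator (x y : ℤ) : Set where
      constructor generator
      field
        point : Pt
        unimodular : det3 e₁ e₂ point ≡ s
        n·point : + n ·ᵖ point ≡ comb e₁ e₂ e₃ x y (+ 1)

    -- Since h is a unit, a multiple p₀ of the Bézout vector has det (e₁, e₂, p₀) = s. Then det (e₁,
    -- e₂, e₃ - n p₀) = D - n s = 0, and `plane` supplies the two coefficients.
    generator-exists : ∃[ x ] ∃[ y ] Generator x y
    generator-exists = from-plane (plane (e₃ -ᵖ (+ n ·ᵖ p₀)) in-plane)
      where
      bézout = bézout₃ (e₁ ✕ e₂)
      h = proj₁ bézout
      p = proj₁ (proj₂ bézout)
      γ = proj₁ (proj₂ (proj₂ bézout))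
      dot≡h : dot (e₁ ✕ e₂) p ≡ h
      dot≡h = proj₁ (proj₂ (proj₂ (proj₂ bézout)))
      unit : ∃[ τ ] τ * h ≡ + 1
      unit = h-unit {h} {γ} (proj₂ (proj₂ (proj₂ (proj₂ bézout)))) p dot≡h
      τ = proj₁ unit
      τh≡1 : τ * h ≡ + 1
      τh≡1 = proj₂ unit
      p₀ = (s * τ) ·ᵖ p
      det≡s : det3 e₁ e₂ p₀ ≡ s
      det≡s = trans (det3-·₃ (s * τ) e₁ e₂ p) (trans (cong (s * τ *_) (trans (sym (dot-cross e₁ e₂ p)) dot≡h)) (trans (*-assoc s τ h) (trans (cong (s *_) τh≡1) (*-identityʳ s))))
      in-plane : det3 e₁ e₂ (e₃ -ᵖ (+ n ·ᵖ p₀)) ≡ + 0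
      in-plane = trans (det3-comb₃- (+ n) e₁ e₂ p₀ e₃) (trans (cong₂ (λ a b → a - + n * b) D≡sn det≡s) (lem s (+ n)))
        where
        lem : ∀ s n → s * n - n * s ≡ + 0
        lem = solve-∀
      from-plane : (∃[ x ] ∃[ y ] e₃ -ᵖ (+ n ·ᵖ p₀) ≡ (x ·ᵖ e₁) +ᵖ (y ·ᵖ e₂)) → ∃[ x ] ∃[ y ] Generator x y
      from-plane (x , y , e) = - x , - y , generator p₀ det≡s (coord-ext λ k → trans (lem (coord (+ n ·ᵖ p₀) k) (coord e₃ k))
        (trans (cong (_-_ (coord e₃ k)) (trans (sym (coord-- e₃ (+ n ·ᵖ p₀) k)) (trans (cong (λ q → coord q k) e) (trans (coord-+ (x ·ᵖ e₁) (y ·ᵖ e₂) k) (cong₂ _+_ (coord-· x e₁ k) (coord-· y e₂ k))))))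
        (trans (lem₂ x y (coord e₁ k) (coord e₂ k) (coord e₃ k)) (sym (coord-comb e₁ e₂ e₃ (- x) (- y) (+ 1) k)))))
        where
        lem : ∀ a b → a ≡ b - (b - a)
        lem = solve-∀
        lem₂ : ∀ x y a b c → c - (x * a + y * b) ≡ - x * a + - y * b + + 1 * c
        lem₂ = solve-∀

    generator-shift : ∀ {x y} a b → Generator x y → Generator (x - a * + n) (y - b * + n)
    generator-shift {x} {y} a b (generator p det≡s np) = generator (p -ᵖ ((a ·ᵖ e₁) +ᵖ (b ·ᵖ e₂))) (trans (det3-shear a b e₁ e₂ p) det≡s)
      (coord-ext λ k → trans (coord-· (+ n) (p -ᵖ ((a ·ᵖ e₁) +ᵖ (b ·ᵖ e₂))) k) (trans (cong (+ n *_) (trans (coord-- p ((a ·ᵖ e₁) +ᵖ (b ·ᵖ e₂)) k) (cong (_-_ (coord p k)) (trans (coord-+ (a ·ᵖ e₁) (b ·ᵖ e₂) k) (cong₂ _+_ (coord-· a e₁ k) (coord-· b e₂ k))))))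
        (trans (lem (+ n) (coord p k) a b (coord e₁ k) (coord e₂ k)) (trans (cong (λ x → x - (a * + n * coord e₁ k + b * + n * coord e₂ k)) (trans (sym (coord-· (+ n) p k)) (trans (cong (λ q → coord q k) np) (coord-comb e₁ e₂ e₃ x y (+ 1) k))))
        (trans (lem₂ x y (a * + n) (b * + n) (coord e₁ k) (coord e₂ k) (coord e₃ k)) (sym (coord-comb e₁ e₂ e₃ (x - a * + n) (y - b * + n) (+ 1) k)))))))
      where
      lem : ∀ n p a b x y → n * (p - (a * x + b * y)) ≡ n * p - (a * n * x + b * n * y)
      lem = solve-∀
      lem₂ : ∀ x y p q a b c → x * a + y * b + + 1 * c - (p * a + q * b) ≡ (x - p) * a + (y - q) * b + + 1 * c
      lem₂ = solve-∀

    normal-form : ∀ {x y} → Generator x y → Equivalent T (Tabn (- x) (- y) (+ n))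
    normal-form (generator p det≡s np) = basis⇒normal-form T s≡±1 det≡s np

    -- The determinant with e₁ and e₂, corrected by the sign s, reads off the coefficient k of
    -- `point` in w - v₀; what remains lies in the plane of e₁ and e₂.
    w-multiple : ∀ {a b} → Generator a b → ∃[ k ] ∃[ x ] ∃[ y ] ∀ j → + suc N-1 * coordinates (+ n) a b k x y j ≡ + n * + c j
    w-multiple {a} {b} (generator p det≡s np) = from-plane (plane (q -ᵖ (k ·ᵖ p)) in-plane)
      where
      q = w -ᵖ T v0
      k = s * det3 e₁ e₂ q
      in-plane : det3 e₁ e₂ (q -ᵖ (k ·ᵖ p)) ≡ + 0
      in-plane = trans (det3-comb₃- k e₁ e₂ p q) (trans (cong (λ t → det3 e₁ e₂ q - k * t) det≡s) (lem s (det3 e₁ e₂ q) s*s≡1))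
        where
        lem : ∀ s t → s * s ≡ + 1 → t - s * t * s ≡ + 0
        lem s t e = trans (lem₁ s t) (trans (cong (λ x → t - x * t) e) (lem₂ t))
          where
          lem₁ : ∀ s t → t - s * t * s ≡ t - s * s * t
          lem₁ = solve-∀
          lem₂ : ∀ t → t - + 1 * t ≡ + 0
          lem₂ = solve-∀
      from-plane : (∃[ x ] ∃[ y ] q -ᵖ (k ·ᵖ p) ≡ (x ·ᵖ e₁) +ᵖ (y ·ᵖ e₂)) → ∃[ k ] ∃[ x ] ∃[ y ] ∀ j → + suc N-1 * coordinates (+ n) a b k x y j ≡ + n * + c j
      from-plane (x , y , e) = k , x , y , bary-unique D≢0 (subst (IntBary T (+ n) (coordinates (+ n) a b k x y)) v0+q≡w I) Iw
        where
        v0+q≡w : T v0 +ᵖ q ≡ w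
        v0+q≡w = coord-ext λ κ → trans (coord-+ (T v0) q κ) (trans (cong (_+_ (coord (T v0) κ)) (coord-- w (T v0) κ)) (lem (coord (T v0) κ) (coord w κ)))
          where
          lem : ∀ a b → a + (b - a) ≡ b
          lem = solve-∀
        q≡ : ∀ κ → coord q κ ≡ (x * coord e₁ κ + y * coord e₂ κ) + k * coord p κ
        q≡ κ = trans (lem (coord q κ) (k * coord p κ)) (cong (_+ k * coord p κ) (trans (cong (_-_ (coord q κ)) (sym (coord-· k p κ))) (trans (sym (coord-- q (k ·ᵖ p) κ)) (trans (cong (λ v → coord v κ) e)
          (trans (coord-+ (x ·ᵖ e₁) (y ·ᵖ e₂) κ) (cong₂ _+_ (coord-· x e₁ κ) (coord-· y e₂ κ)))))))
          where
          lem : ∀ q m → q ≡ (q - m) + m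
          lem = solve-∀
        I : IntBary T (+ n) (coordinates (+ n) a b k x y) (T v0 +ᵖ q)
        I = edges⇒bary {+ n} {coordinates (+ n) a b k x y} {q} (lem (+ n) (k * a + x * + n) (k * b + y * + n) k) (coord-ext λ κ → trans (coord-· (+ n) q κ) (trans (cong (+ n *_) (q≡ κ))
            (trans (lem₂ (+ n) k x y (coord e₁ κ) (coord e₂ κ) (coord p κ)) (trans (cong (λ t → + n * (x * coord e₁ κ + y * coord e₂ κ) + k * t) (trans (sym (coord-· (+ n) p κ)) (trans (cong (λ v → coord v κ) np) (coord-comb e₁ e₂ e₃ a b (+ 1) κ))))
            (trans (lem₃ (+ n) k x y a b (coord e₁ κ) (coord e₂ κ) (coord e₃ κ)) (sym (coord-comb e₁ e₂ e₃ (k * a + x * + n) (k * b + y * + n) k κ)))))))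
          where
          lem : ∀ n a b k → n - (a + b + k) + a + b + k ≡ n
          lem = solve-∀
          lem₂ : ∀ n k x y e f p → n * ((x * e + y * f) + k * p) ≡ n * (x * e + y * f) + k * (n * p)
          lem₂ = solve-∀
          lem₃ : ∀ n k x y a b e f h → n * (x * e + y * f) + k * (a * e + b * f + + 1 * h) ≡ (k * a + x * n) * e + (k * b + y * n) * f + k * h
          lem₃ = solve-∀

    -- Coordinates congruent modulo n differ by a combination of edges: k times the generator minus
    -- t₁ e₁ + t₂ e₂ + t₃ e₃ is the required lattice point, measured from v₀.
    multiple-bary : ∀ {a b} → Generator a b → ∀ k t₁ t₂ t₃ y → sum4ᶻ y ≡ + n →
      k * a ≡ y v1 + t₁ * + n → k * b ≡ y v2 + t₂ * + n → k ≡ y v3 + t₃ * + n → ∃[ p ] IntBary T (+ n) y p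
    multiple-bary {a} {b} (generator p det≡s np) k t₁ t₂ t₃ y Σy E₁ E₂ E₃ = T v0 +ᵖ q , edges⇒bary {+ n} {y} {q} Σy
        (coord-ext λ κ → trans (coord-· (+ n) q κ) (trans (cong (+ n *_) (trans (coord-- (k ·ᵖ p) (comb e₁ e₂ e₃ t₁ t₂ t₃) κ) (cong₂ _-_ (coord-· k p κ) (coord-comb e₁ e₂ e₃ t₁ t₂ t₃ κ))))
          (trans (lem₁ (+ n) k t₁ t₂ t₃ (coord e₁ κ) (coord e₂ κ) (coord e₃ κ) (coord p κ)) (trans (cong (λ t → k * t - (t₁ * + n * coord e₁ κ + t₂ * + n * coord e₂ κ + t₃ * + n * coord e₃ κ)) (trans (sym (coord-· (+ n) p κ)) (trans (cong (λ v → coord v κ) np) (coord-comb e₁ e₂ e₃ a b (+ 1) κ))))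
          (trans (lem₂ k a b (coord e₁ κ) (coord e₂ κ) (coord e₃ κ) (t₁ * + n) (t₂ * + n) (t₃ * + n)) (trans (cong₂ (λ x z → (x - t₁ * + n) * coord e₁ κ + (z - t₂ * + n) * coord e₂ κ + (k - t₃ * + n) * coord e₃ κ) E₁ E₂)
          (trans (cong (λ z → (y v1 + t₁ * + n - t₁ * + n) * coord e₁ κ + (y v2 + t₂ * + n - t₂ * + n) * coord e₂ κ + (z - t₃ * + n) * coord e₃ κ) E₃)
          (trans (lem₃ (y v1) (y v2) (y v3) (t₁ * + n) (t₂ * + n) (t₃ * + n) (coord e₁ κ) (coord e₂ κ) (coord e₃ κ)) (sym (coord-comb e₁ e₂ e₃ (y v1) (y v2) (y v3) κ))))))))))
      where
      q = (k ·ᵖ p) -ᵖ comb e₁ e₂ e₃ t₁ t₂ t₃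
      lem₁ : ∀ n k x y z a b c p → n * (k * p - (x * a + y * b + z * c)) ≡ k * (n * p) - (x * n * a + y * n * b + z * n * c)
      lem₁ = solve-∀
      lem₂ : ∀ k a b e f h x y z → k * (a * e + b * f + + 1 * h) - (x * e + y * f + z * h) ≡ (k * a - x) * e + (k * b - y) * f + (k - z) * h
      lem₂ = solve-∀
      lem₃ : ∀ a b c x y z e f h → (a + x - x) * e + (b + y - y) * f + (c + z - z) * h ≡ a * e + b * f + c * h
      lem₃ = solve-∀

-- From the geometry of T to the arithmetic of `Core`.

module CoreOfTetrahedron where

  open import Data.Nat as ℕ using (ℕ; suc; zero; NonZero)
  import Data.Nat.Properties as ℕ
  open import Data.Nat.DivMod using (_%_; _/_; m≡m%n+[m/n]*n; [m+kn]%n≡m%n; m<n⇒m%n≡m; m%n<n)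
  open import Data.Nat.Divisibility as ℕ∣ using (_∣_; divides; quotient)
  open import Data.Nat.Coprimality using (Coprime; coprime-divisor)
  import Data.Nat.Tactic.RingSolver as ℕ-Ring
  open import Data.Integer hiding (suc; NonZero; _/_; _%_)
  open import Data.Integer.Properties
  open import Data.Integer.Tactic.RingSolver
  open import Data.Fin using (Fin; zero; suc)
  open import Data.Product using (∃-syntax; _,_; proj₁; proj₂)
  open import Data.Sum using (_⊎_; inj₁; inj₂)
  open import Data.Empty using (⊥-elim)
  open import Relation.Binary.PropositionalEquality
  open import Algebra.Properties.CommutativeMonoid.Sum ℕ.+-0-commutativeMonoid using (sum)
  open import Defs
  open RationalCoordinates using (sum4ᶻ)
  open LatticePoints using (coordinates)
  open CyclicQuotient

  %-of-ℤ : ∀ {n x y} .{{_ : NonZero n}} z → + x ≡ + y + z * + n → y ℕ.< n → x % n ≡ y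
  %-of-ℤ {n} {x} {y} (+ z) e y<n = trans (cong (_% n) (+-injective (trans e (trans (cong (_+_ (+ y)) (sym (pos-* z n))) (sym (pos-+ y (z ℕ.* n))))))) (trans ([m+kn]%n≡m%n y z n) (m<n⇒m%n≡m y<n))
  %-of-ℤ {n} {x} {y} -[1+ z ] e y<n = trans (sym (trans (cong (_% n) y≡) ([m+kn]%n≡m%n x (suc z) n))) (m<n⇒m%n≡m y<n)
    where
    lem : ∀ y z n → y ≡ y + (- z) * n + z * n
    lem = solve-∀
    y≡ : y ≡ x ℕ.+ suc z ℕ.* n
    y≡ = +-injective (trans (lem (+ y) (+ suc z) (+ n)) (trans (cong₂ _+_ (sym e) (sym (pos-* (suc z) n))) (sym (pos-+ x (suc z ℕ.* n)))))

  -- The first entry stands for - 1 - a - b modulo n; adding 3 n keeps the natural subtraction exact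
  -- for a, b < n.
  u-of : (n a b : ℕ) → Fin 4 → ℕ
  u-of n a b = vec4 (3 ℕ.* n ℕ.∸ suc (a ℕ.+ b)) a b 1

  module _ {n N : ℕ} .{{_ : NonZero n}} .{{_ : NonZero N}} {c : Fin 4 → ℕ} (Σc≡N : sum c ≡ N) (0<c : ∀ j → 0 ℕ.< c j) (coprime : ∃[ j ] Coprime N (c j))
    {a b : ℕ} (a<n : a ℕ.< n) (b<n : b ℕ.< n)
    (points : ∀ k t₁ t₂ t₃ (y : Fin 4 → ℕ) → sum4ᶻ (λ j → + y j) ≡ + n → + k * + a ≡ + y v1 + t₁ * + n → + k * + b ≡ + y v2 + t₂ * + n → + k ≡ + y v3 + t₃ * + n →
       (∃[ i ] + y i ≡ + n) ⊎ (∀ j → N ℕ.* y j ≡ n ℕ.* c j))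
    (k x y : ℤ) (NW≡nc : ∀ j → + N * coordinates (+ n) (+ a) (+ b) k x y j ≡ + n * + c j)
    where

    private
      u : Fin 4 → ℕ
      u = u-of n a b

      W : Fin 4 → ℤ
      W = coordinates (+ n) (+ a) (+ b) k x y

      -- The coordinates W of w over n are integers with N Wⱼ = n cⱼ, and N is coprime to one of the
      -- cⱼ.
      N∣n : N ∣ n
      N∣n = coprime-divisor (proj₂ coprime) (divides ∣ W j ∣ (trans (ℕ.*-comm (c j) n) (trans (+-injective (trans (pos-* n (c j)) (trans (sym (NW≡nc j)) (nonneg (W j) (NW≡nc j))))) (ℕ.*-comm N ∣ W j ∣))))
        where
        j = proj₁ coprime
        nonneg : ∀ z {m} → + N * z ≡ + n * + m → + N * z ≡ + (N ℕ.* ∣ z ∣)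
        nonneg z {m} e = trans (sym (0≤i⇒+∣i∣≡i (≤-trans (+≤+ ℕ.z≤n) (≤-reflexive (trans (pos-* n m) (sym e)))))) (cong +_ (abs-* (+ N) z))

      g : ℕ
      g = quotient N∣n

      n≡Ng : n ≡ N ℕ.* g
      n≡Ng = trans (ℕ∣.m∣n⇒n≡quotient*m N∣n) (ℕ.*-comm g N)

      W≡gc : ∀ j → W j ≡ + (g ℕ.* c j)
      W≡gc j = *-cancelˡ-≡ (+ N) (W j) (+ (g ℕ.* c j)) (trans (NW≡nc j) (trans (sym (pos-* n (c j))) (trans (cong +_ (trans (cong (ℕ._* c j) n≡Ng) (ℕ.*-assoc N g (c j)))) (pos-* N (g ℕ.* c j)))))

      gc<n : ∀ j → g ℕ.* c j ℕ.< n
      gc<n j = ℕ.<-≤-trans (ℕ.*-monoʳ-< g ⦃ g≢0 ⦄ (c<N j)) (ℕ.≤-reflexive (trans (ℕ.*-comm g N) (sym n≡Ng)))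
        where
        g≢0 : NonZero g
        g≢0 = ℕ.m*n≢0⇒n≢0 N ⦃ subst NonZero n≡Ng (ℕ.>-nonZero (ℕ.n≢0⇒n>0 (ℕ.≢-nonZero⁻¹ n))) ⦄
        c<N : ∀ j → c j ℕ.< N
        c<N j = ℕ.<-≤-trans (lt j) (ℕ.≤-reflexive Σc≡N)
          where
          c₀ = c v0
          c₁ = c v1
          c₂ = c v2
          c₃ = c v3
          lt : ∀ j → c j ℕ.< sum c
          lt zero = ℕ.m<m+n c₀ (ℕ.<-≤-trans (0<c v1) (ℕ.m≤m+n c₁ _))
          lt (suc zero) = ℕ.+-mono-≤ (0<c v0) (ℕ.m≤m+n c₁ _)
          lt (suc (suc zero)) = ℕ.+-mono-≤ (0<c v0) (ℕ.≤-trans (ℕ.m≤m+n c₂ _) (ℕ.m≤n+m _ c₁))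
          lt (suc (suc (suc zero))) = ℕ.+-mono-≤ (0<c v0) (ℕ.≤-trans (ℕ.≤-trans (ℕ.m≤m+n c₃ 0) (ℕ.m≤n+m _ c₂)) (ℕ.m≤n+m _ c₁))

      1+a+b≤3n : suc (a ℕ.+ b) ℕ.≤ 3 ℕ.* n
      1+a+b≤3n = ℕ.≤-trans (ℕ.+-mono-≤ a<n (ℕ.<⇒≤ b<n)) (ℕ.+-monoʳ-≤ n (ℕ.m≤m+n n _))

      u₀ : + u v0 ≡ + 3 * + n - (+ 1 + (+ a + + b))
      u₀ = trans (lem (+ u v0) (+ 1 + (+ a + + b))) (cong (_- (+ 1 + (+ a + + b))) (trans (cong (_+_ (+ u v0)) (sym (trans (pos-+ 1 (a ℕ.+ b)) (cong (_+_ (+ 1)) (pos-+ a b))))) (trans (sym (pos-+ (u v0) (suc (a ℕ.+ b)))) (trans (cong +_ (ℕ.m∸n+n≡m 1+a+b≤3n)) (pos-* 3 n)))))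
        where
        lem : ∀ x y → x ≡ x + y - y
        lem = solve-∀

      -- As u₃ = 1, the multiple of u that gives w is the last coordinate g c₃ of w.
      wit′ : ∀ j → g ℕ.* c v3 ℕ.* u j % n ≡ g ℕ.* c j
      wit′ zero = %-of-ℤ (+ 3 * k - + 1 + x + y) (trans (pos-* (g ℕ.* c v3) (u v0)) (trans (cong₂ _*_ (sym (W≡gc v3)) u₀)
          (trans (lem k (+ a) (+ b) (+ n) x y) (cong (_+ (+ 3 * k - + 1 + x + y) * + n) (W≡gc v0))))) (gc<n v0)
        where
        lem : ∀ k a b n x y → k * (+ 3 * n - (+ 1 + (a + b))) ≡ n - (k * a + x * n + (k * b + y * n) + k) + (+ 3 * k - + 1 + x + y) * n
        lem = solve-∀
      wit′ (suc zero) = %-of-ℤ (- x) (trans (pos-* (g ℕ.* c v3) a) (trans (cong (_* + a) (sym (W≡gc v3))) (trans (lem (k * + a) x (+ n)) (cong (_+ - x * + n) (W≡gc v1))))) (gc<n v1)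
        where
        lem : ∀ p x n → p ≡ p + x * n + - x * n
        lem = solve-∀
      wit′ (suc (suc zero)) = %-of-ℤ (- y) (trans (pos-* (g ℕ.* c v3) b) (trans (cong (_* + b) (sym (W≡gc v3))) (trans (lem (k * + b) y (+ n)) (cong (_+ - y * + n) (W≡gc v2))))) (gc<n v2)
        where
        lem : ∀ p x n → p ≡ p + x * n + - x * n
        lem = solve-∀
      wit′ (suc (suc (suc zero))) = trans (cong (_% n) (ℕ.*-identityʳ (g ℕ.* c v3))) (m<n⇒m%n≡m (gc<n v3))

      Σu≡3n : sum u ≡ 3 ℕ.* n
      Σu≡3n = trans (lem (u v0) a b) (ℕ.m∸n+n≡m 1+a+b≤3n)
        where
        lem : ∀ x a b → x ℕ.+ (a ℕ.+ (b ℕ.+ (1 ℕ.+ 0))) ≡ x ℕ.+ suc (a ℕ.+ b)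
        lem = ℕ-Ring.solve-∀

      -- Residues summing to n are the coordinates of a lattice point of T. It is no vertex, because
      -- a vertex has a coordinate n and residues stay below n.
      age′ : ∀ k → sum (λ j → k ℕ.* u j % n) ≡ n → ∀ j → k ℕ.* u j % n ≡ g ℕ.* c j
      age′ k Σr≡n = conclude (points k (φ v1) (φ v2) (φ v3) r (trans (sym (lem (r v0) (r v1) (r v2) (r v3))) (cong +_ Σr≡n)) (split v1) (split v2) (trans (sym (*-identityʳ (+ k))) (split v3)))
        where
        r : Fin 4 → ℕ
        r j = k ℕ.* u j % n
        φ : Fin 4 → ℤ
        φ j = + (k ℕ.* u j / n)
        split : ∀ j → + k * + u j ≡ + r j + φ j * + n
        split j = trans (sym (pos-* k (u j))) (trans (cong +_ (m≡m%n+[m/n]*n (k ℕ.* u j) n)) (trans (pos-+ (r j) _) (cong (_+_ (+ r j)) (pos-* (k ℕ.* u j / n) n))))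
        lem : ∀ p q r s → + (p ℕ.+ (q ℕ.+ (r ℕ.+ (s ℕ.+ 0)))) ≡ + p + + q + + r + + s
        lem p q r s = cong +_ (eq p q r s)
          where
          eq : ∀ p q r s → p ℕ.+ (q ℕ.+ (r ℕ.+ (s ℕ.+ 0))) ≡ p ℕ.+ q ℕ.+ r ℕ.+ s
          eq = ℕ-Ring.solve-∀
        conclude : (∃[ i ] + r i ≡ + n) ⊎ (∀ j → N ℕ.* r j ≡ n ℕ.* c j) → ∀ j → r j ≡ g ℕ.* c j
        conclude (inj₁ (i , e)) = ⊥-elim (ℕ.<-irrefl (+-injective e) (m%n<n (k ℕ.* u i) n))
        conclude (inj₂ f) j = ℕ.*-cancelˡ-≡ (r j) (g ℕ.* c j) N (trans (f j) (trans (cong (ℕ._* c j) n≡Ng) (ℕ.*-assoc N g (c j))))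

    lift-core : ∃[ g ] Core n N g c (u-of n a b)
    lift-core = g , record
      { n≡Ng = n≡Ng
      ; Σc≡N = Σc≡N
      ; 0<c  = 0<c
      ; n∣Σu = divides 3 Σu≡3n
      ; age  = age′
      ; wit  = g ℕ.* c v3 , wit′
      }

-- Composition of equivalences, and the explicit ones with n = 20.

module Equivalences where

  open import Data.Nat as ℕ using (ℕ)
  open import Data.Integer
  open import Data.Integer.Properties
  open import Data.Integer.Tactic.RingSolver
  open import Data.Fin using (Fin; zero; suc)
  open import Data.Product using (_,_; proj₁; proj₂)
  open import Data.Sum using (_⊎_; inj₁; inj₂)
  open import Relation.Binary.PropositionalEquality
  open import Defs
  open Vectors

  combine-rows : Mat → Pt → Pt
  combine-rows (r , s , t) (a , b , c) = comb r s t a b c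

  _∘ᵐ_ : Mat → Mat → Mat
  (a , b , c) ∘ᵐ M = (combine-rows M a , combine-rows M b , combine-rows M c)

  detM-∘ : ∀ M′ M → detM (M′ ∘ᵐ M) ≡ detM M′ * detM M
  detM-∘ ((a₁ , a₂ , a₃) , (b₁ , b₂ , b₃) , (c₁ , c₂ , c₃)) ((r₁ , r₂ , r₃) , (s₁ , s₂ , s₃) , (t₁ , t₂ , t₃)) = lem a₁ a₂ a₃ b₁ b₂ b₃ c₁ c₂ c₃ r₁ r₂ r₃ s₁ s₂ s₃ t₁ t₂ t₃
    where
    lem : ∀ a₁ a₂ a₃ b₁ b₂ b₃ c₁ c₂ c₃ r₁ r₂ r₃ s₁ s₂ s₃ t₁ t₂ t₃ →
      ((a₁ * r₁ + a₂ * s₁ + a₃ * t₁) * ((b₁ * r₂ + b₂ * s₂ + b₃ * t₂) * (c₁ * r₃ + c₂ * s₃ + c₃ * t₃) - (b₁ * r₃ + b₂ * s₃ + b₃ * t₃) * (c₁ * r₂ + c₂ * s₂ + c₃ * t₂)) - (a₁ * r₂ + a₂ * s₂ + a₃ * t₂) * ((b₁ * r₁ + b₂ * s₁ + b₃ * t₁) * (c₁ * r₃ + c₂ * s₃ + c₃ * t₃) - (b₁ * r₃ + b₂ * s₃ + b₃ * t₃) * (c₁ * r₁ + c₂ * s₁ + c₃ * t₁)) + (a₁ * r₃ + a₂ * s₃ + a₃ * t₃) * ((b₁ * r₁ + b₂ * s₁ + b₃ * t₁) * (c₁ * r₂ + c₂ * s₂ + c₃ * t₂) - (b₁ * r₂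 + b₂ * s₂ + b₃ * t₂) * (c₁ * r₁ + c₂ * s₁ + c₃ * t₁))) ≡
      (a₁ * (b₂ * c₃ - b₃ * c₂) - a₂ * (b₁ * c₃ - b₃ * c₁) + a₃ * (b₁ * c₂ - b₂ * c₁)) * (r₁ * (s₂ * t₃ - s₃ * t₂) - r₂ * (s₁ * t₃ - s₃ * t₁) + r₃ * (s₁ * t₂ - s₂ * t₁))
    lem = solve-∀

  dot-combine-rows : ∀ M a v → dot (combine-rows M a) v ≡ dot a (apply M v)
  dot-combine-rows ((r₁ , r₂ , r₃) , (s₁ , s₂ , s₃) , (t₁ , t₂ , t₃)) (a₁ , a₂ , a₃) (x , y , z) = lem a₁ a₂ a₃ r₁ r₂ r₃ s₁ s₂ s₃ t₁ t₂ t₃ x y z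
    where
    lem : ∀ a₁ a₂ a₃ r₁ r₂ r₃ s₁ s₂ s₃ t₁ t₂ t₃ x y z →
      (a₁ * r₁ + a₂ * s₁ + a₃ * t₁) * x + (a₁ * r₂ + a₂ * s₂ + a₃ * t₂) * y + (a₁ * r₃ + a₂ * s₃ + a₃ * t₃) * z ≡
      a₁ * (r₁ * x + r₂ * y + r₃ * z) + a₂ * (s₁ * x + s₂ * y + s₃ * z) + a₃ * (t₁ * x + t₂ * y + t₃ * z)
    lem = solve-∀

  dot-+ : ∀ a p q → dot a (p +ᵖ q) ≡ dot a p + dot a q
  dot-+ (a , b , c) (x , y , z) (x′ , y′ , z′) = lem a b c x y z x′ y′ z′
    where
    lem : ∀ a b c x y z x′ y′ z′ → a * (x + x′) + b * (y + y′) + c * (z + z′) ≡ (a * x + b * y + c * z) + (a * x′ + b * y′ + c * z′)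
    lem = solve-∀

  Equivalent-trans : ∀ {T T′ T″} → Equivalent T T′ → Equivalent T′ T″ → Equivalent T T″
  Equivalent-trans {T} {T′} {T″} (M , u , det , to , from) (M′@(a , b , c) , u′ , det′ , to′ , from′) =
    M′ ∘ᵐ M , apply M′ u +ᵖ u′ , unimodular det det′ ,
    (λ i → proj₁ (to′ (proj₁ (to i))) , step i (proj₂ (to i)) (proj₂ (to′ (proj₁ (to i))))) ,
    (λ j → proj₁ (from (proj₁ (from′ j))) , step _ (proj₂ (from (proj₁ (from′ j)))) (proj₂ (from′ j)))
    where
    unimodular : detM M ≡ + 1 ⊎ detM M ≡ -[1+ 0 ] → detM M′ ≡ + 1 ⊎ detM M′ ≡ -[1+ 0 ] → detM (M′ ∘ᵐ M) ≡ + 1 ⊎ detM (M′ ∘ᵐ M) ≡ -[1+ 0 ]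
    unimodular (inj₁ p) (inj₁ q) = inj₁ (trans (detM-∘ M′ M) (cong₂ _*_ q p))
    unimodular (inj₁ p) (inj₂ q) = inj₂ (trans (detM-∘ M′ M) (cong₂ _*_ q p))
    unimodular (inj₂ p) (inj₁ q) = inj₂ (trans (detM-∘ M′ M) (cong₂ _*_ q p))
    unimodular (inj₂ p) (inj₂ q) = inj₁ (trans (detM-∘ M′ M) (cong₂ _*_ q p))
    row : ∀ a v x → dot (combine-rows M a) v + (dot a u + x) ≡ dot a (apply M v +ᵖ u) + x
    row a v x = trans (cong (_+ (dot a u + x)) (dot-combine-rows M a v)) (trans (sym (+-assoc (dot a (apply M v)) (dot a u) x)) (cong (_+ x) (sym (dot-+ a (apply M v) u))))
    step : ∀ i {p q} → apply M (T i) +ᵖ u ≡ p → apply M′ p +ᵖ u′ ≡ q → apply (M′ ∘ᵐ M) (T i) +ᵖ (apply M′ u +ᵖ u′) ≡ q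
    step i refl e = trans (Pt-≡ (row a (T i) (proj₁ u′)) (row b (T i) (proj₁ (proj₂ u′))) (row c (T i) (proj₂ (proj₂ u′)))) e

  -- The translation is zero, since all relabellings below fix v₀, which is the origin.
  permuting-vertices : ∀ {T T′} (M : Mat) (f g : Fin 4 → Fin 4) → detM M ≡ + 1 ⊎ detM M ≡ -[1+ 0 ] →
    (∀ i → apply M (T i) +ᵖ (+ 0 , + 0 , + 0) ≡ T′ (f i)) → (∀ j → f (g j) ≡ j) → Equivalent T T′
  permuting-vertices {T} {T′} M f g det maps fg = M , _ , det , (λ i → f i , maps i) , (λ j → g j , trans (maps (g j)) (cong T′ (fg j)))

  by-vertices : ∀ {ℓ} {P : Fin 4 → Set ℓ} → P v0 → P v1 → P v2 → P v3 → ∀ i → P i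
  by-vertices p q r s zero = p
  by-vertices p q r s (suc zero) = q
  by-vertices p q r s (suc (suc zero)) = r
  by-vertices p q r s (suc (suc (suc zero))) = s

  T3-7⇒T3-7 : Equivalent (Tabn (+ 3) (+ 7) (+ 20)) (Tabn (+ 3) (+ 7) (+ 20))
  T3-7⇒T3-7 = permuting-vertices ((+ 1 , + 0 , + 0) , (+ 0 , + 1 , + 0) , (+ 0 , + 0 , + 1)) (by-vertices v0 v1 v2 v3) (by-vertices v0 v1 v2 v3)
    (inj₁ refl) (by-vertices refl refl refl refl) (by-vertices refl refl refl refl)

  T7-3⇒T3-7 : Equivalent (Tabn (+ 7) (+ 3) (+ 20)) (Tabn (+ 3) (+ 7) (+ 20))
  T7-3⇒T3-7 = permuting-vertices ((+ 0 , + 1 , + 0) , (+ 1 , + 0 , + 0) , (+ 0 , + 0 , + 1)) (by-vertices v0 v2 v1 v3) (by-vertices v0 v2 v1 v3)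
    (inj₂ refl) (by-vertices refl refl refl refl) (by-vertices refl refl refl refl)

  -- Over 20 the generators have coordinates (13, 17, 9, 1) and (9, 17, 13, 1). Multiplied by 13 the
  -- former becomes (9, 1, 17, 13), so v₁, v₂, v₃ must go to v₃, v₁, v₂. The first two columns of
  -- the matrix are the images of v₁ and v₂, and the image of v₃ then forces the third.
  T3-11⇒T3-7 : Equivalent (Tabn (+ 3) (+ 11) (+ 20)) (Tabn (+ 3) (+ 7) (+ 20))
  T3-11⇒T3-7 = permuting-vertices ((+ 3 , + 1 , -[1+ 0 ]) , (+ 7 , + 0 , -[1+ 0 ]) , (+ 20 , + 0 , -[1+ 2 ])) (by-vertices v0 v3 v1 v2) (by-vertices v0 v2 v3 v1)
    (inj₁ refl) (by-vertices refl refl refl refl) (by-vertices refl refl refl refl)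

  T11-3⇒T3-7 : Equivalent (Tabn (+ 11) (+ 3) (+ 20)) (Tabn (+ 3) (+ 7) (+ 20))
  T11-3⇒T3-7 = permuting-vertices ((+ 1 , + 3 , -[1+ 0 ]) , (+ 0 , + 7 , -[1+ 0 ]) , (+ 0 , + 20 , -[1+ 2 ])) (by-vertices v0 v1 v3 v2) (by-vertices v0 v1 v3 v2)
    (inj₂ refl) (by-vertices refl refl refl refl) (by-vertices refl refl refl refl)

  T7-11⇒T3-7 : Equivalent (Tabn (+ 7) (+ 11) (+ 20)) (Tabn (+ 3) (+ 7) (+ 20))
  T7-11⇒T3-7 = permuting-vertices ((+ 3 , + 0 , -[1+ 0 ]) , (+ 7 , + 1 , -[1+ 2 ]) , (+ 20 , + 0 , -[1+ 6 ])) (by-vertices v0 v3 v2 v1) (by-vertices v0 v3 v2 v1)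
    (inj₂ refl) (by-vertices refl refl refl refl) (by-vertices refl refl refl refl)

  T11-7⇒T3-7 : Equivalent (Tabn (+ 11) (+ 7) (+ 20)) (Tabn (+ 3) (+ 7) (+ 20))
  T11-7⇒T3-7 = permuting-vertices ((+ 0 , + 3 , -[1+ 0 ]) , (+ 1 , + 7 , -[1+ 2 ]) , (+ 0 , + 20 , -[1+ 6 ])) (by-vertices v0 v2 v3 v1) (by-vertices v0 v3 v1 v2)
    (inj₁ refl) (by-vertices refl refl refl refl) (by-vertices refl refl refl refl)

  -- The maps here and in the next equivalence are inverse to those of `T3-11⇒T3-7` and
  -- `T7-11⇒T3-7`.
  T3-7⇒T3-11 : Equivalent (Tabn (+ 3) (+ 7) (+ 20)) (Tabn (+ 3) (+ 11) (+ 20))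
  T3-7⇒T3-11 = permuting-vertices ((+ 0 , + 3 , -[1+ 0 ]) , (+ 1 , + 11 , -[1+ 3 ]) , (+ 0 , + 20 , -[1+ 6 ])) (by-vertices v0 v2 v3 v1) (by-vertices v0 v3 v1 v2)
    (inj₁ refl) (by-vertices refl refl refl refl) (by-vertices refl refl refl refl)

  T3-7⇒T7-11 : Equivalent (Tabn (+ 3) (+ 7) (+ 20)) (Tabn (+ 7) (+ 11) (+ 20))
  T3-7⇒T7-11 = permuting-vertices ((+ 7 , + 0 , -[1+ 0 ]) , (+ 11 , + 1 , -[1+ 1 ]) , (+ 20 , + 0 , -[1+ 2 ])) (by-vertices v0 v3 v2 v1) (by-vertices v0 v3 v2 v1)
    (inj₂ refl) (by-vertices refl refl refl refl) (by-vertices refl refl refl refl)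

-- The data of the seven weight vectors, and the classification applied to T.

module Conclusions where

  open import Data.Nat as ℕ using (ℕ; suc; zero; pred; NonZero)
  import Data.Nat.Properties as ℕ
  open import Data.Nat.DivMod using (_%_; m<n⇒m%n≡m)
  open import Data.Nat.Divisibility using (_∣_)
  open import Data.Nat.Coprimality using (Coprime; coprime?)
  open import Data.Integer hiding (suc; pred; NonZero; _/_; _%_; _<_)
  open import Data.Integer.Properties
  open import Data.Integer.DivMod using (_%ℕ_; _/ℕ_; n%ℕd<d; a≡a%ℕn+[a/ℕn]*n)
  open import Data.Integer.Tactic.RingSolver
  open import Data.Rational using (1ℚ; _<_; _/_)
  import Data.Rational as ℚ
  open import Data.Fin using (Fin; zero; suc)
  open import Data.Fin.Permutation using (Permutation′; _⟨$⟩ʳ_; _⟨$⟩ˡ_; inverseʳ; flip)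
  open import Data.Product using (∃-syntax; _×_; _,_; proj₁; proj₂)
  open import Data.Sum using (_⊎_; inj₁; inj₂)
  open import Data.Unit using (tt)
  open import Data.Empty using (⊥-elim)
  open import Relation.Nullary.Decidable using (toWitness)
  open import Relation.Binary.PropositionalEquality
  open import Algebra.Properties.CommutativeMonoid.Sum ℕ.+-0-commutativeMonoid using (sum; sum-permute; sum-cong-≗)
  open import Defs
  open RationalCoordinates
  open LatticePoints
  open NormalForms
  open CyclicQuotient
  open Symmetries
  open Classification
  open CoreOfTetrahedron
  open Equivalences

  -- `frac` takes denominators of the form suc d, to which `denom ℓ` does not reduce for a variable
  -- ℓ.
  suc-pred-denom : ∀ ℓ → suc (pred (denom ℓ)) ≡ denom ℓ
  suc-pred-denom zero = refl
  suc-pred-denom (suc zero) = refl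
  suc-pred-denom (suc (suc zero)) = refl
  suc-pred-denom (suc (suc (suc zero))) = refl
  suc-pred-denom (suc (suc (suc (suc zero)))) = refl
  suc-pred-denom (suc (suc (suc (suc (suc zero))))) = refl
  suc-pred-denom (suc (suc (suc (suc (suc (suc zero)))))) = refl

  Σnumer : ∀ ℓ → sum (numer ℓ) ≡ denom ℓ
  Σnumer zero = refl
  Σnumer (suc zero) = refl
  Σnumer (suc (suc zero)) = refl
  Σnumer (suc (suc (suc zero))) = refl
  Σnumer (suc (suc (suc (suc zero)))) = refl
  Σnumer (suc (suc (suc (suc (suc zero))))) = refl
  Σnumer (suc (suc (suc (suc (suc (suc zero)))))) = refl

  numer-coprime : ∀ ℓ → Coprime (denom ℓ) (numer ℓ v0)
  numer-coprime zero = toWitness {a? = coprime? 4 1} tt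
  numer-coprime (suc zero) = toWitness {a? = coprime? 5 1} tt
  numer-coprime (suc (suc zero)) = toWitness {a? = coprime? 7 1} tt
  numer-coprime (suc (suc (suc zero))) = toWitness {a? = coprime? 11 2} tt
  numer-coprime (suc (suc (suc (suc zero)))) = toWitness {a? = coprime? 13 1} tt
  numer-coprime (suc (suc (suc (suc (suc zero))))) = toWitness {a? = coprime? 17 2} tt
  numer-coprime (suc (suc (suc (suc (suc (suc zero)))))) = toWitness {a? = coprime? 19 3} tt

  0<vec4 : ∀ {a b c d} → 0 ℕ.< a → 0 ℕ.< b → 0 ℕ.< c → 0 ℕ.< d → ∀ j → 0 ℕ.< vec4 a b c d j
  0<vec4 p q r s zero = p
  0<vec4 p q r s (suc zero) = q
  0<vec4 p q r s (suc (suc zero)) = r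
  0<vec4 p q r s (suc (suc (suc zero))) = s

  0<numer : ∀ ℓ j → 0 ℕ.< numer ℓ j
  0<numer zero = 0<vec4 ℕ.z<s ℕ.z<s ℕ.z<s ℕ.z<s
  0<numer (suc zero) = 0<vec4 ℕ.z<s ℕ.z<s ℕ.z<s ℕ.z<s
  0<numer (suc (suc zero)) = 0<vec4 ℕ.z<s ℕ.z<s ℕ.z<s ℕ.z<s
  0<numer (suc (suc (suc zero))) = 0<vec4 ℕ.z<s ℕ.z<s ℕ.z<s ℕ.z<s
  0<numer (suc (suc (suc (suc zero)))) = 0<vec4 ℕ.z<s ℕ.z<s ℕ.z<s ℕ.z<s
  0<numer (suc (suc (suc (suc (suc zero))))) = 0<vec4 ℕ.z<s ℕ.z<s ℕ.z<s ℕ.z<s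
  0<numer (suc (suc (suc (suc (suc (suc zero)))))) = 0<vec4 ℕ.z<s ℕ.z<s ℕ.z<s ℕ.z<s

  core-cong : ∀ {n N N′ g c c′ u} .{{_ : NonZero n}} → N ≡ N′ → (∀ j → c j ≡ c′ j) → Core n N g c u → Core n N′ g c′ u
  core-cong {g = g} {c} {c′} refl e C = record
    { n≡Ng = n≡Ng
    ; Σc≡N = trans (sym (sum-cong-≗ e)) Σc≡N
    ; 0<c  = λ j → subst (0 ℕ.<_) (e j) (0<c j)
    ; n∣Σu = n∣Σu
    ; age  = λ k p j → trans (age k p j) (cong (g ℕ.*_) (e j))
    ; wit  = proj₁ wit , λ j → trans (proj₂ wit j) (cong (g ℕ.*_) (e j))
    }
    where open Core C

  numer-zero : ∀ j → numer zero j ≡ 1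
  numer-zero zero = refl
  numer-zero (suc zero) = refl
  numer-zero (suc (suc zero)) = refl
  numer-zero (suc (suc (suc zero))) = refl

  bary-cong : ∀ {T μ ν p} → (∀ j → μ j ≡ ν j) → IsBarycentric T μ p → IsBarycentric T ν p
  bary-cong {T} e (Σμ , Σμv) = trans (sym (sum4-cong e)) Σμ , λ k → trans (sym (sum4-cong (λ j → cong (ℚ._* toℚ (coord (T j) k)) (e j)))) (Σμv k)

  -- For λ⁽¹⁾ all permutations of the weights agree, so the classification applies to the
  -- coordinates u = (· , a , b , 1) of T itself.
  core-conclusion : ∀ {n g a b} .{{_ : NonZero n}} ℓ (σ : Permutation′ 4) → a ℕ.< n → b ℕ.< n → 2 ℕ.≤ g →
    Core n (denom ℓ) g (λ j → numer ℓ (σ ⟨$⟩ʳ j)) (u-of n a b) → ℓ ≡ zero × n ≡ 20 × Residue a × Residue b × a ≢ b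
  core-conclusion {n} {g} {a} {b} ℓ σ a<n b<n 2≤g C = conclude (exceptional-elim ℓ g _ _ (proj₂ (proj₂ (core-exceptional {ℓ = ℓ} 2≤g Cσ λ i k → units (σ ⟨$⟩ˡ i) k))))
    where
    u = u-of n a b
    -- By `vanishing`, a multiple k of u that is 0 at one vertex is 0 at v₃ as well, where it equals
    -- k.
    units : Units n u
    units i k n∣ = subst (n ∣_) (ℕ.*-identityʳ k) (vanishing C {k} i n∣ v3)
    Cσ : Core n (denom ℓ) g (numer ℓ) (λ j → u (σ ⟨$⟩ˡ j))
    Cσ = core-cong refl (λ j → cong (numer ℓ) (inverseʳ σ)) (core-permute C (flip σ))
    -- The residues found so far belong to a permuted and rescaled generator and are dropped; those
    -- of a and b come from a second run, on `C₁`.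
    conclude : ℓ ≡ zero × g ≡ 5 × Residue _ × Residue _ × _ → ℓ ≡ zero × n ≡ 20 × Residue a × Residue b × a ≢ b
    conclude (refl , refl , _) = refl , Core.n≡Ng C , subst Residue (m<n⇒m%n≡m a<n) ra , subst Residue (m<n⇒m%n≡m b<n) rb , λ a≡b → a≢b (cong (_% n) a≡b)
      where
      C₁ : Core n 4 5 (numer zero) u
      C₁ = core-cong refl (λ j → trans (numer-zero (σ ⟨$⟩ʳ j)) (sym (numer-zero j))) C
      E = exceptional-elim zero 5 (a % n) (b % n) (normalized-exceptional {ℓ = zero} 2≤g C₁ units refl)
      ra = proj₁ (proj₂ (proj₂ E))
      rb = proj₁ (proj₂ (proj₂ (proj₂ E)))
      a≢b = proj₂ (proj₂ (proj₂ (proj₂ E)))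

  -- One case for each ordered pair. The shift by n turns - a into 20 - a, which is 11, 7 or 3 for a
  -- = 9, 13 or 17.
  residues⇒T3-7 : ∀ {T n a b} → n ≡ 20 → Residue a → Residue b → a ≢ b →
    Equivalent T (Tabn (- (+ a - + 1 * + n)) (- (+ b - + 1 * + n)) (+ n)) → Equivalent T (Tabn (+ 3) (+ 7) (+ 20))
  residues⇒T3-7 refl (inj₁ refl) (inj₁ refl) a≢b E = ⊥-elim (a≢b refl)
  residues⇒T3-7 refl (inj₁ refl) (inj₂ (inj₁ refl)) a≢b E = Equivalent-trans E T11-7⇒T3-7
  residues⇒T3-7 refl (inj₁ refl) (inj₂ (inj₂ refl)) a≢b E = Equivalent-trans E T11-3⇒T3-7
  residues⇒T3-7 refl (inj₂ (inj₁ refl)) (inj₁ refl) a≢b E = Equivalent-trans E T7-11⇒T3-7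
  residues⇒T3-7 refl (inj₂ (inj₁ refl)) (inj₂ (inj₁ refl)) a≢b E = ⊥-elim (a≢b refl)
  residues⇒T3-7 refl (inj₂ (inj₁ refl)) (inj₂ (inj₂ refl)) a≢b E = Equivalent-trans E T7-3⇒T3-7
  residues⇒T3-7 refl (inj₂ (inj₂ refl)) (inj₁ refl) a≢b E = Equivalent-trans E T3-11⇒T3-7
  residues⇒T3-7 refl (inj₂ (inj₂ refl)) (inj₂ (inj₁ refl)) a≢b E = Equivalent-trans E T3-7⇒T3-7
  residues⇒T3-7 refl (inj₂ (inj₂ refl)) (inj₂ (inj₂ refl)) a≢b E = ⊥-elim (a≢b refl)

  module _ (T : Tet) (w : Pt) (ℓ : Fin 7) (one : OnePointWith T w) (σ : Permutation′ 4) (Iλ : IsBarycentric T (permLam ℓ σ) w) where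

    private
      c : Fin 4 → ℕ
      c j = numer ℓ (σ ⟨$⟩ʳ j)

      Iw : IntBary T (+ suc (pred (denom ℓ))) (λ j → + c j) w
      Iw = barycentric⁻¹ {T} {pred (denom ℓ)} {λ j → + c j} {w} (bary-cong {T} {permLam ℓ σ} (λ j → /ᴺ≡frac (+ c j) ℓ) Iλ)

    volume : ℕ
    volume = n T w one Iw

    volume≡ : normVol T ≡ volume
    volume≡ = ∣D∣≡n T w one Iw

    reduced-generator : ∃[ a ] ∃[ b ] (a ℕ.< volume × b ℕ.< volume × Generator T w one Iw (+ a) (+ b))
    reduced-generator = reduce (generator-exists T w one Iw)
      where
      reduce : (∃[ x ] ∃[ y ] Generator T w one Iw x y) → ∃[ a ] ∃[ b ] (a ℕ.< volume × b ℕ.< volume × Generator T w one Iw (+ a) (+ b))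
      reduce (x , y , G) = x %ℕ volume , y %ℕ volume , n%ℕd<d x volume , n%ℕd<d y volume ,
        subst₂ (Generator T w one Iw) (eq x) (eq y) (generator-shift T w one Iw (x /ℕ volume) (y /ℕ volume) G)
        where
        lem : ∀ r q → r + q - q ≡ r
        lem = solve-∀
        eq : ∀ x → x - (x /ℕ volume) * + volume ≡ + (x %ℕ volume)
        eq x = trans (cong (_- (x /ℕ volume) * + volume) (a≡a%ℕn+[a/ℕn]*n x volume)) (lem (+ (x %ℕ volume)) ((x /ℕ volume) * + volume))

    tetrahedron-core : ∀ {a b} → a ℕ.< volume → b ℕ.< volume → Generator T w one Iw (+ a) (+ b) → ∃[ g ] Core volume (denom ℓ) g c (u-of volume a b)
    tetrahedron-core {a} {b} a<n b<n G = from-w (w-multiple T w one Iw G)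
      where
      points : ∀ k t₁ t₂ t₃ (y : Fin 4 → ℕ) → sum4ᶻ (λ j → + y j) ≡ + volume → + k * + a ≡ + y v1 + t₁ * + volume → + k * + b ≡ + y v2 + t₂ * + volume → + k ≡ + y v3 + t₃ * + volume →
        (∃[ i ] + y i ≡ + volume) ⊎ (∀ j → suc (pred (denom ℓ)) ℕ.* y j ≡ volume ℕ.* c j)
      points k t₁ t₂ t₃ y Σy E₁ E₂ E₃ = conclude (OnePoint.lattice-points T w one Iw (proj₂ (multiple-bary T w one Iw G (+ k) t₁ t₂ t₃ (λ j → + y j) Σy E₁ E₂ E₃)))
        where
        δ-diagonal : ∀ i → δ i i ≡ + 1
        δ-diagonal zero = refl
        δ-diagonal (suc zero) = refl
        δ-diagonal (suc (suc zero)) = refl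
        δ-diagonal (suc (suc (suc zero))) = refl
        conclude : (∃[ i ] ∀ j → + y j ≡ + volume * δ i j) ⊎ ((∀ j → ∃[ m ] y j ≡ suc m) × (∀ j → suc (pred (denom ℓ)) ℕ.* y j ≡ volume ℕ.* c j)) →
          (∃[ i ] + y i ≡ + volume) ⊎ (∀ j → suc (pred (denom ℓ)) ℕ.* y j ≡ volume ℕ.* c j)
        conclude (inj₁ (i , f)) = inj₁ (i , trans (f i) (trans (cong (+ volume *_) (δ-diagonal i)) (*-identityʳ (+ volume))))
        conclude (inj₂ (_ , f)) = inj₂ f
      from-w : (∃[ k ] ∃[ x ] ∃[ y ] ∀ j → + suc (pred (denom ℓ)) * coordinates (+ volume) (+ a) (+ b) k x y j ≡ + volume * + c j) → ∃[ g ] Core volume (denom ℓ) g c (u-of volume a b)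
      from-w (k , x , y , W) = proj₁ L , core-cong (suc-pred-denom ℓ) (λ j → refl) (proj₂ L)
        where
        L = lift-core {volume} {suc (pred (denom ℓ))} {c = c} (trans (sym (sum-permute (numer ℓ) σ)) (trans (Σnumer ℓ) (sym (suc-pred-denom ℓ)))) (λ j → 0<numer ℓ (σ ⟨$⟩ʳ j))
              (σ ⟨$⟩ˡ v0 , subst₂ Coprime (sym (suc-pred-denom ℓ)) (cong (numer ℓ) (sym (inverseʳ σ))) (numer-coprime ℓ))
              a<n b<n points k x y W

    Conclusion : ℕ → Set
    Conclusion n′ = (ℓ ≡ zero) × ((+ n′) /ᴺ ℓ ≡ (+ 5) / 1) ×
      Equivalent T (Tabn (+ 3) (+ 7) (+ 20)) ×
      Equivalent (Tabn (+ 3) (+ 7) (+ 20)) (Tabn (+ 3) (+ 11) (+ 20)) ×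
      Equivalent (Tabn (+ 3) (+ 7) (+ 20)) (Tabn (+ 7) (+ 11) (+ 20))

    conclusion : ∀ n′ → normVol T ≡ n′ → 1ℚ < (+ n′) /ᴺ ℓ → Conclusion n′
    conclusion n′ vol≡n 1<n/N = from-generator reduced-generator
      where
      volume≡n : volume ≡ n′
      volume≡n = trans (sym volume≡) vol≡n
      N<n′ : denom ℓ ℕ.< n′
      N<n′ = subst (ℕ._< n′) (suc-pred-denom ℓ) (1<frac {n′} {pred (denom ℓ)} (subst (1ℚ <_) (/ᴺ≡frac (+ n′) ℓ) 1<n/N))
      1<g : ∀ {N g m} → N ℕ.< m → m ≡ N ℕ.* g → 1 ℕ.< g
      1<g {N} {g} N<n′ n≡Ng = ℕ.*-cancelˡ-< N 1 g (ℕ.≤-<-trans (ℕ.≤-reflexive (ℕ.*-identityʳ N)) (ℕ.<-≤-trans N<n′ (ℕ.≤-reflexive n≡Ng)))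
      volume-ratio : ∀ {ℓ m} → ℓ ≡ zero → m ≡ 20 → (+ m) /ᴺ ℓ ≡ (+ 5) / 1
      volume-ratio refl refl = refl
      from-generator : (∃[ a ] ∃[ b ] (a ℕ.< volume × b ℕ.< volume × Generator T w one Iw (+ a) (+ b))) → Conclusion n′
      from-generator (a , b , a<volume , b<volume , G) = from-core (tetrahedron-core a<volume b<volume G)
        where
        from-residues : ℓ ≡ zero × volume ≡ 20 × Residue a × Residue b × a ≢ b → Conclusion n′
        from-residues (ℓ≡0 , volume≡20 , ra , rb , a≢b) =
          ℓ≡0 , volume-ratio ℓ≡0 (trans (sym volume≡n) volume≡20) ,
          residues⇒T3-7 volume≡20 ra rb a≢b (normal-form T w one Iw (generator-shift T w one Iw (+ 1) (+ 1) G)) ,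
          T3-7⇒T3-11 , T3-7⇒T7-11
        from-core : (∃[ g ] Core volume (denom ℓ) g (λ j → numer ℓ (σ ⟨$⟩ʳ j)) (u-of volume a b)) → Conclusion n′
        from-core (g , C) = from-residues (core-conclusion ℓ σ a<volume b<volume (1<g {denom ℓ} (ℕ.<-≤-trans N<n′ (ℕ.≤-reflexive (sym volume≡n))) (Core.n≡Ng C)) C)

open import Defs
open import Data.Nat using (ℕ)
open import Data.Integer using (+_)
open import Data.Rational using (1ℚ; _<_; _/_)
open import Data.Fin using (Fin; zero)
open import Data.Fin.Permutation using (Permutation′)
open import Data.Product using (_×_; _,_; ∃-syntax)
open import Relation.Binary.PropositionalEquality using (_≡_)

theorem14 : (T : Tet) (w : Pt) (n : ℕ) (ℓ : Fin 7) →
    OnePointWith T w →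
    normVol T ≡ n →
    (∃[ σ ] IsBarycentric T (permLam ℓ σ) w) →
    1ℚ < (+ n) /ᴺ ℓ →
    (ℓ ≡ zero) × ((+ n) /ᴺ ℓ ≡ (+ 5) / 1) ×
    Equivalent T (Tabn (+ 3) (+ 7) (+ 20)) ×
    Equivalent (Tabn (+ 3) (+ 7) (+ 20)) (Tabn (+ 3) (+ 11) (+ 20)) ×
    Equivalent (Tabn (+ 3) (+ 7) (+ 20)) (Tabn (+ 7) (+ 11) (+ 20))
theorem14 T w n ℓ one vol≡n (σ , Iλ) 1<n/N = Conclusions.conclusion T w ℓ one σ Iλ n vol≡n 1<n/N
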